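{- For every integer $d\ge 30$, $N_d>\frac{\sqrt d}{2}$; that is, there exists a well-rounded unimodular lattice in $\mathbb{R}^d$ whose covering radius is strictly larger than $\sqrt d/2$ (the covering radius of $\mathbb{Z}^d$).
   Context: A lattice $\Lambda\subset\mathbb{R}^d$ is \emph{well-rounded} if its shortest nonzero vectors (with respect to the Euclidean norm) span $\mathbb{R}^d$, and \emph{unimodular} if its covolume equals $1$. The \emph{covering radius} $r(\Lambda)$ of a lattice $\Lambda\subset\mathbb{R}^d$ is the least $r\ge 0$ such that $\mathbb{R}^d=\Lambda+B_r$, where $B_r$ is the closed Euclidean ball of radius $r$ centered at $0$. $N_d$ denotes the supremum of $r(\Lambda)$ over all well-rounded unimodular lattices $\Lambda\subset\mathbb{R}^d$. -}

module Defs where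

open import Data.Fin.Base using (zero; suc; toℕ; punchIn)
open import Data.Integer.Base as ℤ using (ℤ; +_; -[1+_])
import Data.Integer.Properties as ℤP
open import Data.Nat.Base as ℕ using (ℕ; zero; suc)
import Data.Nat.Properties as ℕP
open import Data.Nat.Coprimality using (1-coprimeTo) renaming (sym to coprime-sym)
open import Data.Product.Base using (Σ-syntax; ∃-syntax; _×_; _,_)
open import Data.Rational.Base as ℚ using (ℚ; mkℚ; 0ℚ; 1ℚ; ½; ↥_; ↧ₙ_)
open import Data.Rational.Properties as ℚP using (_≤?_)
open import Data.Rational.Solver using (module +-*-Solver)
open import Data.Sum.Base using (_⊎_; inj₁; inj₂)
open import Data.Vec.Functional using (Vector; foldr)
open import Algebra.Bundles using (CommutativeRing)
import Algebra.Properties.Semiring.Mult as SMult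
open import Relation.Binary.PropositionalEquality
  using (_≡_; refl; sym; trans; cong; cong₂; subst; subst₂)
open import Relation.Nullary using (¬_; Dec; yes; no; contradiction)

IsCauchy : (ℕ → ℚ) → Set
IsCauchy f = ∀ ε → 0ℚ ℚ.< ε →
  ∃[ N ] (∀ m n → N ℕ.≤ m → N ℕ.≤ n → ℚ.∣ f m ℚ.- f n ∣ ℚ.< ε)

-- Cauchy sequences are not quotiented: equality of reals is _≈_ below.
record ℝ : Set where
  constructor mkℝ
  field
    seq    : ℕ → ℚ
    cauchy : IsCauchy seq
open ℝ public

infix 4 _≈_ _≤_ _<_

_≈_ : ℝ → ℝ → Set
x ≈ y = ∀ ε → 0ℚ ℚ.< ε → ∃[ N ] (∀ n → N ℕ.≤ n → ℚ.∣ seq x n ℚ.- seq y n ∣ ℚ.< ε)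

_≤_ : ℝ → ℝ → Set
x ≤ y = ∀ ε → 0ℚ ℚ.< ε → ∃[ N ] (∀ n → N ℕ.≤ n → seq x n ℚ.< seq y n ℚ.+ ε)

_<_ : ℝ → ℝ → Set
x < y = ∃[ ε ] (0ℚ ℚ.< ε × ∃[ N ] (∀ n → N ℕ.≤ n → seq x n ℚ.+ ε ℚ.< seq y n))

open import Data.Rational.Base using (_+_; _*_; _-_; -_; ∣_∣; 1/_)
open +-*-Solver using (solve; _:+_; _:*_; _:-_; :-_; _:=_)

sum≥0 : ∀ {a b} → 0ℚ ℚ.≤ a → 0ℚ ℚ.≤ b → 0ℚ ℚ.≤ a + b
sum≥0 {a} {b} 0≤a 0≤b = ℚP.nonNegative⁻¹ (a + b)
  {{ℚP.nonNeg+nonNeg⇒nonNeg a {{ℚ.nonNegative 0≤a}} b {{ℚ.nonNegative 0≤b}}}}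

sum>0 : ∀ {a b} → 0ℚ ℚ.≤ a → 0ℚ ℚ.< b → 0ℚ ℚ.< a + b
sum>0 {a} {b} 0≤a 0<b = ℚP.positive⁻¹ (a + b)
  {{ℚP.nonNeg+pos⇒pos a {{ℚ.nonNegative 0≤a}} b {{ℚ.positive 0<b}}}}

prod≥0 : ∀ {a b} → 0ℚ ℚ.≤ a → 0ℚ ℚ.≤ b → 0ℚ ℚ.≤ a * b
prod≥0 {a} {b} 0≤a 0≤b = ℚP.nonNegative⁻¹ (a * b)
  {{ℚP.nonNeg*nonNeg⇒nonNeg a {{ℚ.nonNegative 0≤a}} b {{ℚ.nonNegative 0≤b}}}}

prod>0 : ∀ {a b} → 0ℚ ℚ.< a → 0ℚ ℚ.< b → 0ℚ ℚ.< a * b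
prod>0 {a} {b} 0<a 0<b = ℚP.positive⁻¹ (a * b)
  {{ℚP.pos*pos⇒pos a {{ℚ.positive 0<a}} b {{ℚ.positive 0<b}}}}

+-interchange : ∀ a b c d → (a - c) + (b - d) ≡ (a + b) - (c + d)
+-interchange = solve 4 (λ a b c d → (a :- c) :+ (b :- d) := (a :+ b) :- (c :+ d)) refl

*-telescope : ∀ a b c d → a * (b - d) + d * (a - c) ≡ a * b - c * d
*-telescope = solve 4 (λ a b c d → a :* (b :- d) :+ d :* (a :- c) := a :* b :- c :* d) refl

minus-swap : ∀ a b → - (a - b) ≡ b - a
minus-swap = solve 2 (λ a b → :- (a :- b) := b :- a) refl

minus-neg : ∀ a b → b - a ≡ - a - - b
minus-neg = solve 2 (λ a b → b :- a := (:- a) :- (:- b)) refl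

minus-plus : ∀ a b → (a - b) + b ≡ a
minus-plus = solve 2 (λ a b → (a :- b) :+ b := a) refl

plus-minusˡ : ∀ a b → (a + b) - a ≡ b
plus-minusˡ = solve 2 (λ a b → (a :+ b) :- a := b) refl

plus-minusʳ : ∀ a b → (a + b) - b ≡ a
plus-minusʳ = solve 2 (λ a b → (a :+ b) :- b := a) refl

square-split : ∀ b h →
  (h * h + (b + h) * (b + h)) + (h + h) * (b + h) ≡ (b + (h + h)) * (b + (h + h))
square-split = solve 2 (λ b h → h :* h :+ (b :+ h) :* (b :+ h) :+ (h :+ h) :* (b :+ h)
                             := (b :+ (h :+ h)) :* (b :+ (h :+ h))) refl

half>0 : ∀ {ε} → 0ℚ ℚ.< ε → 0ℚ ℚ.< ½ * ε
half>0 {ε} = prod>0 {½} {ε} (ℚP.positive⁻¹ ½)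

half+half : ∀ ε → ½ * ε + ½ * ε ≡ ε
half+half ε = trans (sym (ℚP.*-distribʳ-+ ε ½ ½)) (ℚP.*-identityˡ ε)

∣-∣-swap : ∀ p q → ∣ p - q ∣ ≡ ∣ q - p ∣
∣-∣-swap p q = trans (sym (ℚP.∣-p∣≡∣p∣ (p - q)))
  (cong ∣_∣ (minus-swap p q))

∣∣<-intro : ∀ {p ε} → p ℚ.< ε → - p ℚ.< ε → ∣ p ∣ ℚ.< ε
∣∣<-intro {p} a b with ℚP.∣p∣≡p∨∣p∣≡-p p
... | inj₁ e = subst (ℚ._< _) (sym e) a
... | inj₂ e = subst (ℚ._< _) (sym e) b

p≤∣p∣ : ∀ p → p ℚ.≤ ∣ p ∣
p≤∣p∣ p with ℚP.≤-total 0ℚ p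
... | inj₁ 0≤p = ℚP.≤-reflexive (sym (ℚP.0≤p⇒∣p∣≡p 0≤p))
... | inj₂ p≤0 = ℚP.≤-trans p≤0 (ℚP.0≤∣p∣ p)

minus-< : ∀ {p q r} → p ℚ.< q + r → p - q ℚ.< r
minus-< {p} {q} {r} h = subst (p - q ℚ.<_)
  (plus-minusˡ q r) (ℚP.+-monoˡ-< (- q) h)

triangle : ∀ {p} u v → u + v ≡ p → ∣ p ∣ ℚ.≤ ∣ u ∣ + ∣ v ∣
triangle u v refl = ℚP.∣p+q∣≤∣p∣+∣q∣ u v

∣p∣-∣q∣≤∣p-q∣ : ∀ p q → ∣ p ∣ - ∣ q ∣ ℚ.≤ ∣ p - q ∣
∣p∣-∣q∣≤∣p-q∣ p q = subst (∣ p ∣ - ∣ q ∣ ℚ.≤_) (plus-minusʳ ∣ p - q ∣ ∣ q ∣)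
  (ℚP.+-monoˡ-≤ (- ∣ q ∣) (triangle (p - q) q (minus-plus p q)))

∣∣p∣-∣q∣∣≤∣p-q∣ : ∀ p q → ∣ ∣ p ∣ - ∣ q ∣ ∣ ℚ.≤ ∣ p - q ∣
∣∣p∣-∣q∣∣≤∣p-q∣ p q with ℚP.∣p∣≡p∨∣p∣≡-p (∣ p ∣ - ∣ q ∣)
... | inj₁ e = subst (ℚ._≤ ∣ p - q ∣) (sym e) (∣p∣-∣q∣≤∣p-q∣ p q)
... | inj₂ e = subst (ℚ._≤ ∣ p - q ∣) (sym (trans e (minus-swap ∣ p ∣ ∣ q ∣)))
  (subst (∣ q ∣ - ∣ p ∣ ℚ.≤_) (∣-∣-swap q p) (∣p∣-∣q∣≤∣p-q∣ q p))

+-cauchy : ∀ {f g} → IsCauchy f → IsCauchy g → IsCauchy (λ n → f n + g n)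
+-cauchy {f} {g} cf cg ε 0<ε with cf (½ * ε) (half>0 0<ε) | cg (½ * ε) (half>0 0<ε)
... | N₁ , h₁ | N₂ , h₂ = N₁ ℕ.⊔ N₂ , λ m n lm ln →
  ℚP.≤-<-trans
    (triangle (f m - f n) (g m - g n) (+-interchange (f m) (g m) (f n) (g n)))
    (subst (∣ f m - f n ∣ + ∣ g m - g n ∣ ℚ.<_) (half+half ε)
      (ℚP.+-mono-<
        (h₁ m n (ℕP.m⊔n≤o⇒m≤o N₁ N₂ lm) (ℕP.m⊔n≤o⇒m≤o N₁ N₂ ln))
        (h₂ m n (ℕP.m⊔n≤o⇒n≤o N₁ N₂ lm) (ℕP.m⊔n≤o⇒n≤o N₁ N₂ ln))))

neg-cauchy : ∀ {f} → IsCauchy f → IsCauchy (λ n → - f n)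
neg-cauchy {f} cf ε 0<ε with cf ε 0<ε
... | N , h = N , λ m n lm ln → subst (ℚ._< ε)
  (cong ∣_∣ (minus-neg (f m) (f n)))
  (h n m ln lm)

abs-cauchy : ∀ {f} → IsCauchy f → IsCauchy (λ n → ∣ f n ∣)
abs-cauchy {f} cf ε 0<ε with cf ε 0<ε
... | N , h = N , λ m n lm ln →
  ℚP.≤-<-trans (∣∣p∣-∣q∣∣≤∣p-q∣ (f m) (f n)) (h m n lm ln)

eventually-bounded : ∀ {f} → IsCauchy f →
  ∃[ B ] (0ℚ ℚ.< B × ∃[ N ] (∀ n → N ℕ.≤ n → ∣ f n ∣ ℚ.< B))
eventually-bounded {f} cf with cf 1ℚ (ℚP.positive⁻¹ 1ℚ)
... | N , h = 1ℚ + ∣ f N ∣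
  , ℚP.<-≤-trans (ℚP.positive⁻¹ 1ℚ)
      (subst (ℚ._≤ 1ℚ + ∣ f N ∣) (ℚP.+-identityʳ 1ℚ) (ℚP.+-monoʳ-≤ 1ℚ (ℚP.0≤∣p∣ (f N))))
  , N , λ n ln → ℚP.≤-<-trans
      (triangle (f n - f N) (f N) (minus-plus (f n) (f N)))
      (ℚP.+-monoˡ-< ∣ f N ∣ (h n N ln ℕP.≤-refl))

tolerance : ∀ {B ε} → 0ℚ ℚ.< B → 0ℚ ℚ.< ε → ∃[ τ ] (0ℚ ℚ.< τ × B * τ ≡ ε)
tolerance {B} {ε} 0<B 0<ε = 1/ B * ε
  , ℚP.positive⁻¹ _ {{ℚP.pos*pos⇒pos (1/ B) {{ℚP.1/pos⇒pos B}} ε {{ℚ.positive 0<ε}}}}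
  , trans (sym (ℚP.*-assoc B (1/ B) ε))
      (trans (cong (_* ε) (ℚP.*-inverseʳ B)) (ℚP.*-identityˡ ε))
  where instance
    B-pos : ℚ.Positive B
    B-pos = ℚ.positive 0<B
    B-nonZero : ℚ.NonZero B
    B-nonZero = ℚP.pos⇒nonZero B

*-bound : ∀ {a b B τ} → 0ℚ ℚ.< B → ∣ a ∣ ℚ.< B → ∣ b ∣ ℚ.< τ → ∣ a * b ∣ ℚ.< B * τ
*-bound {a} {b} {B} {τ} 0<B ha hb = subst (ℚ._< B * τ) (sym (ℚP.∣p*q∣≡∣p∣*∣q∣ a b))
  (ℚP.≤-<-trans
    (ℚP.*-monoʳ-≤-nonNeg ∣ b ∣ {{ℚP.∣-∣-nonNeg b}} (ℚP.<⇒≤ ha))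
    (ℚP.*-monoʳ-<-pos B {{ℚ.positive 0<B}} hb))

+-bound : ∀ {u v w s t ε} → u + v ≡ w → s + t ≡ ε →
  ∣ u ∣ ℚ.< s → ∣ v ∣ ℚ.< t → ∣ w ∣ ℚ.< ε
+-bound {u} {v} refl refl hu hv = ℚP.≤-<-trans (ℚP.∣p+q∣≤∣p∣+∣q∣ u v) (ℚP.+-mono-< hu hv)

*-step : ∀ {a b c d A B σ τ ε} → 0ℚ ℚ.< A → 0ℚ ℚ.< B → A * σ ≡ ½ * ε → B * τ ≡ ½ * ε →
  ∣ a ∣ ℚ.< A → ∣ b - d ∣ ℚ.< σ → ∣ d ∣ ℚ.< B → ∣ a - c ∣ ℚ.< τ → ∣ a * b - c * d ∣ ℚ.< ε
*-step {a} {b} {c} {d} {A} {B} {σ} {τ} {ε} 0<A 0<B eσ eτ ha hbd hd hac =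
  +-bound {a * (b - d)} {d * (a - c)} {s = A * σ} {t = B * τ}
    (*-telescope a b c d)
    (trans (cong₂ _+_ eσ eτ) (half+half ε))
    (*-bound {a} {b - d} {A} {σ} 0<A ha hbd)
    (*-bound {d} {a - c} {B} {τ} 0<B hd hac)

*-cauchy : ∀ {f g} → IsCauchy f → IsCauchy g → IsCauchy (λ n → f n * g n)
*-cauchy {f} {g} cf cg ε 0<ε = combine (eventually-bounded cf) (eventually-bounded cg)
  where
  Goal = ∃[ N ] (∀ m n → N ℕ.≤ m → N ℕ.≤ n → ∣ f m * g m - f n * g n ∣ ℚ.< ε)
  Bound : (ℕ → ℚ) → Set
  Bound h = ∃[ B ] (0ℚ ℚ.< B × ∃[ N ] (∀ n → N ℕ.≤ n → ∣ h n ∣ ℚ.< B))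
  combine : Bound f → Bound g → Goal
  combine (A , 0<A , N₁ , h₁) (B , 0<B , N₂ , h₂) =
    pick (tolerance 0<A (half>0 0<ε)) (tolerance 0<B (half>0 0<ε))
    where
    Tol : ℚ → Set
    Tol C = ∃[ τ ] (0ℚ ℚ.< τ × C * τ ≡ ½ * ε)
    pick : Tol A → Tol B → Goal
    pick (σ , 0<σ , eσ) (τ , 0<τ , eτ) with cg σ 0<σ | cf τ 0<τ
    ... | N₃ , h₃ | N₄ , h₄ = N₁₂ ℕ.⊔ N₃₄ , λ m n lm ln →
      *-step {f m} {g m} {f n} {g n} 0<A 0<B eσ eτ
        (h₁ m (ℕP.m⊔n≤o⇒m≤o N₁ N₂ (first lm)))
        (h₃ m n (ℕP.m⊔n≤o⇒m≤o N₃ N₄ (second lm)) (ℕP.m⊔n≤o⇒m≤o N₃ N₄ (second ln)))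
        (h₂ n (ℕP.m⊔n≤o⇒n≤o N₁ N₂ (first ln)))
        (h₄ m n (ℕP.m⊔n≤o⇒n≤o N₃ N₄ (second lm)) (ℕP.m⊔n≤o⇒n≤o N₃ N₄ (second ln)))
      where
      N₁₂ = N₁ ℕ.⊔ N₂
      N₃₄ = N₃ ℕ.⊔ N₄
      first : ∀ {k} → N₁₂ ℕ.⊔ N₃₄ ℕ.≤ k → N₁₂ ℕ.≤ k
      first = ℕP.m⊔n≤o⇒m≤o N₁₂ N₃₄
      second : ∀ {k} → N₁₂ ℕ.⊔ N₃₄ ℕ.≤ k → N₃₄ ℕ.≤ k
      second = ℕP.m⊔n≤o⇒n≤o N₁₂ N₃₄

const-cauchy : ∀ q → IsCauchy (λ _ → q)
const-cauchy q ε 0<ε = 0 , λ m n _ _ → subst (λ z → ∣ z ∣ ℚ.< ε) (sym (ℚP.+-inverseʳ q)) 0<ε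

infixl 6 _+ℝ_ _-ℝ_
infixl 7 _*ℝ_
infix  8 -ℝ_

-- The operations act termwise.  They are opaque so that type checking never
-- normalises rational arithmetic; the seq-… equations give their values.
opaque
  fromℚ : ℚ → ℝ
  fromℚ q = mkℝ (λ _ → q) (const-cauchy q)

  _+ℝ_ : ℝ → ℝ → ℝ
  x +ℝ y = mkℝ (λ n → seq x n + seq y n) (+-cauchy {seq x} {seq y} (cauchy x) (cauchy y))

  -ℝ_ : ℝ → ℝ
  -ℝ x = mkℝ (λ n → - seq x n) (neg-cauchy {seq x} (cauchy x))

  _*ℝ_ : ℝ → ℝ → ℝ
  x *ℝ y = mkℝ (λ n → seq x n * seq y n) (*-cauchy {seq x} {seq y} (cauchy x) (cauchy y))

  ∣_∣ℝ : ℝ → ℝ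
  ∣ x ∣ℝ = mkℝ (λ n → ∣ seq x n ∣) (abs-cauchy {seq x} (cauchy x))

  seq-fromℚ : ∀ q n → seq (fromℚ q) n ≡ q
  seq-fromℚ q n = refl

  seq-+ : ∀ x y n → seq (x +ℝ y) n ≡ seq x n + seq y n
  seq-+ x y n = refl

  seq-neg : ∀ x n → seq (-ℝ x) n ≡ - seq x n
  seq-neg x n = refl

  seq-* : ∀ x y n → seq (x *ℝ y) n ≡ seq x n * seq y n
  seq-* x y n = refl

  seq-∣∣ : ∀ x n → seq ∣ x ∣ℝ n ≡ ∣ seq x n ∣
  seq-∣∣ x n = refl

_-ℝ_ : ℝ → ℝ → ℝ
x -ℝ y = x +ℝ (-ℝ y)

0ℝ 1ℝ ½ℝ : ℝ
0ℝ = fromℚ 0ℚ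
1ℝ = fromℚ 1ℚ
½ℝ = fromℚ ½

fromℤ : ℤ → ℝ
fromℤ z = fromℚ (mkℚ z 0 (coprime-sym (1-coprimeTo ℤ.∣ z ∣)))

fromℕ : ℕ → ℝ
fromℕ n = fromℤ (+ n)

unit-fraction : ℕ → ℚ
unit-fraction n = mkℚ (+ 1) n (1-coprimeTo (suc n))

choose : {P : Set} → Dec P → ℚ → ℚ → ℚ
choose (yes _) b a = b
choose (no  _) b a = a

-- Starting from 0, take k steps of length δ, refusing any step that would
-- bring the square above q.
climb : (δ q : ℚ) → ℕ → ℚ
climb δ q zero    = 0ℚ
climb δ q (suc k) =
  let a = climb δ q k
      b = a + δ
  in choose (b * b ≤? q) b a

-- The largest nonnegative multiple of 1/(n+1) whose square is at most q
-- (and 0 if q is negative).  The number of steps is large enough because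
-- q < 1 + ∣ ↥ q ∣ ≤ (1 + ∣ ↥ q ∣)².  See √-approx-lower and √-approx-upper.
√-approx : ℕ → ℚ → ℚ
√-approx n q = climb (unit-fraction n) q (suc n ℕ.* suc ℤ.∣ ↥ q ∣)

0<δ : ∀ n → 0ℚ ℚ.< unit-fraction n
0<δ n = ℚP.positive⁻¹ (unit-fraction n)

δ≤ : ∀ {ε} n → 0ℚ ℚ.< ε → ↧ₙ ε ℕ.≤ n → unit-fraction n ℚ.≤ ε
δ≤ {mkℚ (+ 0) d c} n (ℚ.*<* h) l = contradiction h (ℤP.<-irrefl refl)
δ≤ {mkℚ -[1+ a ] d c} n (ℚ.*<* ()) l
δ≤ {mkℚ (+ suc a) d c} n _ l = ℚ.*≤* (subst₂ ℤ._≤_ (sym (ℤP.*-identityˡ (+ suc d)))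
    (ℤP.pos-* (suc a) (suc n))
    (ℤ.+≤+ (ℕP.≤-trans (ℕP.≤-trans l (ℕP.n≤1+n n)) (ℕP.m≤m+n (suc n) (a ℕ.* suc n)))))

climb≥0 : ∀ {δ} q k → 0ℚ ℚ.< δ → 0ℚ ℚ.≤ climb δ q k
climb≥0 q zero 0<δ = ℚP.≤-refl
climb≥0 {δ} q (suc k) 0<δ with (climb δ q k + δ) * (climb δ q k + δ) ≤? q
... | yes _ = sum≥0 {climb δ q k} {δ} (climb≥0 q k 0<δ) (ℚP.<⇒≤ 0<δ)
... | no  _ = climb≥0 q k 0<δ

climb-square : ∀ δ q k → climb δ q k ≡ 0ℚ ⊎ climb δ q k * climb δ q k ℚ.≤ q
climb-square δ q zero = inj₁ refl
climb-square δ q (suc k) with (climb δ q k + δ) * (climb δ q k + δ) ≤? q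
... | yes h = inj₂ h
... | no  _ = climb-square δ q k

open SMult (CommutativeRing.semiring ℚP.+-*-commutativeRing)
  using (×-assocˡ; ×-assoc-*) renaming (_×_ to _·_)

climb-progress : ∀ δ q k →
  climb δ q k ≡ k · δ ⊎ q ℚ.< (climb δ q k + δ) * (climb δ q k + δ)
climb-progress δ q zero = inj₁ refl
climb-progress δ q (suc k) with (climb δ q k + δ) * (climb δ q k + δ) ≤? q
... | no  h = inj₂ (ℚP.≰⇒> h)
... | yes h with climb-progress δ q k
...   | inj₁ e = inj₁ (trans (cong (_+ δ) e) (ℚP.+-comm (k · δ) δ))
...   | inj₂ s = contradiction (ℚP.<-≤-trans s h) (ℚP.<-irrefl refl)

natℚ : ℕ → ℚ
natℚ n = mkℚ (+ n) 0 (coprime-sym (1-coprimeTo n))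

·1 : ∀ n → n · 1ℚ ≡ natℚ n
·1 zero = refl
·1 (suc n) = trans (cong (λ z → 1ℚ + z) (·1 n))
  (trans (cong (λ z → z ℚ./ 1) (cong (λ z → (+ 1) ℤ.+ z) (ℤP.*-identityʳ (+ n))))
         (ℚP.↥p/↧p≡p (natℚ (suc n))))

K·δ : ∀ n m → (suc n ℕ.* m) · unit-fraction n ≡ natℚ m
K·δ n m = trans (cong (_· δ) (ℕP.*-comm (suc n) m))
  (trans (sym (×-assocˡ δ m (suc n)))
  (trans (cong (m ·_) (trans (cong (suc n ·_) (sym (ℚP.*-identityˡ δ)))
     (trans (sym (×-assoc-* (suc n) 1ℚ δ))
     (trans (cong (_* δ) (·1 (suc n)))
            (ℚP.*-inverseʳ (natℚ (suc n)))))))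
     (·1 m)))
  where δ = unit-fraction n

q<nat : ∀ q → q ℚ.< natℚ (suc ℤ.∣ ↥ q ∣)
q<nat (mkℚ (+ p) d c) = ℚ.*<* (subst₂ ℤ._<_ (sym (ℤP.*-identityʳ (+ p)))
  (ℤP.pos-* (suc p) (suc d)) (ℤ.+<+ (ℕP.m≤m*n (suc p) (suc d))))
q<nat (mkℚ -[1+ p ] d c) = ℚP.<-trans
  (ℚP.negative⁻¹ (mkℚ -[1+ p ] d c)) (ℚP.positive⁻¹ (natℚ (suc (suc p))))

nat≤nat² : ∀ m → natℚ (suc m) ℚ.≤ natℚ (suc m) * natℚ (suc m)
nat≤nat² m = subst (ℚ._≤ natℚ (suc m) * natℚ (suc m)) (ℚP.*-identityʳ (natℚ (suc m)))
  (ℚP.*-monoˡ-≤-nonNeg (natℚ (suc m)) {1ℚ} {natℚ (suc m)} (ℚ.*≤* (ℤ.+≤+ (ℕ.s≤s ℕ.z≤n))))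

square-mono : ∀ {a b} → 0ℚ ℚ.≤ a → a ℚ.≤ b → a * a ℚ.≤ b * b
square-mono {a} {b} 0≤a a≤b = ℚP.≤-trans
  (ℚP.*-monoˡ-≤-nonNeg a {{ℚ.nonNegative 0≤a}} a≤b)
  (ℚP.*-monoʳ-≤-nonNeg b {{ℚ.nonNegative (ℚP.≤-trans 0≤a a≤b)}} a≤b)

√-approx≥0 : ∀ n q → 0ℚ ℚ.≤ √-approx n q
√-approx≥0 n q = climb≥0 q (suc n ℕ.* suc ℤ.∣ ↥ q ∣) (0<δ n)

√-approx-lower : ∀ n q → √-approx n q ≡ 0ℚ ⊎ √-approx n q * √-approx n q ℚ.≤ q
√-approx-lower n q = climb-square (unit-fraction n) q (suc n ℕ.* suc ℤ.∣ ↥ q ∣)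

√-approx-upper : ∀ n q →
  q ℚ.< (√-approx n q + unit-fraction n) * (√-approx n q + unit-fraction n)
√-approx-upper n q
  with climb-progress (unit-fraction n) q (suc n ℕ.* suc ℤ.∣ ↥ q ∣)
... | inj₂ h = h
... | inj₁ e = ℚP.<-≤-trans (q<nat q) (ℚP.≤-trans (nat≤nat² m)
    (square-mono {natℚ (suc m)} {√-approx n q + δ} (ℚP.nonNegative⁻¹ (natℚ (suc m)))
      (subst (ℚ._≤ √-approx n q + δ) (trans (ℚP.+-identityʳ (√-approx n q)) (trans e (K·δ n (suc m))))
        (ℚP.+-monoʳ-≤ (√-approx n q) (ℚP.<⇒≤ (0<δ n))))))
  where
  m = ℤ.∣ ↥ q ∣
  δ = unit-fraction n

√-modulus : ∀ {h p q} m n → 0ℚ ℚ.< h → unit-fraction n ℚ.≤ h → p - q ℚ.< h * h →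
  √-approx m p - √-approx n q ℚ.< h + h
√-modulus {h} {p} {q} m n 0<h δ≤h p-q<h² =
  minus-< {√-approx m p} {b} {h + h} (ℚP.≰⇒> too-large)
  where
  a = √-approx m p
  b = √-approx n q
  0≤b = √-approx≥0 n q
  0≤h = ℚP.<⇒≤ 0<h
  0<b+2h : 0ℚ ℚ.< b + (h + h)
  0<b+2h = sum>0 {b} {h + h} 0≤b (sum>0 {h} {h} 0≤h 0<h)
  slack : 0ℚ ℚ.≤ (h + h) * (b + h)
  slack = prod≥0 {h + h} {b + h} (sum≥0 {h} {h} 0≤h 0≤h) (sum≥0 {b} {h} 0≤b 0≤h)
  q<[b+h]² : q ℚ.< (b + h) * (b + h)
  q<[b+h]² = ℚP.<-≤-trans (√-approx-upper n q)
    (square-mono {b + unit-fraction n} {b + h}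
      (sum≥0 {b} {unit-fraction n} 0≤b (ℚP.<⇒≤ (0<δ n))) (ℚP.+-monoʳ-≤ b δ≤h))
  enlarge : h * h + (b + h) * (b + h) ℚ.≤ (b + (h + h)) * (b + (h + h))
  enlarge = subst₂ ℚ._≤_ (ℚP.+-identityʳ (h * h + (b + h) * (b + h))) (square-split b h)
    (ℚP.+-monoʳ-≤ (h * h + (b + h) * (b + h)) slack)
  p<[b+2h]² : p ℚ.< (b + (h + h)) * (b + (h + h))
  p<[b+2h]² = ℚP.<-≤-trans
    (subst (ℚ._< h * h + (b + h) * (b + h)) (minus-plus p q) (ℚP.+-mono-< p-q<h² q<[b+h]²))
    enlarge
  too-large : ¬ (b + (h + h) ℚ.≤ a)
  too-large l with √-approx-lower m p
  ... | inj₁ e = ℚP.<-irrefl refl (ℚP.<-≤-trans 0<b+2h (subst (b + (h + h) ℚ.≤_) e l))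
  ... | inj₂ a²≤p = ℚP.<-irrefl refl (ℚP.<-≤-trans p<[b+2h]²
    (ℚP.≤-trans (square-mono (ℚP.<⇒≤ 0<b+2h) l) a²≤p))

√-cauchy : ∀ {f} → IsCauchy f → IsCauchy (λ n → √-approx n (f n))
√-cauchy {f} cf ε 0<ε = finish (cf (h * h) (prod>0 {h} {h} 0<h 0<h))
  where
  h = ½ * ε
  0<h = half>0 0<ε
  D = ↧ₙ h
  finish : ∃[ N ] (∀ m n → N ℕ.≤ m → N ℕ.≤ n → ∣ f m - f n ∣ ℚ.< h * h) →
    ∃[ N ] (∀ m n → N ℕ.≤ m → N ℕ.≤ n → ∣ √-approx m (f m) - √-approx n (f n) ∣ ℚ.< ε)
  finish (N , H) = N ℕ.⊔ D , λ m n lm ln → ∣∣<-intro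
    (one m n lm ln)
    (subst (ℚ._< ε) (sym (minus-swap (√-approx m (f m)) (√-approx n (f n)))) (one n m ln lm))
    where
    one : ∀ m n → N ℕ.⊔ D ℕ.≤ m → N ℕ.⊔ D ℕ.≤ n → √-approx m (f m) - √-approx n (f n) ℚ.< ε
    one m n lm ln = subst (√-approx m (f m) - √-approx n (f n) ℚ.<_) (half+half ε)
      (√-modulus {h} {f m} {f n} m n 0<h (δ≤ n 0<h (ℕP.m⊔n≤o⇒n≤o N D ln))
        (ℚP.≤-<-trans (p≤∣p∣ (f m - f n))
          (H m n (ℕP.m⊔n≤o⇒m≤o N D lm) (ℕP.m⊔n≤o⇒m≤o N D ln))))

-- The square root of x for x ≥ 0, and 0 for x < 0.
opaque
  √_ : ℝ → ℝ
  √ x = mkℝ (λ n → √-approx n (seq x n)) (√-cauchy {seq x} (cauchy x))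

  seq-√ : ∀ x n → seq (√ x) n ≡ √-approx n (seq x n)
  seq-√ x n = refl

ℝ^ : ℕ → Set
ℝ^ d = Vector ℝ d

infix 4 _≈ᵥ_

_≈ᵥ_ : ∀ {d} → ℝ^ d → ℝ^ d → Set
v ≈ᵥ w = ∀ i → v i ≈ w i

0ᵥ : ∀ {d} → ℝ^ d
0ᵥ i = 0ℝ

_-ᵥ_ : ∀ {d} → ℝ^ d → ℝ^ d → ℝ^ d
(v -ᵥ w) i = v i -ℝ w i

sum : ∀ {n} → Vector ℝ n → ℝ
sum = foldr _+ℝ_ 0ℝ

∥_∥ : ∀ {d} → ℝ^ d → ℝ
∥ v ∥ = √ (sum λ i → v i *ℝ v i)

combination : ∀ {d k} → Vector ℝ k → Vector (ℝ^ d) k → ℝ^ d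
combination c b j = sum λ i → c i *ℝ b i j

LinearlyIndependent : ∀ {d k} → Vector (ℝ^ d) k → Set
LinearlyIndependent b = ∀ c → combination c b ≈ᵥ 0ᵥ → ∀ i → c i ≈ 0ℝ

Spans : ∀ {d} → (ℝ^ d → Set) → Set
Spans {d} S = ∀ (x : ℝ^ d) →
  ∃[ k ] Σ[ b ∈ Vector (ℝ^ d) k ] Σ[ c ∈ Vector ℝ k ]
    ((∀ i → S (b i)) × x ≈ᵥ combination c b)

alternating : ℕ → ℝ → ℝ
alternating zero    x = x
alternating (suc n) x = -ℝ alternating n x

-- Laplace expansion along row 0.
det : ∀ {n} → Vector (Vector ℝ n) n → ℝ
det {zero}  M = 1ℝ
det {suc n} M = sum λ j →
  alternating (toℕ j) (M zero j *ℝ det (λ i k → M (suc i) (punchIn j k)))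

-- A lattice of full rank d is presented by a ℤ-basis (the rows of a matrix);
-- it is the set of vectors v with v ∈ Λ.
record Lattice (d : ℕ) : Set where
  field
    basis       : Vector (ℝ^ d) d
    independent : LinearlyIndependent basis
open Lattice public

infix 4 _∈_

_∈_ : ∀ {d} → ℝ^ d → Lattice d → Set
_∈_ {d} v Λ = Σ[ z ∈ Vector ℤ d ] v ≈ᵥ combination (λ i → fromℤ (z i)) (basis Λ)

covolume : ∀ {d} → Lattice d → ℝ
covolume Λ = ∣ det (basis Λ) ∣ℝ

Unimodular : ∀ {d} → Lattice d → Set
Unimodular Λ = covolume Λ ≈ 1ℝ

IsShortest : ∀ {d} → Lattice d → ℝ^ d → Set
IsShortest Λ v = v ∈ Λ × ¬ (v ≈ᵥ 0ᵥ) × (∀ w → w ∈ Λ → ¬ (w ≈ᵥ 0ᵥ) → ∥ v ∥ ≤ ∥ w ∥)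

WellRounded : ∀ {d} → Lattice d → Set
WellRounded Λ = Spans (IsShortest Λ)

-- ℝ^d = Λ + B_r, with B_r the closed ball.
Covers : ∀ {d} → Lattice d → ℝ → Set
Covers {d} Λ r = ∀ (x : ℝ^ d) → Σ[ v ∈ ℝ^ d ] (v ∈ Λ × ∥ x -ᵥ v ∥ ≤ r)

IsCoveringRadius : ∀ {d} → Lattice d → ℝ → Set
IsCoveringRadius Λ r =
  0ℝ ≤ r × Covers Λ r × (∀ s → 0ℝ ≤ s → Covers Λ s → r ≤ s)

WRCoveringRadius : ℕ → ℝ → Set
WRCoveringRadius d r =
  Σ[ Λ ∈ Lattice d ] (WellRounded Λ × Unimodular Λ × IsCoveringRadius Λ r)

IsSupremum : (ℝ → Set) → ℝ → Set
IsSupremum S N = (∀ x → S x → x ≤ N) × (∀ M → (∀ x → S x → x ≤ M) → N ≤ M)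

-- "N = N_d", as a relation, so that finiteness of the supremum is not presupposed.
IsN : ℕ → ℝ → Set
IsN d N = IsSupremum (WRCoveringRadius d) N

-- Scaled to minimal norm 8, the laminated lattice Λ₁₅ consists of the x ∈ ℤ¹⁵ with
-- 4 ∣ Σ xᵢ whose reduction mod 2 is a word of the [15,4,8] simplex code.  It has
-- volume 2¹², and as a word of that code vanishes in at least 7 places, (1,…,1) is at
-- squared distance at least 7 from it.  Hence Λ₁₅ ⊕ √8 ℤᵈ⁻¹⁵ is well-rounded, has volume
-- 2^((3d−21)/2), and has a point at squared distance 7 + 2 (d − 15) = 2d − 23 from it.
-- Rescaled to volume 1, its squared covering radius exceeds d/4 as soon as
-- (1 − 23/2d)ᵈ > 2⁻²¹.  The left-hand side increases with d, and the inequality holds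
-- for d = 30.

module Submission where

open import Algebra.Bundles using (CommutativeRing)
import Algebra.Properties.CommutativeMonoid.Sum as Product
import Algebra.Properties.CommutativeSemiring.Exp as CommutativeExp
import Algebra.Properties.Semiring.Exp as Exp
import Algebra.Properties.Semiring.Mult as Mult
import Algebra.Properties.Semiring.Sum as Summation
import Algebra.Solver.Ring as RingSolver
open import Algebra.Solver.Ring.AlmostCommutativeRing
  using (fromCommutativeRing; _-Raw-AlmostCommutative⟶_)
open import Data.Fin.Base as Fin using (Fin; zero; suc; toℕ)
open import Data.Integer.Base as ℤ using (ℤ; +_; -[1+_])
import Data.Integer.Properties as ℤP
open import Data.Maybe.Base as Maybe using (Maybe)
open import Data.Nat.Base as ℕ using (ℕ; zero; suc)
open import Data.Nat.Coprimality using (1-coprimeTo) renaming (sym to coprime-sym)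
import Data.Nat.Properties as ℕP
import Data.Nat.Solver as ℕSolver
open import Data.Product.Base using (Σ-syntax; ∃-syntax; _×_; _,_; proj₁; proj₂)
open import Data.Rational.Base as ℚ using (ℚ; 0ℚ; 1ℚ; ½; ↧ₙ_)
import Data.Rational.Properties as ℚP
import Data.Rational.Solver as ℚSolver
open import Data.Sum.Base as Sum using (_⊎_; inj₁; inj₂)
open import Data.Vec.Functional as Vector using (Vector)
open import Relation.Binary.Bundles using (Setoid)
open import Relation.Binary.Structures using (IsEquivalence)
open import Relation.Binary.PropositionalEquality
  using (_≡_; _≢_; refl; sym; trans; cong; cong₂; subst; subst₂; module ≡-Reasoning)
open import Relation.Nullary using (¬_; Dec; yes; no; contradiction)
open import Relation.Nullary.Decidable using (dec⇒maybe; decidable-stable; from-yes; _→-dec_)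

-- Normalising the volume calls for fractional powers of 2 that depend on d. All of them are powers
-- of one number t = 2^(1/2d), obtained as a cut, so volume one becomes an identity between powers
-- of t, and the comparison with d/4 becomes an inequality of natural numbers once both sides are
-- raised to the power d. The lattice itself stays integral: its points are integer vectors, and the
-- different scales of the two summands enter only as weights 1 and 8 in the quadratic form.
-- Spanning over ℝ is reduced to giving, for each coordinate axis, two minimal vectors whose sum
-- lies on that axis. A hole only bounds covering radii from below, whereas the theorem also asks
-- for a covering radius that exists as a real number. It is built classically as the supremum of
-- the uncovered rationals, and it is attained because only finitely many lattice points are near a
-- given point.

-- The inequality 2²¹ (2d - 23)ᵈ > (2d)ᵈ for d ≥ 30.

module DimensionBound where
  open ℕSolver.+-*-Solver using (con)
    renaming (solve to ℕ-solve; _:+_ to _⊕_; _:*_ to _⊗_; _:=_ to _⊜_)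

  ^-distribʳ-* : ∀ m n o → (m ℕ.* n) ℕ.^ o ≡ m ℕ.^ o ℕ.* n ℕ.^ o
  ^-distribʳ-* m n zero    = refl
  ^-distribʳ-* m n (suc o) = trans (cong (m ℕ.* n ℕ.*_) (^-distribʳ-* m n o))
    (ℕ-solve 4 (λ m n p q → m ⊗ n ⊗ (p ⊗ q) ⊜ m ⊗ p ⊗ (n ⊗ q)) refl m n (m ℕ.^ o) (n ℕ.^ o))

  -- Bernoulli's inequality (1 + Y/X)ᵐ ≥ 1 + mY/X with denominators cleared; the induction step
  -- discards the term in Y².
  bernoulli : ∀ X Y m → X ℕ.^ m ℕ.* (X ℕ.+ m ℕ.* Y) ℕ.≤ (X ℕ.+ Y) ℕ.^ m ℕ.* X
  bernoulli X Y zero    = ℕP.≤-reflexive (cong (ℕ._+ 0) (ℕP.+-identityʳ X))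
  bernoulli X Y (suc m) = begin
    X ℕ.* P ℕ.* (X ℕ.+ suc m ℕ.* Y)
      ≤⟨ ℕP.m≤m+n _ (P ℕ.* (m ℕ.* Y) ℕ.* Y) ⟩
    X ℕ.* P ℕ.* (X ℕ.+ suc m ℕ.* Y) ℕ.+ P ℕ.* (m ℕ.* Y) ℕ.* Y
      ≡⟨ ℕ-solve 4 (λ X Y P Z → X ⊗ P ⊗ (X ⊕ (Y ⊕ Z)) ⊕ P ⊗ Z ⊗ Y ⊜ (X ⊕ Y) ⊗ (P ⊗ (X ⊕ Z)))
           refl X Y P (m ℕ.* Y) ⟩
    (X ℕ.+ Y) ℕ.* (P ℕ.* (X ℕ.+ m ℕ.* Y))
      ≤⟨ ℕP.*-monoʳ-≤ (X ℕ.+ Y) (bernoulli X Y m) ⟩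
    (X ℕ.+ Y) ℕ.* ((X ℕ.+ Y) ℕ.^ m ℕ.* X)
      ≡⟨ ℕP.*-assoc (X ℕ.+ Y) ((X ℕ.+ Y) ℕ.^ m) X ⟨
    (X ℕ.+ Y) ℕ.* (X ℕ.+ Y) ℕ.^ m ℕ.* X ∎
    where
    open ℕP.≤-Reasoning
    P : ℕ
    P = X ℕ.^ m

  -- (1 − 23/2n)ⁿ increases with n.
  ratio-increases : ∀ A n → A ℕ.+ 23 ≡ 2 ℕ.* n → .{{ℕ.NonZero A}} → .{{ℕ.NonZero n}} →
    A ℕ.^ n ℕ.* (2 ℕ.+ 2 ℕ.* n) ℕ.^ suc n ℕ.≤ (2 ℕ.+ A) ℕ.^ suc n ℕ.* (2 ℕ.* n) ℕ.^ n
  -- With C = 2n and C′ = 2n + 2, consecutive ratios have quotient (1 + 46/(C′A))ⁿ⁺¹ · A/C, since (2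
  -- + A) C = C′A + 46. Bernoulli bounds the power below by 1 + 46 (n + 1)/(C′A), which is exactly
  -- C/A because 46 (n + 1) = 23 C′.
  ratio-increases A n A+23≡2n = ℕP.*-cancelʳ-≤ _ _ (C ℕ.* (C′ ℕ.* A)) {{nonZero}} (begin
    A ℕ.^ n ℕ.* C′ ℕ.^ suc n ℕ.* (C ℕ.* (C′ ℕ.* A))
      ≡⟨ ℕ-solve 5 (λ a c C C′ A → a ⊗ c ⊗ (C ⊗ (C′ ⊗ A)) ⊜ (c ⊗ (A ⊗ a)) ⊗ (C′ ⊗ C))
           refl (A ℕ.^ n) (C′ ℕ.^ suc n) C C′ A ⟩
    C′ ℕ.^ suc n ℕ.* A ℕ.^ suc n ℕ.* (C′ ℕ.* C)
      ≡⟨ cong₂ ℕ._*_ (sym (^-distribʳ-* C′ A (suc n))) linear ⟩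
    (C′ ℕ.* A) ℕ.^ suc n ℕ.* (C′ ℕ.* A ℕ.+ suc n ℕ.* 46)
      ≤⟨ bernoulli (C′ ℕ.* A) 46 (suc n) ⟩
    (C′ ℕ.* A ℕ.+ 46) ℕ.^ suc n ℕ.* (C′ ℕ.* A)
      ≡⟨ cong (λ X → X ℕ.^ suc n ℕ.* (C′ ℕ.* A)) shifted ⟩
    ((2 ℕ.+ A) ℕ.* C) ℕ.^ suc n ℕ.* (C′ ℕ.* A)
      ≡⟨ cong (ℕ._* (C′ ℕ.* A)) (^-distribʳ-* (2 ℕ.+ A) C (suc n)) ⟩
    (2 ℕ.+ A) ℕ.^ suc n ℕ.* (C ℕ.* C ℕ.^ n) ℕ.* (C′ ℕ.* A)
      ≡⟨ ℕ-solve 5 (λ a c C C′ A → a ⊗ (C ⊗ c) ⊗ (C′ ⊗ A) ⊜ a ⊗ c ⊗ (C ⊗ (C′ ⊗ A)))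
           refl ((2 ℕ.+ A) ℕ.^ suc n) (C ℕ.^ n) C C′ A ⟩
    (2 ℕ.+ A) ℕ.^ suc n ℕ.* C ℕ.^ n ℕ.* (C ℕ.* (C′ ℕ.* A)) ∎)
    where
    open ℕP.≤-Reasoning
    C C′ : ℕ
    C  = 2 ℕ.* n
    C′ = 2 ℕ.+ C
    nonZero : ℕ.NonZero (C ℕ.* (C′ ℕ.* A))
    nonZero = ℕP.m*n≢0 C (C′ ℕ.* A) {{ℕP.m*n≢0 2 n}} {{ℕP.m*n≢0 C′ A}}
    linear : C′ ℕ.* C ≡ C′ ℕ.* A ℕ.+ suc n ℕ.* 46
    linear = trans (cong (C′ ℕ.*_) (sym A+23≡2n))
      (ℕ-solve 2 (λ A n → (con 2 ⊕ con 2 ⊗ n) ⊗ (A ⊕ con 23)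
        ⊜ (con 2 ⊕ con 2 ⊗ n) ⊗ A ⊕ (con 1 ⊕ n) ⊗ con 46) refl A n)
    shifted : C′ ℕ.* A ℕ.+ 46 ≡ (2 ℕ.+ A) ℕ.* C
    shifted = subst (λ C → (2 ℕ.+ C) ℕ.* A ℕ.+ 46 ≡ (2 ℕ.+ A) ℕ.* C) A+23≡2n
      (ℕ-solve 1 (λ A → (con 2 ⊕ (A ⊕ con 23)) ⊗ A ⊕ con 46 ⊜ (con 2 ⊕ A) ⊗ (A ⊕ con 23)) refl A)

  ratio-step : ∀ V A n → A ℕ.+ 23 ≡ 2 ℕ.* n → .{{ℕ.NonZero A}} → .{{ℕ.NonZero n}} →
    (2 ℕ.* n) ℕ.^ n ℕ.< V ℕ.* A ℕ.^ n →
    (2 ℕ.+ 2 ℕ.* n) ℕ.^ suc n ℕ.< V ℕ.* (2 ℕ.+ A) ℕ.^ suc n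
  ratio-step V A n A+23≡2n h =
    ℕP.*-cancelˡ-< (A ℕ.^ n) ((2 ℕ.+ 2 ℕ.* n) ℕ.^ suc n) (V ℕ.* (2 ℕ.+ A) ℕ.^ suc n) (begin-strict
      A ℕ.^ n ℕ.* (2 ℕ.+ 2 ℕ.* n) ℕ.^ suc n
        ≤⟨ ratio-increases A n A+23≡2n ⟩
      (2 ℕ.+ A) ℕ.^ suc n ℕ.* (2 ℕ.* n) ℕ.^ n
        <⟨ ℕP.*-monoʳ-< ((2 ℕ.+ A) ℕ.^ suc n) {{ℕP.m^n≢0 (2 ℕ.+ A) (suc n)}} h ⟩
      (2 ℕ.+ A) ℕ.^ suc n ℕ.* (V ℕ.* A ℕ.^ n)
        ≡⟨ rotate ((2 ℕ.+ A) ℕ.^ suc n) V (A ℕ.^ n) ⟩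
      A ℕ.^ n ℕ.* (V ℕ.* (2 ℕ.+ A) ℕ.^ suc n) ∎)
    where
    open ℕP.≤-Reasoning
    rotate : ∀ x y z → x ℕ.* (y ℕ.* z) ≡ z ℕ.* (y ℕ.* x)
    rotate = ℕ-solve 3 (λ x y z → x ⊗ (y ⊗ z) ⊜ z ⊗ (y ⊗ x)) refl

  ratio-bound : ∀ V A n → A ℕ.+ 23 ≡ 2 ℕ.* n → .{{ℕ.NonZero A}} → .{{ℕ.NonZero n}} →
    (2 ℕ.* n) ℕ.^ n ℕ.< V ℕ.* A ℕ.^ n → ∀ j →
    (2 ℕ.* (j ℕ.+ n)) ℕ.^ (j ℕ.+ n) ℕ.< V ℕ.* (2 ℕ.* j ℕ.+ A) ℕ.^ (j ℕ.+ n)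
  ratio-bound V A n e h zero    = h
  ratio-bound V A n e h (suc j) = subst₂ (λ C D → C ℕ.^ suc (j ℕ.+ n) ℕ.< V ℕ.* D ℕ.^ suc (j ℕ.+ n))
    (sym (ℕP.*-suc 2 (j ℕ.+ n))) (cong (ℕ._+ A) (sym (ℕP.*-suc 2 j)))
    (ratio-step V (2 ℕ.* j ℕ.+ A) (j ℕ.+ n) shifted {{≢0 (2 ℕ.* j) A}} {{≢0 j n}}
      (ratio-bound V A n e h j))
    where
    ≢0 : ∀ m n → .{{ℕ.NonZero n}} → ℕ.NonZero (m ℕ.+ n)
    ≢0 m n = ℕ.>-nonZero (ℕP.<-≤-trans (ℕP.n≢0⇒n>0 (ℕ.≢-nonZero⁻¹ n)) (ℕP.m≤n+m n m))
    shifted : 2 ℕ.* j ℕ.+ A ℕ.+ 23 ≡ 2 ℕ.* (j ℕ.+ n)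
    shifted = trans (ℕP.+-assoc (2 ℕ.* j) A 23)
      (trans (cong (2 ℕ.* j ℕ.+_) e) (sym (ℕP.*-distribˡ-+ 2 j n)))

  -- In dimension 29 the corresponding inequality 58²⁹ < 2²¹ · 35²⁹ fails.
  dimension-30 : (2 ℕ.* 30) ℕ.^ 30 ℕ.< 2 ℕ.^ 21 ℕ.* 37 ℕ.^ 30
  dimension-30 = ℕP.<ᵇ⇒< ((2 ℕ.* 30) ℕ.^ 30) (2 ℕ.^ 21 ℕ.* 37 ℕ.^ 30) _

open DimensionBound using (ratio-bound; dimension-30)

-- The integral model of Λ₁₅ ⊕ ℤᵏ: minimum, deep hole and minimal vectors.

module ∑ℤ = Summation (CommutativeRing.semiring ℤP.+-*-commutativeRing)
open ∑ℤ using () renaming (sum to sumℤ)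

module IntegerLattice where
  open import Data.Bool.Base using (Bool; true; false; not; _∧_; _∨_; _xor_; if_then_else_)
  open import Data.Bool.Properties using (∧-comm; ∧-idem)
  open import Data.Fin using (#_)
  import Data.Fin.Properties as FinP
  open import Data.Integer.Base using (_+_; _*_; _-_; -_; _≤_)
  open import Data.Integer.DivMod using (_%ℕ_; _/ℕ_; a≡a%ℕn+[a/ℕn]*n; n%ℕd<d)
  open import Data.Integer.Solver using (module +-*-Solver)
  open import Data.Vec.Base as Vec using (Vec; _∷_; []; lookup)
  open +-*-Solver using (solve; _:+_; _:*_; _:-_; :-_; _:=_; con)

  0≤z² : ∀ z → + 0 ≤ z * z
  0≤z² (+ zero)  = ℤP.≤-refl
  0≤z² (+ suc n) = ℤ.+≤+ ℕ.z≤n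
  0≤z² -[1+ n ]  = ℤ.+≤+ ℕ.z≤n

  1≤z² : ∀ z → z ≢ + 0 → + 1 ≤ z * z
  1≤z² (+ zero)  z≢0 = contradiction refl z≢0
  1≤z² (+ suc n) z≢0 = ℤ.+≤+ (ℕ.s≤s ℕ.z≤n)
  1≤z² -[1+ n ]  z≢0 = ℤ.+≤+ (ℕ.s≤s ℕ.z≤n)

  z²≤0⇒z≡0 : ∀ z → z * z ≤ + 0 → z ≡ + 0
  z²≤0⇒z≡0 z h with z ℤP.≟ + 0
  ... | yes e = e
  ... | no z≢0 with ℤP.≤-trans (1≤z² z z≢0) h
  ... | ℤ.+≤+ ()

  sumℤ-mono : ∀ {n} {f g : Vector ℤ n} → (∀ i → f i ≤ g i) → sumℤ f ≤ sumℤ g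
  sumℤ-mono {zero}  h = ℤP.≤-refl
  sumℤ-mono {suc n} h = ℤP.+-mono-≤ (h zero) (sumℤ-mono λ i → h (suc i))

  sumℤ≥0 : ∀ {n} {f : Vector ℤ n} → (∀ i → + 0 ≤ f i) → + 0 ≤ sumℤ f
  sumℤ≥0 {n} {f} h = subst (_≤ sumℤ f) (∑ℤ.sum-replicate-zero n) (sumℤ-mono h)

  term≤sumℤ : ∀ {n} {f : Vector ℤ n} → (∀ i → + 0 ≤ f i) → ∀ i → f i ≤ sumℤ f
  term≤sumℤ {suc n} {f} h zero = subst (_≤ sumℤ f) (ℤP.+-identityʳ (f zero))
    (ℤP.+-monoʳ-≤ (f zero) (sumℤ≥0 λ i → h (suc i)))
  term≤sumℤ {suc n} {f} h (suc i) = subst (_≤ sumℤ f) (ℤP.+-identityˡ (f (suc i)))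
    (ℤP.+-mono-≤ (h zero) (term≤sumℤ (λ i → h (suc i)) i))

  δ : ∀ {n} → Fin n → Fin n → ℤ
  δ zero    zero    = + 1
  δ zero    (suc j) = + 0
  δ (suc i) zero    = + 0
  δ (suc i) (suc j) = δ i j

  sumℤ-0 : ∀ {n} {f : Vector ℤ n} → (∀ i → f i ≡ + 0) → sumℤ f ≡ + 0
  sumℤ-0 {n} h = trans (∑ℤ.sum-cong-≗ h) (∑ℤ.sum-replicate-zero n)

  sumℤ-δ : ∀ {n} (f : Vector ℤ n) j → sumℤ (λ i → f i * δ i j) ≡ f j
  sumℤ-δ {suc n} f zero = trans
    (cong₂ _+_ (ℤP.*-identityʳ (f zero)) (sumℤ-0 λ i → ℤP.*-zeroʳ (f (suc i))))
    (ℤP.+-identityʳ (f zero))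
  sumℤ-δ {suc n} f (suc j) = trans
    (cong₂ _+_ (ℤP.*-zeroʳ (f zero)) (sumℤ-δ (λ i → f (suc i)) j)) (ℤP.+-identityˡ (f (suc j)))

  image : ∀ {m n} → (Fin m → Fin n → ℤ) → Vector ℤ m → Vector ℤ n
  image M z j = sumℤ λ i → z i * M i j

  image-+ : ∀ {m n} (M : Fin m → Fin n → ℤ) z w j →
    image M (λ i → z i + w i) j ≡ image M z j + image M w j
  image-+ M z w j = trans (∑ℤ.sum-cong-≗ λ i → ℤP.*-distribʳ-+ (M i j) (z i) (w i))
    (∑ℤ.∑-distrib-+ (λ i → z i * M i j) (λ i → w i * M i j))

  image-image : ∀ {l m n} (M : Fin m → Fin n → ℤ) (N : Fin l → Fin m → ℤ) z j →
    image M (image N z) j ≡ sumℤ (λ i → z i * image M (N i) j)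
  image-image M N z j = begin
    sumℤ (λ i → sumℤ (λ l → z l * N l i) * M i j)
      ≡⟨ ∑ℤ.sum-cong-≗ (λ i → ∑ℤ.*-distribʳ-sum (M i j) (λ l → z l * N l i)) ⟩
    sumℤ (λ i → sumℤ (λ l → z l * N l i * M i j))
      ≡⟨ ∑ℤ.∑-comm (λ i l → z l * N l i * M i j) ⟩
    sumℤ (λ l → sumℤ (λ i → z l * N l i * M i j))
      ≡⟨ ∑ℤ.sum-cong-≗ (λ l → ∑ℤ.sum-cong-≗ (λ i → ℤP.*-assoc (z l) (N l i) (M i j))) ⟩
    sumℤ (λ l → sumℤ (λ i → z l * (N l i * M i j)))
      ≡⟨ ∑ℤ.sum-cong-≗ (λ l → sym (∑ℤ.*-distribˡ-sum (z l) (λ i → N l i * M i j))) ⟩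
    sumℤ (λ l → z l * image M (N l) j) ∎
    where open ≡-Reasoning

  -- Parity

  bit : Bool → ℤ
  bit true  = + 1
  bit false = + 0

  infix 4 _≋_

  -- The quotient is part of the data because divisibility of norms by 8 is later read off from the
  -- halves of even vectors.
  record _≋_ (z : ℤ) (b : Bool) : Set where
    constructor half-is
    field
      half : ℤ
      split : z ≡ bit b + + 2 * half

  parity : ∀ z → ∃[ b ] z ≋ b
  parity z with z %ℕ 2 | n%ℕd<d z 2 | a≡a%ℕn+[a/ℕn]*n z 2
  ... | 0 | _ | e = false , half-is (z /ℕ 2) (trans e (cong (λ h → + 0 + h) (ℤP.*-comm (z /ℕ 2) (+ 2))))
  ... | 1 | _ | e = true  , half-is (z /ℕ 2) (trans e (cong (λ h → + 1 + h) (ℤP.*-comm (z /ℕ 2) (+ 2))))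
  ... | suc (suc _) | ℕ.s≤s (ℕ.s≤s ()) | _

  ≋-+ : ∀ {z w a b} → z ≋ a → w ≋ b → z + w ≋ a xor b
  ≋-+ {a = a} {b} (half-is x refl) (half-is y refl) = half-is (bit (a ∧ b) + (x + y)) (begin
    bit a + + 2 * x + (bit b + + 2 * y)
      ≡⟨ solve 4 (λ a x b y → (a :+ con (+ 2) :* x) :+ (b :+ con (+ 2) :* y)
                           := (a :+ b) :+ con (+ 2) :* (x :+ y)) refl (bit a) x (bit b) y ⟩
    bit a + bit b + + 2 * (x + y)
      ≡⟨ cong (_+ + 2 * (x + y)) (carry a b) ⟩
    bit (a xor b) + + 2 * bit (a ∧ b) + + 2 * (x + y)
      ≡⟨ solve 3 (λ s c h → (s :+ con (+ 2) :* c) :+ con (+ 2) :* h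
                         := s :+ con (+ 2) :* (c :+ h)) refl (bit (a xor b)) (bit (a ∧ b)) (x + y) ⟩
    bit (a xor b) + + 2 * (bit (a ∧ b) + (x + y)) ∎)
    where
    open ≡-Reasoning
    carry : ∀ a b → bit a + bit b ≡ bit (a xor b) + + 2 * bit (a ∧ b)
    carry true  true  = refl
    carry true  false = refl
    carry false true  = refl
    carry false false = refl

  ≋-* : ∀ {z w a b} → z ≋ a → w ≋ b → z * w ≋ a ∧ b
  ≋-* {a = a} {b} (half-is x refl) (half-is y refl) =
    half-is (bit a * y + x * bit b + + 2 * (x * y)) (begin
    (bit a + + 2 * x) * (bit b + + 2 * y)
      ≡⟨ solve 4 (λ a x b y → (a :+ con (+ 2) :* x) :* (b :+ con (+ 2) :* y)
           := a :* b :+ con (+ 2) :* (a :* y :+ x :* b :+ con (+ 2) :* (x :* y)))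
           refl (bit a) x (bit b) y ⟩
    bit a * bit b + + 2 * (bit a * y + x * bit b + + 2 * (x * y))
      ≡⟨ cong (_+ + 2 * (bit a * y + x * bit b + + 2 * (x * y))) (product a b) ⟩
    bit (a ∧ b) + + 2 * (bit a * y + x * bit b + + 2 * (x * y)) ∎)
    where
    open ≡-Reasoning
    product : ∀ a b → bit a * bit b ≡ bit (a ∧ b)
    product true  true  = refl
    product true  false = refl
    product false b     = refl

  ≋-odd≢even : ∀ {z} → z ≋ true → ¬ (z ≋ false)
  ≋-odd≢even (half-is x refl) (half-is y e) = no-half (y - x) (begin
    + 2 * (y - x)
      ≡⟨ solve 2 (λ x y → con (+ 2) :* (y :- x) := (con (+ 0) :+ con (+ 2) :* y) :- con (+ 2) :* x) refl x y ⟩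
    + 0 + + 2 * y - + 2 * x
      ≡⟨ cong (_- + 2 * x) (sym e) ⟩
    + 1 + + 2 * x - + 2 * x
      ≡⟨ solve 1 (λ x → (con (+ 1) :+ con (+ 2) :* x) :- con (+ 2) :* x := con (+ 1)) refl x ⟩
    + 1 ∎)
    where
    open ≡-Reasoning
    no-half : ∀ z → + 2 * z ≢ + 1
    no-half (+ zero)        ()
    no-half (+ suc zero)    ()
    no-half (+ suc (suc n)) ()
    no-half -[1+ n ]        ()

  xorsum : ∀ {n} → Vector Bool n → Bool
  xorsum {zero}  b = false
  xorsum {suc n} b = b zero xor xorsum (λ i → b (suc i))

  ≋-sum : ∀ {n} {f : Vector ℤ n} {b : Vector Bool n} → (∀ i → f i ≋ b i) → sumℤ f ≋ xorsum b
  ≋-sum {zero}  h = half-is (+ 0) refl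
  ≋-sum {suc n} h = ≋-+ (h zero) (≋-sum λ i → h (suc i))

  ≋⇒bit≤z² : ∀ {z} b → z ≋ b → bit b ≤ z * z
  ≋⇒bit≤z² {z} true  h = 1≤z² z λ { refl → ≋-odd≢even h (half-is (+ 0) refl) }
  ≋⇒bit≤z² {z} false h = 0≤z² z

  odd²≥1 : ∀ w → + 1 ≤ (+ 1 - + 2 * w) * (+ 1 - + 2 * w)
  odd²≥1 w = ≋⇒bit≤z² true (half-is (- w)
    (solve 1 (λ w → con (+ 1) :- con (+ 2) :* w := con (+ 1) :+ con (+ 2) :* (:- w)) refl w))

  -- If z is even then 1 - z is odd and has square at least 1; the factor 4 comes from the doubling.
  ≋⇒4bit≤[2-2z]² : ∀ {z} b → z ≋ b → + 4 * bit (not b) ≤ (+ 2 - + 2 * z) * (+ 2 - + 2 * z)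
  ≋⇒4bit≤[2-2z]² {z} true  h = 0≤z² (+ 2 - + 2 * z)
  ≋⇒4bit≤[2-2z]² {z} false (half-is w refl) = subst (λ h → + 4 ≤ h)
    (solve 1 (λ w → con (+ 4) :* ((con (+ 1) :- con (+ 2) :* w) :* (con (+ 1) :- con (+ 2) :* w))
      := (con (+ 2) :- con (+ 2) :* (con (+ 0) :+ con (+ 2) :* w))
      :* (con (+ 2) :- con (+ 2) :* (con (+ 0) :+ con (+ 2) :* w))) refl w)
    (ℤP.*-monoˡ-≤-nonNeg (+ 4) (odd²≥1 w))

  -- Write y = 2e. Then Σ e = 2s is even, and so is Σ e², because e² and e have the same parity.
  -- Hence the norm 4 Σ e² is a multiple of 8, and a norm below 8 is zero.
  even-vector-norm : ∀ {n} (y : Vector ℤ n) s → (∀ j → y j ≋ false) → sumℤ y ≡ + 4 * s →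
    (∀ j → y j ≡ + 0) ⊎ + 8 ≤ sumℤ (λ j → y j * y j)
  even-vector-norm {n} y s y-even Σy≡4s = by-sign
    where
    open ≡-Reasoning
    e : Vector ℤ n
    e j = _≋_.half (y-even j)
    y≡2e : ∀ j → y j ≡ + 2 * e j
    y≡2e j = trans (_≋_.split (y-even j)) (ℤP.+-identityˡ (+ 2 * e j))
    Σe≡2s : sumℤ e ≡ + 2 * s
    Σe≡2s = ℤP.*-cancelˡ-≡ (+ 2) (sumℤ e) (+ 2 * s) (begin
      + 2 * sumℤ e              ≡⟨ ∑ℤ.*-distribˡ-sum (+ 2) e ⟩
      sumℤ (λ j → + 2 * e j)    ≡⟨ ∑ℤ.sum-cong-≗ (λ j → sym (y≡2e j)) ⟩
      sumℤ y                    ≡⟨ Σy≡4s ⟩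
      + 4 * s                   ≡⟨ ℤP.*-assoc (+ 2) (+ 2) s ⟩
      + 2 * (+ 2 * s)           ∎)
    b : Vector Bool n
    b j = proj₁ (parity (e j))
    Σe²≋ : sumℤ (λ j → e j * e j) ≋ xorsum b
    Σe²≋ = ≋-sum λ j → subst (e j * e j ≋_) (∧-idem (b j))
      (≋-* (proj₂ (parity (e j))) (proj₂ (parity (e j))))
    Σe²-even : sumℤ (λ j → e j * e j) ≋ false
    Σe²-even = transfer (xorsum b) Σe²≋ (≋-sum λ j → proj₂ (parity (e j)))
      where
      transfer : ∀ b → sumℤ (λ j → e j * e j) ≋ b → sumℤ e ≋ b → sumℤ (λ j → e j * e j) ≋ false
      transfer false h _ = h
      transfer true  _ k = contradiction
        (half-is s (trans Σe≡2s (sym (ℤP.+-identityˡ (+ 2 * s))))) (≋-odd≢even k)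
    h : ℤ
    h = _≋_.half Σe²-even
    Σe²≡2h : sumℤ (λ j → e j * e j) ≡ + 2 * h
    Σe²≡2h = trans (_≋_.split Σe²-even) (ℤP.+-identityˡ (+ 2 * h))
    Σy²≡8h : sumℤ (λ j → y j * y j) ≡ + 8 * h
    Σy²≡8h = begin
      sumℤ (λ j → y j * y j)          ≡⟨ ∑ℤ.sum-cong-≗ square ⟩
      sumℤ (λ j → + 4 * (e j * e j))  ≡⟨ sym (∑ℤ.*-distribˡ-sum (+ 4) (λ j → e j * e j)) ⟩
      + 4 * sumℤ (λ j → e j * e j)    ≡⟨ cong (λ h → + 4 * h) Σe²≡2h ⟩
      + 4 * (+ 2 * h)                 ≡⟨ sym (ℤP.*-assoc (+ 4) (+ 2) h) ⟩
      + 8 * h                         ∎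
      where
      square : ∀ j → y j * y j ≡ + 4 * (e j * e j)
      square j = trans (cong₂ _*_ (y≡2e j) (y≡2e j))
        (solve 1 (λ e → (con (+ 2) :* e) :* (con (+ 2) :* e) := con (+ 4) :* (e :* e)) refl (e j))
    by-sign : (∀ j → y j ≡ + 0) ⊎ + 8 ≤ sumℤ (λ j → y j * y j)
    by-sign with + 1 ℤP.≤? h
    ... | yes 1≤h = inj₂ (subst (λ h → + 8 ≤ h) (sym Σy²≡8h) (ℤP.*-monoˡ-≤-nonNeg (+ 8) 1≤h))
    ... | no  1≰h = inj₁ λ j → z²≤0⇒z≡0 (y j) (ℤP.≤-trans
      (term≤sumℤ (λ j → 0≤z² (y j)) j)
      (subst (_≤ + 0) (sym Σy²≡8h) (ℤP.*-monoˡ-≤-nonNeg (+ 8) {h} {+ 0} (ℤP.i<j⇒i≤pred[j] (ℤP.≰⇒> 1≰h)))))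

  -- A basis of the laminated lattice Λ₁₅ in minimal norm 8: the x ∈ ℤ¹⁵ with
  -- 4 ∣ Σ xᵢ whose reduction mod 2 lies in the [15,4,8] simplex code, which is
  -- generated by the last four rows.
  table : Vec (Vec ℕ 15) 15
  table =
      (4 ∷ 0 ∷ 0 ∷ 0 ∷ 0 ∷ 0 ∷ 0 ∷ 0 ∷ 0 ∷ 0 ∷ 0 ∷ 0 ∷ 0 ∷ 0 ∷ 0 ∷ [])
    ∷ (2 ∷ 2 ∷ 0 ∷ 0 ∷ 0 ∷ 0 ∷ 0 ∷ 0 ∷ 0 ∷ 0 ∷ 0 ∷ 0 ∷ 0 ∷ 0 ∷ 0 ∷ [])
    ∷ (2 ∷ 0 ∷ 2 ∷ 0 ∷ 0 ∷ 0 ∷ 0 ∷ 0 ∷ 0 ∷ 0 ∷ 0 ∷ 0 ∷ 0 ∷ 0 ∷ 0 ∷ [])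
    ∷ (2 ∷ 0 ∷ 0 ∷ 2 ∷ 0 ∷ 0 ∷ 0 ∷ 0 ∷ 0 ∷ 0 ∷ 0 ∷ 0 ∷ 0 ∷ 0 ∷ 0 ∷ [])
    ∷ (2 ∷ 0 ∷ 0 ∷ 0 ∷ 2 ∷ 0 ∷ 0 ∷ 0 ∷ 0 ∷ 0 ∷ 0 ∷ 0 ∷ 0 ∷ 0 ∷ 0 ∷ [])
    ∷ (2 ∷ 0 ∷ 0 ∷ 0 ∷ 0 ∷ 2 ∷ 0 ∷ 0 ∷ 0 ∷ 0 ∷ 0 ∷ 0 ∷ 0 ∷ 0 ∷ 0 ∷ [])
    ∷ (2 ∷ 0 ∷ 0 ∷ 0 ∷ 0 ∷ 0 ∷ 2 ∷ 0 ∷ 0 ∷ 0 ∷ 0 ∷ 0 ∷ 0 ∷ 0 ∷ 0 ∷ [])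
    ∷ (2 ∷ 0 ∷ 0 ∷ 0 ∷ 0 ∷ 0 ∷ 0 ∷ 2 ∷ 0 ∷ 0 ∷ 0 ∷ 0 ∷ 0 ∷ 0 ∷ 0 ∷ [])
    ∷ (2 ∷ 0 ∷ 0 ∷ 0 ∷ 0 ∷ 0 ∷ 0 ∷ 0 ∷ 2 ∷ 0 ∷ 0 ∷ 0 ∷ 0 ∷ 0 ∷ 0 ∷ [])
    ∷ (2 ∷ 0 ∷ 0 ∷ 0 ∷ 0 ∷ 0 ∷ 0 ∷ 0 ∷ 0 ∷ 2 ∷ 0 ∷ 0 ∷ 0 ∷ 0 ∷ 0 ∷ [])
    ∷ (2 ∷ 0 ∷ 0 ∷ 0 ∷ 0 ∷ 0 ∷ 0 ∷ 0 ∷ 0 ∷ 0 ∷ 2 ∷ 0 ∷ 0 ∷ 0 ∷ 0 ∷ [])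
    ∷ (1 ∷ 1 ∷ 1 ∷ 1 ∷ 0 ∷ 1 ∷ 1 ∷ 0 ∷ 1 ∷ 0 ∷ 0 ∷ 1 ∷ 0 ∷ 0 ∷ 0 ∷ [])
    ∷ (1 ∷ 1 ∷ 1 ∷ 0 ∷ 1 ∷ 1 ∷ 0 ∷ 1 ∷ 0 ∷ 1 ∷ 0 ∷ 0 ∷ 1 ∷ 0 ∷ 0 ∷ [])
    ∷ (1 ∷ 1 ∷ 0 ∷ 1 ∷ 1 ∷ 0 ∷ 1 ∷ 1 ∷ 0 ∷ 0 ∷ 1 ∷ 0 ∷ 0 ∷ 1 ∷ 0 ∷ [])
    ∷ (1 ∷ 0 ∷ 1 ∷ 1 ∷ 1 ∷ 0 ∷ 0 ∷ 0 ∷ 1 ∷ 1 ∷ 1 ∷ 0 ∷ 0 ∷ 0 ∷ 1 ∷ [])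
    ∷ []

  G : Fin 15 → Fin 15 → ℤ
  G i j = + lookup (lookup table i) j

  odd-entry : Fin 15 → Fin 15 → Bool
  odd-entry i j = proj₁ (parity (G i j))

  word : Vector Bool 15 → Vector Bool 15
  word b j = xorsum λ i → odd-entry i j ∧ b i

  only-last-four : Bool → Bool → Bool → Bool → Vector Bool 15
  only-last-four a b c d = lookup (Vec.replicate 11 false Vec.++ a ∷ b ∷ c ∷ d ∷ [])

  weight coweight : Vector Bool 15 → ℤ
  weight   b = sumℤ λ j → bit (word b j)
  coweight b = sumℤ λ j → bit (not (word b j))

  -- The sixteen words of the simplex code are evaluated one by one; the case split makes each
  -- equation a computation.
  weights : ∀ a b c d →
    let w = only-last-four a b c d in
    (weight w , coweight w) ≡ (if a ∨ b ∨ c ∨ d then (+ 8 , + 7) else (+ 0 , + 15))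
  weights false false false false = refl
  weights false false false true  = refl
  weights false false true  false = refl
  weights false false true  true  = refl
  weights false true  false false = refl
  weights false true  false true  = refl
  weights false true  true  false = refl
  weights false true  true  true  = refl
  weights true  false false false = refl
  weights true  false false true  = refl
  weights true  false true  false = refl
  weights true  false true  true  = refl
  weights true  true  false false = refl
  weights true  true  false true  = refl
  weights true  true  true  false = refl
  weights true  true  true  true  = refl

  weight-cases : ∀ b → weight b ≡ + 0 × coweight b ≡ + 15 ⊎ weight b ≡ + 8 × coweight b ≡ + 7
  -- The first eleven rows are even, so `word b` computes to the word of
  -- `only-last-four b₀ b₁ b₂ b₃`, and `weights` applies to `b` itself.
  weight-cases b = cases (b₀ ∨ b₁ ∨ b₂ ∨ b₃) (weights b₀ b₁ b₂ b₃)
    where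
    b₀ b₁ b₂ b₃ : Bool
    b₀ = b (# 11)
    b₁ = b (# 12)
    b₂ = b (# 13)
    b₃ = b (# 14)
    cases : ∀ c → (weight b , coweight b) ≡ (if c then (+ 8 , + 7) else (+ 0 , + 15)) →
      weight b ≡ + 0 × coweight b ≡ + 15 ⊎ weight b ≡ + 8 × coweight b ≡ + 7
    cases true  e = inj₂ (cong proj₁ e , cong proj₂ e)
    cases false e = inj₁ (cong proj₁ e , cong proj₂ e)

  image-parity : ∀ z → ∃[ b ] (∀ j → image G z j ≋ word b j)
  image-parity z = (λ i → proj₁ (parity (z i))) , λ j →
    ≋-sum λ i → subst (λ p → z i * G i j ≋ p) (∧-comm (proj₁ (parity (z i))) (odd-entry i j))
      (≋-* (proj₂ (parity (z i))) (proj₂ (parity (G i j))))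

  -- Rows 0 to 10 sum to 4 and the four codewords to 8; the quotient by 11 tells them apart.
  row-sum/4 : Fin 15 → ℤ
  row-sum/4 i = + (ℕ.suc (Fin.toℕ i ℕ./ 11))

  row-sums : ∀ i → sumℤ (G i) ≡ + 4 * row-sum/4 i
  row-sums = from-yes (FinP.all? λ i → sumℤ (G i) ℤP.≟ + 4 * row-sum/4 i)

  4∣image-sum : ∀ z → sumℤ (image G z) ≡ + 4 * sumℤ (λ i → z i * row-sum/4 i)
  4∣image-sum z = begin
    sumℤ (λ j → sumℤ λ i → z i * G i j)      ≡⟨ ∑ℤ.∑-comm (λ j i → z i * G i j) ⟩
    sumℤ (λ i → sumℤ λ j → z i * G i j)      ≡⟨ ∑ℤ.sum-cong-≗ (λ i → sym (∑ℤ.*-distribˡ-sum (z i) (G i))) ⟩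
    sumℤ (λ i → z i * sumℤ (G i))            ≡⟨ ∑ℤ.sum-cong-≗ (λ i → cong (z i *_) (row-sums i)) ⟩
    sumℤ (λ i → z i * (+ 4 * row-sum/4 i))   ≡⟨ ∑ℤ.sum-cong-≗ (λ i → swap (z i) (row-sum/4 i)) ⟩
    sumℤ (λ i → + 4 * (z i * row-sum/4 i))   ≡⟨ sym (∑ℤ.*-distribˡ-sum (+ 4) (λ i → z i * row-sum/4 i)) ⟩
    + 4 * sumℤ (λ i → z i * row-sum/4 i)     ∎
    where
    open ≡-Reasoning
    swap : ∀ a b → a * (+ 4 * b) ≡ + 4 * (a * b)
    swap = solve 2 (λ a b → a :* (con (+ 4) :* b) := con (+ 4) :* (a :* b)) refl

  normℤ : ∀ {n} → Vector ℤ n → ℤ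
  normℤ y = sumℤ λ j → y j * y j

  -- A nonzero word has eight odd coordinates, each contributing at least 1 to the norm. The zero
  -- word leaves an even vector with sum divisible by 4, to which `even-vector-norm` applies.
  minimum₁₅ : ∀ z → (∀ j → image G z j ≡ + 0) ⊎ + 8 ≤ normℤ (image G z)
  minimum₁₅ z = by-word (image-parity z)
    where
    0≤bit : ∀ b → + 0 ≤ bit b
    0≤bit true  = ℤ.+≤+ ℕ.z≤n
    0≤bit false = ℤ.+≤+ ℕ.z≤n
    even : ∀ {z} b → z ≋ b → bit b ≤ + 0 → z ≋ false
    even false h _ = h
    even true  h (ℤ.+≤+ ())
    by-word : ∃[ b ] (∀ j → image G z j ≋ word b j) →
      (∀ j → image G z j ≡ + 0) ⊎ + 8 ≤ normℤ (image G z)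
    by-word (b , h) = by-weight (weight-cases b)
      where
      by-weight : weight b ≡ + 0 × coweight b ≡ + 15 ⊎ weight b ≡ + 8 × coweight b ≡ + 7 →
        (∀ j → image G z j ≡ + 0) ⊎ + 8 ≤ normℤ (image G z)
      by-weight (inj₂ (w≡8 , _)) = inj₂ (subst (_≤ normℤ (image G z)) w≡8
        (sumℤ-mono λ j → ≋⇒bit≤z² (word b j) (h j)))
      by-weight (inj₁ (w≡0 , _)) = even-vector-norm (image G z) (sumℤ λ i → z i * row-sum/4 i)
        (λ j → even (word b j) (h j) (subst (bit (word b j) ≤_) w≡0
          (term≤sumℤ (λ j → 0≤bit (word b j)) j)))
        (4∣image-sum z)

  -- The deep hole (1,…,1): every lattice point differs from it by an odd number
  -- in at least 7 coordinates.  Everything is doubled to match the hole of ℤ.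
  hole₁₅ : ∀ z → + 28 ≤ normℤ (λ j → + 2 - + 2 * image G z j)
  hole₁₅ z = by-word (image-parity z)
    where
    28≤ : ∀ {c} → c ≡ + 15 ⊎ c ≡ + 7 → + 28 ≤ + 4 * c
    28≤ (inj₁ refl) = from-yes (+ 28 ℤP.≤? + 60)
    28≤ (inj₂ refl) = ℤP.≤-refl
    by-word : ∃[ b ] (∀ j → image G z j ≋ word b j) → + 28 ≤ normℤ (λ j → + 2 - + 2 * image G z j)
    by-word (b , h) = ℤP.≤-trans (28≤ (Sum.map proj₂ proj₂ (weight-cases b)))
      (subst (_≤ normℤ (λ j → + 2 - + 2 * image G z j))
        (sym (∑ℤ.*-distribˡ-sum (+ 4) (λ j → bit (not (word b j)))))
        (sumℤ-mono λ j → ≋⇒4bit≤[2-2z]² (word b j) (h j)))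

  -- Coordinates, in the basis G, of the minimal vectors 2eᵢ + 2e₀ (2e₀ + 2e₁
  -- for i = 0) and of their differences from 4eᵢ.
  plus₁₅ minus₁₅ : Fin 15 → Vector ℤ 15
  plus₁₅ zero = δ (suc zero)
  plus₁₅ i@(suc _) = if Fin.toℕ i ℕ.<ᵇ 11 then δ i else from-codeword
    where
    from-codeword : Vector ℤ 15
    -- Twice codeword i is 2e₀ + 2eᵢ plus six vectors 2eₗ with 0 < l < 11. Subtracting the six rows
    -- 2e₀ + 2eₗ leaves 2eᵢ - 10e₀, and three copies of row 0, which is 4e₀, turn this into 2eᵢ +
    -- 2e₀.
    from-codeword zero = + 3
    from-codeword l@(suc _) = + 2 * δ i l - (if Fin.toℕ l ℕ.<ᵇ 11 then G i l else + 0)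
  minus₁₅ zero    l = δ zero l - plus₁₅ zero l
  minus₁₅ (suc i) l = plus₁₅ (suc i) l - δ zero l

  plus+minus₁₅ : ∀ i j → image G (plus₁₅ i) j + image G (minus₁₅ i) j ≡ + 4 * δ i j
  plus+minus₁₅ = from-yes (FinP.all? λ i → FinP.all? λ j →
    image G (plus₁₅ i) j + image G (minus₁₅ i) j ℤP.≟ + 4 * δ i j)

  plus-norm₁₅ : ∀ i → normℤ (image G (plus₁₅ i)) ≡ + 8
  plus-norm₁₅ = from-yes (FinP.all? λ i → normℤ (image G (plus₁₅ i)) ℤP.≟ + 8)

  minus-norm₁₅ : ∀ i → normℤ (image G (minus₁₅ i)) ≡ + 8
  minus-norm₁₅ = from-yes (FinP.all? λ i → normℤ (image G (minus₁₅ i)) ℤP.≟ + 8)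

  G-lower : ∀ i j → i Fin.< j → G i j ≡ + 0
  G-lower = from-yes (FinP.all? λ i → FinP.all? λ j → (i FinP.<? j) →-dec (G i j ℤP.≟ + 0))

  -- The coordinates of ℤᵏ are put in front, so that every construction recurses on `k` with Λ₁₅ as
  -- its base case, and the matrix stays lower triangular.
  B : ∀ k → Fin (k ℕ.+ 15) → Fin (k ℕ.+ 15) → ℤ
  B zero    i       j       = G i j
  B (suc k) zero    j       = δ zero j
  B (suc k) (suc i) zero    = + 0
  B (suc k) (suc i) (suc j) = B k i j

  -- Coordinates of the two kinds are scaled so that a unit vector of ℤ is as long as
  -- the minimal vectors of the lattice with basis G, which have norm 8.
  ω : ∀ k → Fin (k ℕ.+ 15) → ℤ
  ω zero    i       = + 1
  ω (suc k) zero    = + 8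
  ω (suc k) (suc i) = ω k i

  -- Twice the coordinates of the hole.
  η : ∀ k → Fin (k ℕ.+ 15) → ℤ
  η zero    i       = + 2
  η (suc k) zero    = + 1
  η (suc k) (suc i) = η k i

  -- The multiple of eᵢ that is a sum of two minimal vectors: 4eᵢ = (2eᵢ + 2e₀) + (2eᵢ - 2e₀) in Λ₁₅
  -- (with e₁ in place of e₀ for i = 0), and 2eᵢ = eᵢ + eᵢ in ℤᵏ.
  μ : ∀ k → Fin (k ℕ.+ 15) → ℤ
  μ zero    i       = + 4
  μ (suc k) zero    = + 2
  μ (suc k) (suc i) = μ k i

  0∷_ : ∀ {n} → Vector ℤ n → Vector ℤ (suc n)
  (0∷ z) zero    = + 0
  (0∷ z) (suc i) = z i

  plus minus : ∀ k → Fin (k ℕ.+ 15) → Vector ℤ (k ℕ.+ 15)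
  plus zero    i       = plus₁₅ i
  plus (suc k) zero    = δ zero
  plus (suc k) (suc i) = 0∷ plus k i
  minus zero    i       = minus₁₅ i
  minus (suc k) zero    = δ zero
  minus (suc k) (suc i) = 0∷ minus k i

  weighted : ∀ k → Vector ℤ (k ℕ.+ 15) → ℤ
  weighted k y = sumℤ λ j → ω k j * (y j * y j)

  weighted-cong : ∀ k {y w} → (∀ j → y j ≡ w j) → weighted k y ≡ weighted k w
  weighted-cong k h = ∑ℤ.sum-cong-≗ λ j → cong (λ t → ω k j * (t * t)) (h j)

  weighted-zero : ∀ y → weighted zero y ≡ normℤ y
  weighted-zero y = ∑ℤ.sum-cong-≗ λ j → ℤP.*-identityˡ (y j * y j)

  1≤ω : ∀ k j → + 1 ≤ ω k j
  1≤ω zero    j       = ℤP.≤-refl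
  1≤ω (suc k) zero    = ℤ.+≤+ (ℕ.s≤s ℕ.z≤n)
  1≤ω (suc k) (suc j) = 1≤ω k j

  y²≤ω*y² : ∀ k (y : Vector ℤ (k ℕ.+ 15)) j → y j * y j ≤ ω k j * (y j * y j)
  y²≤ω*y² k y j = subst (_≤ ω k j * (y j * y j)) (ℤP.*-identityˡ (y j * y j))
    (ℤP.*-monoʳ-≤-nonNeg (y j * y j) {{ℤ.nonNegative (0≤z² (y j))}} (1≤ω k j))

  y²≤weighted : ∀ k y j → y j * y j ≤ weighted k y
  y²≤weighted k y j = ℤP.≤-trans (y²≤ω*y² k y j)
    (term≤sumℤ (λ i → ℤP.≤-trans (0≤z² (y i)) (y²≤ω*y² k y i)) j)

  0≤weighted : ∀ k y → + 0 ≤ weighted k y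
  0≤weighted k y = sumℤ≥0 λ j → ℤP.≤-trans (0≤z² (y j)) (y²≤ω*y² k y j)

  image-head : ∀ k z → image (B (suc k)) z zero ≡ z zero
  image-head k z = trans (cong₂ _+_ (ℤP.*-identityʳ (z zero)) (sumℤ-0 λ i → ℤP.*-zeroʳ (z (suc i))))
    (ℤP.+-identityʳ (z zero))

  image-tail : ∀ k z j → image (B (suc k)) z (suc j) ≡ image (B k) (λ i → z (suc i)) j
  image-tail k z j = trans (cong (_+ image (B k) (λ i → z (suc i)) j) (ℤP.*-zeroʳ (z zero)))
    (ℤP.+-identityˡ (image (B k) (λ i → z (suc i)) j))

  image-0 : ∀ k {z} → (∀ i → z i ≡ + 0) → ∀ j → image (B k) z j ≡ + 0
  image-0 k {z} h j = sumℤ-0 λ i → trans (cong (_* B k i j) (h i)) (ℤP.*-zeroˡ (B k i j))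

  weighted-image : ∀ k z →
    weighted (suc k) (image (B (suc k)) z) ≡ + 8 * (z zero * z zero) + weighted k (image (B k) λ i → z (suc i))
  weighted-image k z = cong₂ _+_ (cong (λ t → + 8 * (t * t)) (image-head k z)) (weighted-cong k (image-tail k z))

  minimum : ∀ k z → (∀ j → image (B k) z j ≡ + 0) ⊎ + 8 ≤ weighted k (image (B k) z)
  minimum zero z = Sum.map₂ (subst (λ n → + 8 ≤ n) (sym (weighted-zero (image G z)))) (minimum₁₅ z)
  minimum (suc k) z = by-head (z zero ℤP.≟ + 0)
    where
    Goal : Set
    Goal = (∀ j → image (B (suc k)) z j ≡ + 0) ⊎ + 8 ≤ weighted (suc k) (image (B (suc k)) z)
    large : + 8 ≤ + 8 * (z zero * z zero) + weighted k (image (B k) λ i → z (suc i)) → Goal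
    large h = inj₂ (subst (λ n → + 8 ≤ n) (sym (weighted-image k z)) h)
    by-tail : z zero ≡ + 0 → (∀ j → image (B k) (λ i → z (suc i)) j ≡ + 0) ⊎
      + 8 ≤ weighted k (image (B k) λ i → z (suc i)) → Goal
    by-tail e (inj₁ h) = inj₁ λ
      { zero    → trans (image-head k z) e
      ; (suc j) → trans (image-tail k z j) (h j) }
    by-tail e (inj₂ h) = large (ℤP.+-mono-≤ (ℤP.*-monoˡ-≤-nonNeg (+ 8) (0≤z² (z zero))) h)
    by-head : Dec (z zero ≡ + 0) → Goal
    by-head (yes e) = by-tail e (minimum k λ i → z (suc i))
    by-head (no z≢0) = large (ℤP.+-mono-≤ (ℤP.*-monoˡ-≤-nonNeg (+ 8) (1≤z² (z zero) z≢0))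
      (0≤weighted k (image (B k) λ i → z (suc i))))

  -- The summands are orthogonal, so the bounds add: in each coordinate of ℤᵏ the doubled difference
  -- 1 - 2z is odd and carries weight 8, and Λ₁₅ contributes 28.
  hole : ∀ k z → + (8 ℕ.* k ℕ.+ 28) ≤ weighted k (λ j → η k j - + 2 * image (B k) z j)
  hole zero z = subst (λ n → + 28 ≤ n)
    (sym (weighted-zero (λ j → + 2 - + 2 * image G z j))) (hole₁₅ z)
  hole (suc k) z = subst₂ _≤_
    (cong (λ n → + (n ℕ.+ 28)) (sym (ℕP.*-suc 8 k)))
    (cong₂ _+_ (cong (λ t → + 8 * ((+ 1 - + 2 * t) * (+ 1 - + 2 * t))) (sym (image-head k z)))
      (weighted-cong k λ j → cong (λ t → η k j - + 2 * t) (sym (image-tail k z j))))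
    (ℤP.+-mono-≤ (ℤP.*-monoˡ-≤-nonNeg (+ 8) (odd²≥1 (z zero))) (hole k λ i → z (suc i)))

  plus+minus : ∀ k i j → image (B k) (plus k i) j + image (B k) (minus k i) j ≡ μ k i * δ i j
  plus+minus zero    i j = plus+minus₁₅ i j
  plus+minus (suc k) zero zero = cong₂ _+_ (image-head k (δ zero)) (image-head k (δ zero))
  plus+minus (suc k) zero (suc j) = cong₂ _+_ tail≡0 tail≡0
    where
    tail≡0 : image (B (suc k)) (δ zero) (suc j) ≡ + 0
    tail≡0 = trans (image-tail k (δ zero) j) (image-0 k (λ _ → refl) j)
  plus+minus (suc k) (suc i) zero = trans
    (cong₂ _+_ (image-head k (0∷ plus k i)) (image-head k (0∷ minus k i))) (sym (ℤP.*-zeroʳ (μ k i)))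
  plus+minus (suc k) (suc i) (suc j) = trans
    (cong₂ _+_ (image-tail k (0∷ plus k i) j) (image-tail k (0∷ minus k i) j)) (plus+minus k i j)

  δ-norm : ∀ k → weighted (suc k) (image (B (suc k)) (δ zero)) ≡ + 8
  δ-norm k = trans (weighted-image k (δ zero)) (cong (λ n → + 8 + n)
    (sumℤ-0 λ j → trans (cong (λ t → ω k j * (t * t)) (image-0 k (λ _ → refl) j)) (ℤP.*-zeroʳ (ω k j))))

  plus-norm : ∀ k i → weighted k (image (B k) (plus k i)) ≡ + 8
  plus-norm zero    i       = trans (weighted-zero (image G (plus₁₅ i))) (plus-norm₁₅ i)
  plus-norm (suc k) zero    = δ-norm k
  plus-norm (suc k) (suc i) = trans (weighted-image k (0∷ plus k i))
    (trans (ℤP.+-identityˡ (weighted k (image (B k) (plus k i)))) (plus-norm k i))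

  minus-norm : ∀ k i → weighted k (image (B k) (minus k i)) ≡ + 8
  minus-norm zero    i       = trans (weighted-zero (image G (minus₁₅ i))) (minus-norm₁₅ i)
  minus-norm (suc k) zero    = δ-norm k
  minus-norm (suc k) (suc i) = trans (weighted-image k (0∷ minus k i))
    (trans (ℤP.+-identityˡ (weighted k (image (B k) (minus k i)))) (minus-norm k i))

  B-lower : ∀ k i j → i Fin.< j → B k i j ≡ + 0
  B-lower zero    i       j       i<j         = G-lower i j i<j
  B-lower (suc k) zero    (suc j) i<j         = refl
  B-lower (suc k) (suc i) (suc j) (ℕ.s≤s i<j) = B-lower k i j i<j

  -- An orthogonal sublattice with periods μⱼ, spanned by the sums of minimal vectors. Rounding to
  -- it shows that the covering radius is finite.
  multiples : ∀ k (n : Vector ℤ (k ℕ.+ 15)) → ∃[ z ] (∀ j → image (B k) z j ≡ n j * μ k j)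
  multiples k n = image (λ i l → plus k i l + minus k i l) n , λ j → begin
    image (B k) (image (λ i l → plus k i l + minus k i l) n) j
      ≡⟨ image-image (B k) (λ i l → plus k i l + minus k i l) n j ⟩
    sumℤ (λ i → n i * image (B k) (λ l → plus k i l + minus k i l) j)
      ≡⟨ ∑ℤ.sum-cong-≗ (λ i → cong (n i *_)
           (trans (image-+ (B k) (plus k i) (minus k i) j) (plus+minus k i j))) ⟩
    sumℤ (λ i → n i * (μ k i * δ i j))
      ≡⟨ ∑ℤ.sum-cong-≗ (λ i → sym (ℤP.*-assoc (n i) (μ k i) (δ i j))) ⟩
    sumℤ (λ i → n i * μ k i * δ i j)
      ≡⟨ sumℤ-δ (λ i → n i * μ k i) j ⟩
    n j * μ k j ∎
    where open ≡-Reasoning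

open IntegerLattice

open import Defs
open import Axiom.ExcludedMiddle using (ExcludedMiddle)
open import Data.Nat.Base using () renaming (_≤_ to _≤ℕ_)
open import Level using (0ℓ)

-- The ordered commutative ring of real numbers.

module Rational where
  open ℚSolver.+-*-Solver using (solve; _:+_; _:*_; _:-_; :-_; _:=_)

  neg-square : ∀ p → (ℚ.- p) ℚ.* (ℚ.- p) ≡ p ℚ.* p
  neg-square = solve 1 (λ p → (:- p) :* (:- p) := p :* p) refl

  differences-add : ∀ a b c → (a ℚ.- b) ℚ.+ (b ℚ.- c) ≡ a ℚ.- c
  differences-add = solve 3 (λ a b c → (a :- b) :+ (b :- c) := a :- c) refl

  plus-minus : ∀ p q → q ℚ.+ (p ℚ.- q) ≡ p
  plus-minus = solve 2 (λ p q → q :+ (p :- q) := p) refl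

  halves-add : ∀ a b ε → (a ℚ.+ ½ ℚ.* ε) ℚ.+ (b ℚ.+ ½ ℚ.* ε) ≡ (a ℚ.+ b) ℚ.+ ε
  halves-add a b ε = trans (swap a b (½ ℚ.* ε)) (cong (a ℚ.+ b ℚ.+_) (half+half ε))
    where
    swap : ∀ a b h → (a ℚ.+ h) ℚ.+ (b ℚ.+ h) ≡ (a ℚ.+ b) ℚ.+ (h ℚ.+ h)
    swap = solve 3 (λ a b h → (a :+ h) :+ (b :+ h) := (a :+ b) :+ (h :+ h)) refl

  square≥0 : ∀ p → 0ℚ ℚ.≤ p ℚ.* p
  square≥0 p with ℚP.≤-total 0ℚ p
  ... | inj₁ 0≤p = prod≥0 {p} {p} 0≤p 0≤p
  ... | inj₂ p≤0 = subst (0ℚ ℚ.≤_) (neg-square p) (prod≥0 {ℚ.- p} {ℚ.- p} 0≤-p 0≤-p)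
    where
    0≤-p : 0ℚ ℚ.≤ ℚ.- p
    0≤-p = ℚP.neg-antimono-≤ p≤0

  <-shift : ∀ {p q r} → p ℚ.- q ℚ.< r → p ℚ.< q ℚ.+ r
  <-shift {p} {q} {r} h = subst₂ ℚ._<_
    (plus-minus p q) refl (ℚP.+-monoʳ-< q h)

  p<p+ε : ∀ p {ε} → 0ℚ ℚ.< ε → p ℚ.< p ℚ.+ ε
  p<p+ε p h = subst₂ ℚ._<_ (ℚP.+-identityʳ p) refl (ℚP.+-monoʳ-< p h)

open Rational

Eventually : (ℕ → Set) → Set
Eventually P = ∃[ N ] (∀ n → N ℕ.≤ n → P n)

always : {P : ℕ → Set} → (∀ n → P n) → Eventually P
always h = 0 , λ n _ → h n

eventually-map : {P Q : ℕ → Set} → (∀ n → P n → Q n) → Eventually P → Eventually Q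
eventually-map f (N , h) = N , λ n l → f n (h n l)

eventually-map₂ : {P Q R : ℕ → Set} → (∀ n → P n → Q n → R n) →
  Eventually P → Eventually Q → Eventually R
eventually-map₂ f (M , g) (N , h) = M ℕ.⊔ N , λ n l →
  f n (g n (ℕP.m⊔n≤o⇒m≤o M N l)) (h n (ℕP.m⊔n≤o⇒n≤o M N l))

Eventually-const : {P : Set} → Eventually (λ _ → P) → P
Eventually-const (N , h) = h N ℕP.≤-refl

-- _≈_ and _≤_ unfold to formulas about sequences, from which Agda cannot
-- recover the reals being compared; these wrappers do not unfold.
record _≃_ (x y : ℝ) : Set where
  constructor ≈⇒≃
  field ≃⇒≈ : x ≈ y
open _≃_ public

record _≼_ (x y : ℝ) : Set where
  constructor ≤⇒≼
  field ≼⇒≤ : x ≤ y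
open _≼_ public

infix 4 _≃_ _≼_

≡⇒≃ : ∀ {x y} → (∀ n → seq x n ≡ seq y n) → x ≃ y
≡⇒≃ {x} {y} h .≃⇒≈ ε 0<ε = always λ n → subst (λ z → ℚ.∣ z ∣ ℚ.< ε)
  (sym (trans (cong (ℚ._- seq y n) (h n)) (ℚP.+-inverseʳ (seq y n)))) 0<ε

≃-refl : ∀ {x} → x ≃ x
≃-refl = ≡⇒≃ λ n → refl

≃-sym : ∀ {x y} → x ≃ y → y ≃ x
≃-sym {x} {y} h .≃⇒≈ ε 0<ε = eventually-map
  (λ n → subst (ℚ._< ε) (∣-∣-swap (seq x n) (seq y n))) (h .≃⇒≈ ε 0<ε)

≃-trans : ∀ {x y z} → x ≃ y → y ≃ z → x ≃ z
≃-trans {x} {y} {z} h k .≃⇒≈ ε 0<ε = eventually-map₂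
  (λ n → +-bound {seq x n ℚ.- seq y n} {seq y n ℚ.- seq z n}
    (differences-add (seq x n) (seq y n) (seq z n)) (half+half ε))
  (h .≃⇒≈ _ (half>0 0<ε)) (k .≃⇒≈ _ (half>0 0<ε))

opaque
  unfolding _+ℝ_

  +-cong : ∀ {x x′ y y′} → x ≃ x′ → y ≃ y′ → x +ℝ y ≃ x′ +ℝ y′
  +-cong {x} {x′} {y} {y′} h k .≃⇒≈ ε 0<ε = eventually-map₂
    (λ n → +-bound {seq x n ℚ.- seq x′ n} {seq y n ℚ.- seq y′ n}
      (+-interchange (seq x n) (seq y n) (seq x′ n) (seq y′ n)) (half+half ε))
    (h .≃⇒≈ _ (half>0 0<ε)) (k .≃⇒≈ _ (half>0 0<ε))

  neg-cong : ∀ {x y} → x ≃ y → -ℝ x ≃ -ℝ y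
  neg-cong {x} {y} h .≃⇒≈ ε 0<ε = eventually-map
    (λ n → subst (ℚ._< ε) (cong ℚ.∣_∣ (minus-neg (seq x n) (seq y n))))
    (≃-sym h .≃⇒≈ ε 0<ε)

  *-cong : ∀ {x x′ y y′} → x ≃ x′ → y ≃ y′ → x *ℝ y ≃ x′ *ℝ y′
  *-cong {x} {x′} {y} {y′} h k .≃⇒≈ ε 0<ε =
    bounded (eventually-bounded {seq x} (cauchy x)) (eventually-bounded {seq y′} (cauchy y′))
    where
    Bound : (ℕ → ℚ) → Set
    Bound f = ∃[ B ] (0ℚ ℚ.< B × Eventually (λ n → ℚ.∣ f n ∣ ℚ.< B))
    Tolerance : ℚ → Set
    Tolerance B = ∃[ τ ] (0ℚ ℚ.< τ × B ℚ.* τ ≡ ½ ℚ.* ε)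
    Goal : Set
    Goal = Eventually λ n → ℚ.∣ seq x n ℚ.* seq y n ℚ.- seq x′ n ℚ.* seq y′ n ∣ ℚ.< ε
    bounded : Bound (seq x) → Bound (seq y′) → Goal
    bounded (A , 0<A , boundˣ) (B , 0<B , boundʸ) =
      close (tolerance 0<A (half>0 0<ε)) (tolerance 0<B (half>0 0<ε))
      where
      close : Tolerance A → Tolerance B → Goal
      close (σ , 0<σ , eσ) (τ , 0<τ , eτ) = eventually-map₂
        {λ n → ℚ.∣ seq x n ∣ ℚ.< A × ℚ.∣ seq y n ℚ.- seq y′ n ∣ ℚ.< σ}
        {λ n → ℚ.∣ seq y′ n ∣ ℚ.< B × ℚ.∣ seq x n ℚ.- seq x′ n ∣ ℚ.< τ}
        (λ { n (ha , hbd) (hd , hac) →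
          *-step {seq x n} {seq y n} {seq x′ n} {seq y′ n} {A} {B} {σ} {τ} {ε}
            0<A 0<B eσ eτ ha hbd hd hac })
        (eventually-map₂ (λ n → _,_) boundˣ (k .≃⇒≈ σ 0<σ))
        (eventually-map₂ (λ n → _,_) boundʸ (h .≃⇒≈ τ 0<τ))

  +-assoc : ∀ x y z → x +ℝ y +ℝ z ≃ x +ℝ (y +ℝ z)
  +-assoc x y z = ≡⇒≃ λ n → ℚP.+-assoc (seq x n) (seq y n) (seq z n)

  +-comm : ∀ x y → x +ℝ y ≃ y +ℝ x
  +-comm x y = ≡⇒≃ λ n → ℚP.+-comm (seq x n) (seq y n)

  +-identityˡ : ∀ x → 0ℝ +ℝ x ≃ x
  +-identityˡ x = ≡⇒≃ λ n → ℚP.+-identityˡ (seq x n)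

  +-inverseˡ : ∀ x → (-ℝ x) +ℝ x ≃ 0ℝ
  +-inverseˡ x = ≡⇒≃ λ n → ℚP.+-inverseˡ (seq x n)

  *-assoc : ∀ x y z → x *ℝ y *ℝ z ≃ x *ℝ (y *ℝ z)
  *-assoc x y z = ≡⇒≃ λ n → ℚP.*-assoc (seq x n) (seq y n) (seq z n)

  *-comm : ∀ x y → x *ℝ y ≃ y *ℝ x
  *-comm x y = ≡⇒≃ λ n → ℚP.*-comm (seq x n) (seq y n)

  *-identityˡ : ∀ x → 1ℝ *ℝ x ≃ x
  *-identityˡ x = ≡⇒≃ λ n → ℚP.*-identityˡ (seq x n)

  *-distribʳ-+ : ∀ x y z → (y +ℝ z) *ℝ x ≃ y *ℝ x +ℝ z *ℝ x
  *-distribʳ-+ x y z = ≡⇒≃ λ n → ℚP.*-distribʳ-+ (seq x n) (seq y n) (seq z n)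

  fromℚ-+ : ∀ p q → fromℚ (p ℚ.+ q) ≃ fromℚ p +ℝ fromℚ q
  fromℚ-+ p q = ≡⇒≃ λ n → refl

  fromℚ-* : ∀ p q → fromℚ (p ℚ.* q) ≃ fromℚ p *ℝ fromℚ q
  fromℚ-* p q = ≡⇒≃ λ n → refl

  fromℚ-neg : ∀ p → fromℚ (ℚ.- p) ≃ -ℝ fromℚ p
  fromℚ-neg p = ≡⇒≃ λ n → refl

≃-isEquivalence : IsEquivalence _≃_
≃-isEquivalence = record { refl = ≃-refl ; sym = ≃-sym ; trans = ≃-trans }

≃-setoid : Setoid 0ℓ 0ℓ
≃-setoid = record { isEquivalence = ≃-isEquivalence }

open import Algebra.Consequences.Setoid ≃-setoid
  using (comm∧idˡ⇒id; comm∧invˡ⇒inv; comm∧distrʳ⇒distr)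

ℝ-commutativeRing : CommutativeRing 0ℓ 0ℓ
ℝ-commutativeRing = record
  { Carrier = ℝ ; _≈_ = _≃_ ; _+_ = _+ℝ_ ; _*_ = _*ℝ_ ; -_ = -ℝ_ ; 0# = 0ℝ ; 1# = 1ℝ
  ; isCommutativeRing = record
    { isRing = record
      { +-isAbelianGroup = record
        { isGroup = record
          { isMonoid = record
            { isSemigroup = record
              { isMagma = record
                { isEquivalence = ≃-isEquivalence
                ; ∙-cong = +-cong }
              ; assoc = +-assoc }
            ; identity = comm∧idˡ⇒id +-comm +-identityˡ }
          ; inverse = comm∧invˡ⇒inv +-comm +-inverseˡ
          ; ⁻¹-cong = neg-cong }
        ; comm = +-comm }
      ; *-cong = *-cong
      ; *-assoc = *-assoc
      ; *-identity = comm∧idˡ⇒id *-comm *-identityˡ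
      ; distrib = comm∧distrʳ⇒distr +-cong *-comm *-distribʳ-+ }
    ; *-comm = *-comm } }

module R = CommutativeRing ℝ-commutativeRing

-- Coefficients in ℚ rather than ℤ let the ring solver evaluate constants such as ½ and ¼.
fromℚ-morphism :
  CommutativeRing.rawRing ℚP.+-*-commutativeRing -Raw-AlmostCommutative⟶
  fromCommutativeRing ℝ-commutativeRing
fromℚ-morphism = record
  { ⟦_⟧ = fromℚ ; +-homo = fromℚ-+ ; *-homo = fromℚ-* ; -‿homo = fromℚ-neg
  ; 0-homo = ≃-refl ; 1-homo = ≃-refl }

fromℚ-≟ : ∀ p q → Maybe (fromℚ p ≃ fromℚ q)
fromℚ-≟ p q = Maybe.map (λ { refl → ≃-refl }) (dec⇒maybe (p ℚP.≟ q))

module ℝSolver = RingSolver (CommutativeRing.rawRing ℚP.+-*-commutativeRing)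
  (fromCommutativeRing ℝ-commutativeRing) fromℚ-morphism fromℚ-≟
open ℝSolver using (solve; _:+_; _:*_; _:-_; :-_; _:=_; con)

open Mult (CommutativeRing.semiring ℚP.+-*-commutativeRing) using () renaming (_×_ to _·_)
module ℚ^ = Exp (CommutativeRing.semiring ℚP.+-*-commutativeRing)
module ℝ^ = Exp R.semiring
module ℝᶜ^ = CommutativeExp R.commutativeSemiring
module ∑ = Summation R.semiring
module Π = Product R.*-commutativeMonoid
open ℝ^ using (_^_)
open Π using () renaming (sum to ∏)

≃⇒≼ : ∀ {x y} → x ≃ y → x ≼ y
≃⇒≼ {x} {y} h .≼⇒≤ ε 0<ε = eventually-map
  (λ n l → <-shift (ℚP.≤-<-trans (p≤∣p∣ (seq x n ℚ.- seq y n)) l)) (h .≃⇒≈ ε 0<ε)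

≼-refl : ∀ {x} → x ≼ x
≼-refl = ≃⇒≼ ≃-refl

pointwise-≼ : ∀ {x y} → (∀ n → seq x n ℚ.≤ seq y n) → x ≼ y
pointwise-≼ {x} {y} h .≼⇒≤ ε 0<ε = always λ n → ℚP.≤-<-trans (h n) (p<p+ε (seq y n) 0<ε)

≼-trans : ∀ {x y z} → x ≼ y → y ≼ z → x ≼ z
≼-trans {x} {y} {z} h k .≼⇒≤ ε 0<ε = eventually-map₂
  {λ n → seq x n ℚ.< seq y n ℚ.+ ½ ℚ.* ε} {λ n → seq y n ℚ.< seq z n ℚ.+ ½ ℚ.* ε}
  (λ n l m → subst (seq x n ℚ.<_)
    (trans (ℚP.+-assoc (seq z n) (½ ℚ.* ε) (½ ℚ.* ε)) (cong (seq z n ℚ.+_) (half+half ε)))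
    (ℚP.<-trans l (ℚP.+-monoˡ-< (½ ℚ.* ε) m)))
  (h .≼⇒≤ _ (half>0 0<ε)) (k .≼⇒≤ _ (half>0 0<ε))

≼-antisym : ∀ {x y} → x ≼ y → y ≼ x → x ≃ y
≼-antisym {x} {y} h k .≃⇒≈ ε 0<ε = eventually-map₂
  {λ n → seq x n ℚ.< seq y n ℚ.+ ε} {λ n → seq y n ℚ.< seq x n ℚ.+ ε}
  (λ n l m → ∣∣<-intro (minus-< {seq x n} {seq y n} l)
    (subst (ℚ._< ε) (sym (minus-swap (seq x n) (seq y n))) (minus-< {seq y n} {seq x n} m)))
  (h .≼⇒≤ ε 0<ε) (k .≼⇒≤ ε 0<ε)

≼-resp : ∀ {x x′ y y′} → x ≃ x′ → y ≃ y′ → x ≼ y → x′ ≼ y′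
≼-resp e f h = ≼-trans (≃⇒≼ (≃-sym e)) (≼-trans h (≃⇒≼ f))

opaque
  unfolding _+ℝ_

  +-mono-≼ : ∀ {x x′ y y′} → x ≼ x′ → y ≼ y′ → x +ℝ y ≼ x′ +ℝ y′
  +-mono-≼ {x} {x′} {y} {y′} h k .≼⇒≤ ε 0<ε = eventually-map₂
    {λ n → seq x n ℚ.< seq x′ n ℚ.+ ½ ℚ.* ε} {λ n → seq y n ℚ.< seq y′ n ℚ.+ ½ ℚ.* ε}
    (λ n l m → subst (seq x n ℚ.+ seq y n ℚ.<_) (halves-add (seq x′ n) (seq y′ n) ε)
      (ℚP.+-mono-< l m))
    (h .≼⇒≤ _ (half>0 0<ε)) (k .≼⇒≤ _ (half>0 0<ε))

  x≼∣x∣ : ∀ x → x ≼ ∣ x ∣ℝ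
  x≼∣x∣ x = pointwise-≼ λ n → p≤∣p∣ (seq x n)

  0≼x⇒∣x∣≼x : ∀ {x} → 0ℝ ≼ x → ∣ x ∣ℝ ≼ x
  0≼x⇒∣x∣≼x {x} h .≼⇒≤ ε 0<ε = eventually-map
    {λ n → 0ℚ ℚ.< seq x n ℚ.+ ½ ℚ.* ε} (λ n → step (seq x n)) (h .≼⇒≤ _ (half>0 0<ε))
    where
    step : ∀ p → 0ℚ ℚ.< p ℚ.+ ½ ℚ.* ε → ℚ.∣ p ∣ ℚ.< p ℚ.+ ε
    step p l = by-sign (ℚP.∣p∣≡p∨∣p∣≡-p p)
      where
      by-sign : ℚ.∣ p ∣ ≡ p ⊎ ℚ.∣ p ∣ ≡ ℚ.- p → ℚ.∣ p ∣ ℚ.< p ℚ.+ ε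
      by-sign (inj₁ e) = subst (ℚ._< p ℚ.+ ε) (sym e) (p<p+ε p 0<ε)
      by-sign (inj₂ e) = subst (ℚ._< p ℚ.+ ε) (sym e)
        (subst₂ ℚ._<_ (ℚP.+-identityʳ (ℚ.- p)) cancel
          (ℚP.+-monoʳ-< (ℚ.- p) (subst (0ℚ ℚ.<_) (halves-add p p ε) (ℚP.+-mono-< l l))))
        where
        cancel : ℚ.- p ℚ.+ (p ℚ.+ p ℚ.+ ε) ≡ p ℚ.+ ε
        cancel = trans (sym (ℚP.+-assoc (ℚ.- p) (p ℚ.+ p) ε)) (cong (ℚ._+ ε)
          (trans (sym (ℚP.+-assoc (ℚ.- p) p p))
            (trans (cong (ℚ._+ p) (ℚP.+-inverseˡ p)) (ℚP.+-identityˡ p))))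

  0≼∣x∣*∣y∣ : ∀ x y → 0ℝ ≼ ∣ x ∣ℝ *ℝ ∣ y ∣ℝ
  0≼∣x∣*∣y∣ x y = pointwise-≼ λ n →
    prod≥0 {ℚ.∣ seq x n ∣} {ℚ.∣ seq y n ∣} (ℚP.0≤∣p∣ (seq x n)) (ℚP.0≤∣p∣ (seq y n))

  0≼x² : ∀ x → 0ℝ ≼ x *ℝ x
  0≼x² x = pointwise-≼ λ n → square≥0 (seq x n)

0≼1 : 0ℝ ≼ 1ℝ
0≼1 = ≼-resp ≃-refl (*-identityˡ 1ℝ) (0≼x² 1ℝ)

∣x∣≃x : ∀ {x} → 0ℝ ≼ x → ∣ x ∣ℝ ≃ x
∣x∣≃x h = ≼-antisym (0≼x⇒∣x∣≼x h) (x≼∣x∣ _)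

-- A nonnegative real may have negative terms, so the product is not termwise nonnegative; the
-- product of the absolute values is, and it represents the same real.
*-nonneg : ∀ {x y} → 0ℝ ≼ x → 0ℝ ≼ y → 0ℝ ≼ x *ℝ y
*-nonneg {x} {y} h k = ≼-trans (0≼∣x∣*∣y∣ x y) (≃⇒≼ (*-cong (∣x∣≃x h) (∣x∣≃x k)))

≼⇒0≼- : ∀ {x y} → x ≼ y → 0ℝ ≼ y -ℝ x
≼⇒0≼- {x} {y} h = ≼-resp (R.-‿inverseʳ x) ≃-refl (+-mono-≼ h ≼-refl)

0≼-⇒≼ : ∀ {x y} → 0ℝ ≼ y -ℝ x → x ≼ y
0≼-⇒≼ {x} {y} h = ≼-resp (R.+-identityˡ x)
  (solve 2 (λ x y → (y :- x) :+ x := y) ≃-refl x y) (+-mono-≼ h (≼-refl {x}))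

*-monoʳ-≼ : ∀ {x y z} → 0ℝ ≼ x → y ≼ z → x *ℝ y ≼ x *ℝ z
*-monoʳ-≼ {x} {y} {z} h k = 0≼-⇒≼ (≼-resp ≃-refl
  (solve 3 (λ x y z → x :* (z :- y) := x :* z :- x :* y) ≃-refl x y z)
  (*-nonneg h (≼⇒0≼- k)))

*-mono-≼ : ∀ {x x′ y y′} → 0ℝ ≼ x → 0ℝ ≼ y′ → x ≼ x′ → y ≼ y′ → x *ℝ y ≼ x′ *ℝ y′
*-mono-≼ {x} {x′} {y} {y′} 0≼x 0≼y′ h k = ≼-trans (*-monoʳ-≼ 0≼x k)
  (≼-resp (*-comm y′ x) (*-comm y′ x′) (*-monoʳ-≼ 0≼y′ h))

<⇒⋠ : ∀ {x y} → x < y → ¬ (y ≼ x)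
<⇒⋠ {x} {y} (ε , 0<ε , l) h = Eventually-const (eventually-map₂
  (λ n l m → ℚP.<-irrefl refl (ℚP.<-trans l m)) l (h .≼⇒≤ ε 0<ε))

opaque
  unfolding _+ℝ_

  -- One rational comparison decides. Choose N beyond which y - x varies by less than ε/2. If its
  -- N-th term is at most ε/2, all later terms are below ε; otherwise they all exceed a fixed
  -- positive number, and x < y.
  ≮⇒≽ : ∀ {x y} → ¬ (x < y) → y ≼ x
  ≮⇒≽ {x} {y} x≮y .≼⇒≤ ε 0<ε =
    settle (+-cauchy {seq y} (cauchy y) (neg-cauchy {seq x} (cauchy x)) _ (half>0 0<ε))
    where
    w : ℕ → ℚ
    w n = seq y n ℚ.- seq x n
    h : ℚ
    h = ½ ℚ.* ε
    settle : ∃[ N ] (∀ m n → N ℕ.≤ m → N ℕ.≤ n → ℚ.∣ w m ℚ.- w n ∣ ℚ.< h) →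
      Eventually λ n → seq y n ℚ.< seq x n ℚ.+ ε
    settle (N , close) = decide (w N ℚP.≤? h)
      where
      near : ∀ m n → N ℕ.≤ m → N ℕ.≤ n → w m ℚ.< w n ℚ.+ h
      near m n lm ln = <-shift {w m} {w n} (ℚP.≤-<-trans (p≤∣p∣ (w m ℚ.- w n)) (close m n lm ln))
      decide : Dec (w N ℚ.≤ h) → Eventually λ n → seq y n ℚ.< seq x n ℚ.+ ε
      decide (yes wN≤h) = N , λ n l → <-shift {seq y n} {seq x n}
        (ℚP.<-≤-trans (near n N l ℕP.≤-refl)
          (subst (w N ℚ.+ h ℚ.≤_) (half+half ε) (ℚP.+-monoˡ-≤ h wN≤h)))
      decide (no wN≰h) = contradiction
        (w N ℚ.- h , gap , N , λ n l → subst₂ ℚ._<_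
            refl (plus-minus (seq y n) (seq x n))
            (ℚP.+-monoʳ-< (seq x n) (minus-< {w N} {h}
              (subst (w N ℚ.<_) (ℚP.+-comm (w n) h) (near N n ℕP.≤-refl l)))))
        x≮y
        where
        gap : 0ℚ ℚ.< w N ℚ.- h
        gap = subst (ℚ._< w N ℚ.- h) (ℚP.+-inverseʳ h) (ℚP.+-monoˡ-< (ℚ.- h) (ℚP.≰⇒> wN≰h))

module Classical (em : ExcludedMiddle 0ℓ) where

  -- The rational margin contained in `_<_` is not read off a negation; excluded middle supplies it.
  ⋠⇒< : ∀ {x y} → ¬ (y ≼ x) → x < y
  ⋠⇒< {x} {y} h with em {x < y}
  ... | yes l = l
  ... | no  l = contradiction (≮⇒≽ l) h

-- Square roots of nonnegative reals.

opaque
  unfolding _+ℝ_ √_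

  -- gaps ≃ 0, but adding it termwise turns the lower approximations produced by √
  -- and by cuts into upper ones.
  gaps : ℝ
  gaps = mkℝ unit-fraction λ ε 0<ε → ↧ₙ ε , λ m n lm ln → ∣∣<-intro
    (small m n 0<ε lm)
    (subst (ℚ._< ε) (sym (minus-swap (unit-fraction m) (unit-fraction n))) (small n m 0<ε ln))
    where
    small : ∀ {ε} m n → 0ℚ ℚ.< ε → ↧ₙ ε ℕ.≤ m → unit-fraction m ℚ.- unit-fraction n ℚ.< ε
    small {ε} m n 0<ε l = minus-< {unit-fraction m} {unit-fraction n} {ε} (ℚP.≤-<-trans (δ≤ m 0<ε l)
      (subst (ε ℚ.<_) (ℚP.+-comm ε (unit-fraction n)) (p<p+ε ε (0<δ n))))

  seq-gaps : ∀ n → seq gaps n ≡ unit-fraction n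
  seq-gaps n = refl

  gaps≃0 : gaps ≃ 0ℝ
  gaps≃0 = ≼-antisym below (pointwise-≼ λ n → ℚP.<⇒≤ (0<δ n))
    where
    below : gaps ≼ 0ℝ
    below .≼⇒≤ ε 0<ε = ↧ₙ (½ ℚ.* ε) , λ n l →
      subst (unit-fraction n ℚ.<_) (trans (half+half ε) (sym (ℚP.+-identityˡ ε)))
        (ℚP.≤-<-trans (δ≤ n (half>0 0<ε) l) (p<p+ε (½ ℚ.* ε) (half>0 0<ε)))

  √-mono : ∀ {x y} → x ≼ y → √ x ≼ √ y
  √-mono {x} {y} h .≼⇒≤ ε 0<ε = eventually-map₂
    {λ n → unit-fraction n ℚ.≤ e} {λ n → seq x n ℚ.< seq y n ℚ.+ e ℚ.* e}
    (λ n δ≤e l → <-shift {√-approx n (seq x n)} {√-approx n (seq y n)}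
      (subst (√-approx n (seq x n) ℚ.- √-approx n (seq y n) ℚ.<_) (half+half ε)
        (√-modulus {e} {seq x n} {seq y n} n n 0<e δ≤e
          (minus-< {seq x n} {seq y n} {e ℚ.* e} l))))
    (↧ₙ e , λ n l → δ≤ n 0<e l)
    (h .≼⇒≤ (e ℚ.* e) (prod>0 {e} {e} 0<e 0<e))
    where
    e : ℚ
    e = ½ ℚ.* ε
    0<e : 0ℚ ℚ.< e
    0<e = half>0 0<ε

  0≼√ : ∀ x → 0ℝ ≼ √ x
  0≼√ x = pointwise-≼ λ n → √-approx≥0 n (seq x n)

  √∣x∣*√∣x∣≼∣x∣ : ∀ x → √ ∣ x ∣ℝ *ℝ √ ∣ x ∣ℝ ≼ ∣ x ∣ℝ
  √∣x∣*√∣x∣≼∣x∣ x = pointwise-≼ λ n → lower n (√-approx-lower n ℚ.∣ seq x n ∣)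
    where
    lower : ∀ n → √-approx n ℚ.∣ seq x n ∣ ≡ 0ℚ ⊎
      √-approx n ℚ.∣ seq x n ∣ ℚ.* √-approx n ℚ.∣ seq x n ∣ ℚ.≤ ℚ.∣ seq x n ∣ →
      √-approx n ℚ.∣ seq x n ∣ ℚ.* √-approx n ℚ.∣ seq x n ∣ ℚ.≤ ℚ.∣ seq x n ∣
    lower n (inj₁ e) = subst (ℚ._≤ ℚ.∣ seq x n ∣) (sym (cong₂ ℚ._*_ e e)) (ℚP.0≤∣p∣ (seq x n))
    lower n (inj₂ l) = l

  ∣x∣≼[√∣x∣+gaps]² : ∀ x → ∣ x ∣ℝ ≼ (√ ∣ x ∣ℝ +ℝ gaps) *ℝ (√ ∣ x ∣ℝ +ℝ gaps)
  ∣x∣≼[√∣x∣+gaps]² x = pointwise-≼ λ n → ℚP.<⇒≤ (√-approx-upper n ℚ.∣ seq x n ∣)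

√-cong : ∀ {x y} → x ≃ y → √ x ≃ √ y
√-cong h = ≼-antisym (√-mono (≃⇒≼ h)) (√-mono (≃⇒≼ (≃-sym h)))

x+gaps≃x : ∀ x → x +ℝ gaps ≃ x
x+gaps≃x x = ≃-trans (+-cong ≃-refl gaps≃0) (R.+-identityʳ x)

-- At a negative term `√-approx` returns 0, whose square is not below that term. Passing to ∣x∣
-- avoids this, and ∣x∣ is then squeezed termwise between the squares of √∣x∣ and √∣x∣ + `gaps`.
√x*√x≃x : ∀ {x} → 0ℝ ≼ x → √ x *ℝ √ x ≃ x
√x*√x≃x {x} h = ≃-trans (≃-sym (*-cong √∣x∣≃√x √∣x∣≃√x)) (≃-trans √∣x∣*√∣x∣≃∣x∣ (∣x∣≃x h))
  where
  √∣x∣≃√x : √ ∣ x ∣ℝ ≃ √ x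
  √∣x∣≃√x = √-cong (∣x∣≃x h)
  √∣x∣*√∣x∣≃∣x∣ : √ ∣ x ∣ℝ *ℝ √ ∣ x ∣ℝ ≃ ∣ x ∣ℝ
  √∣x∣*√∣x∣≃∣x∣ = ≼-antisym (√∣x∣*√∣x∣≼∣x∣ x)
    (≼-trans (∣x∣≼[√∣x∣+gaps]² x) (≃⇒≼ (*-cong (x+gaps≃x _) (x+gaps≃x _))))

√x≼r⇒x≼r² : ∀ {x r} → 0ℝ ≼ x → 0ℝ ≼ r → √ x ≼ r → x ≼ r *ℝ r
√x≼r⇒x≼r² {x} {r} 0≼x 0≼r h = ≼-trans (≃⇒≼ (≃-sym (√x*√x≃x 0≼x))) (*-mono-≼ (0≼√ x) 0≼r h h)

<⇒≼ : ∀ {x y} → x < y → x ≼ y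
<⇒≼ {x} {y} (ε , 0<ε , l) .≼⇒≤ η 0<η = eventually-map
  (λ n h → ℚP.<-trans (p<p+ε (seq x n) 0<ε) (ℚP.<-trans h (p<p+ε (seq y n) 0<η))) l

^-mono-≼ : ∀ {x y} n → 0ℝ ≼ x → x ≼ y → (0ℝ ≼ x ^ n) × x ^ n ≼ y ^ n
^-mono-≼ zero 0≼x x≼y = 0≼1 , ≼-refl
^-mono-≼ {x} {y} (suc n) 0≼x x≼y with ^-mono-≼ n 0≼x x≼y
... | 0≼xⁿ , xⁿ≼yⁿ = *-nonneg 0≼x 0≼xⁿ
                   , *-mono-≼ 0≼x (≼-trans 0≼xⁿ xⁿ≼yⁿ) x≼y xⁿ≼yⁿ

-- Integers and rationals inside ℝ, and powers.

intℚ : ℤ → ℚ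
intℚ z = ℚ.mkℚ z 0 (coprime-sym (1-coprimeTo ℤ.∣ z ∣))

/1 : ∀ z → z ℚ./ 1 ≡ intℚ z
/1 z = ℚP.↥p/↧p≡p (intℚ z)

intℚ-+ : ∀ a b → intℚ (a ℤ.+ b) ≡ intℚ a ℚ.+ intℚ b
intℚ-+ a b = trans (sym (/1 (a ℤ.+ b)))
  (cong (ℚ._/ 1) (sym (cong₂ ℤ._+_ (ℤP.*-identityʳ a) (ℤP.*-identityʳ b))))

intℚ-* : ∀ a b → intℚ (a ℤ.* b) ≡ intℚ a ℚ.* intℚ b
intℚ-* a b = sym (/1 (a ℤ.* b))

intℚ-neg : ∀ a → intℚ (ℤ.- a) ≡ ℚ.- intℚ a
intℚ-neg (+ zero)  = refl
intℚ-neg (+ suc n) = refl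
intℚ-neg -[1+ n ]  = refl

intℚ-≤ : ∀ {a b} → a ℤ.≤ b → intℚ a ℚ.≤ intℚ b
intℚ-≤ {a} {b} h = ℚ.*≤* (subst₂ ℤ._≤_ (sym (ℤP.*-identityʳ a)) (sym (ℤP.*-identityʳ b)) h)

opaque
  unfolding fromℚ

  fromℚ-≼ : ∀ {p q} → p ℚ.≤ q → fromℚ p ≼ fromℚ q
  fromℚ-≼ h = pointwise-≼ λ _ → h

  1⋠0 : ¬ (1ℝ ≼ 0ℝ)
  1⋠0 h = ℚP.<-irrefl refl (Eventually-const {1ℚ ℚ.< 1ℚ} (h .≼⇒≤ 1ℚ (ℚP.positive⁻¹ 1ℚ)))

  archimedean : ∀ x → ∃[ B ] x ≼ fromℕ B
  archimedean x = bound (eventually-bounded {seq x} (cauchy x))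
    where
    bound : ∃[ B ] (0ℚ ℚ.< B × Eventually (λ n → ℚ.∣ seq x n ∣ ℚ.< B)) → ∃[ B ] x ≼ fromℕ B
    bound (B , _ , h) = suc ℤ.∣ ℚ.↥ B ∣ , ≤⇒≼ λ ε 0<ε → eventually-map
      (λ n l → ℚP.<-trans (ℚP.≤-<-trans (p≤∣p∣ (seq x n)) l)
        (ℚP.<-trans (q<nat B) (p<p+ε (natℚ (suc ℤ.∣ ℚ.↥ B ∣)) 0<ε))) h

fromℤ-+ : ∀ a b → fromℤ (a ℤ.+ b) ≃ fromℤ a +ℝ fromℤ b
fromℤ-+ a b = ≃-trans (R.reflexive (cong fromℚ (intℚ-+ a b))) (fromℚ-+ (intℚ a) (intℚ b))

fromℤ-* : ∀ a b → fromℤ (a ℤ.* b) ≃ fromℤ a *ℝ fromℤ b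
fromℤ-* a b = ≃-trans (R.reflexive (cong fromℚ (intℚ-* a b))) (fromℚ-* (intℚ a) (intℚ b))

fromℤ-neg : ∀ a → fromℤ (ℤ.- a) ≃ -ℝ fromℤ a
fromℤ-neg a = ≃-trans (R.reflexive (cong fromℚ (intℚ-neg a))) (fromℚ-neg (intℚ a))

fromℤ-≼ : ∀ {a b} → a ℤ.≤ b → fromℤ a ≼ fromℤ b
fromℤ-≼ h = fromℚ-≼ (intℚ-≤ h)

0≼fromℕ : ∀ n → 0ℝ ≼ fromℕ n
0≼fromℕ n = fromℤ-≼ (ℤ.+≤+ ℕ.z≤n)

fromℤ-cancel-≼ : ∀ {a b} → fromℤ a ≼ fromℤ b → a ℤ.≤ b
fromℤ-cancel-≼ {a} {b} h = ℤP.≮⇒≥ λ b<a → 1⋠0 (≼-resp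
  (solve 1 (λ x → con 1ℚ :+ x :- x := con 1ℚ) ≃-refl (fromℤ b))
  (R.-‿inverseʳ (fromℤ b))
  (+-mono-≼ (≼-trans (≼-resp (fromℤ-+ (+ 1) b) ≃-refl (fromℤ-≼ (ℤP.i<j⇒suc[i]≤j b<a))) h)
    (≼-refl { -ℝ fromℤ b})))

fromℤ≃0⇒≡0 : ∀ {a} → fromℤ a ≃ 0ℝ → a ≡ + 0
fromℤ≃0⇒≡0 h = ℤP.≤-antisym (fromℤ-cancel-≼ (≃⇒≼ h)) (fromℤ-cancel-≼ (≃⇒≼ (≃-sym h)))

fromℕ-^ : ∀ m n → fromℕ (m ℕ.^ n) ≃ fromℕ m ^ n
fromℕ-^ m zero    = ≃-refl
fromℕ-^ m (suc n) = ≃-trans (R.reflexive (cong fromℤ (ℤP.pos-* m (m ℕ.^ n))))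
  (≃-trans (fromℤ-* (+ m) (+ (m ℕ.^ n))) (*-cong ≃-refl (fromℕ-^ m n)))

ℚ^-mono-≤ : ∀ {p q} n → 0ℚ ℚ.≤ p → p ℚ.≤ q → 0ℚ ℚ.≤ p ℚ^.^ n × p ℚ^.^ n ℚ.≤ q ℚ^.^ n
ℚ^-mono-≤ zero 0≤p p≤q = ℚP.nonNegative⁻¹ 1ℚ , ℚP.≤-refl
ℚ^-mono-≤ {p} {q} (suc n) 0≤p p≤q = extend (ℚ^-mono-≤ n 0≤p p≤q)
  where
  extend : 0ℚ ℚ.≤ p ℚ^.^ n × p ℚ^.^ n ℚ.≤ q ℚ^.^ n →
    0ℚ ℚ.≤ p ℚ^.^ suc n × p ℚ^.^ suc n ℚ.≤ q ℚ^.^ suc n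
  extend (0≤pⁿ , pⁿ≤qⁿ) = prod≥0 {p} {p ℚ^.^ n} 0≤p 0≤pⁿ , ℚP.≤-trans
    (ℚP.*-monoʳ-≤-nonNeg (p ℚ^.^ n) {{ℚ.nonNegative 0≤pⁿ}} p≤q)
    (ℚP.*-monoˡ-≤-nonNeg q {{ℚ.nonNegative (ℚP.≤-trans 0≤p p≤q)}} pⁿ≤qⁿ)

1≤3ᵏ : ∀ k → 1ℚ ℚ.≤ natℚ 3 ℚ^.^ k
1≤3ᵏ zero    = ℚP.≤-refl
1≤3ᵏ (suc k) = ℚP.≤-trans (intℚ-≤ {+ 1} {+ 3} (ℤ.+≤+ (ℕ.s≤s ℕ.z≤n)))
  (subst (ℚ._≤ natℚ 3 ℚ.* natℚ 3 ℚ^.^ k) (ℚP.*-identityʳ (natℚ 3))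
    (ℚP.*-monoˡ-≤-nonNeg (natℚ 3) (1≤3ᵏ k)))

3ᵏ≰2 : ∀ k → ¬ (natℚ 3 ℚ^.^ suc k ℚ.≤ natℚ 2)
3ᵏ≰2 k h = 3≰2 (ℚP.≤-trans (subst (ℚ._≤ natℚ 3 ℚ.* natℚ 3 ℚ^.^ k) (ℚP.*-identityʳ (natℚ 3))
    (ℚP.*-monoˡ-≤-nonNeg (natℚ 3) (1≤3ᵏ k))) h)
  where
  3≰2 : ¬ (natℚ 3 ℚ.≤ natℚ 2)
  3≰2 (ℚ.*≤* (ℤ.+≤+ (ℕ.s≤s (ℕ.s≤s ()))))

opaque
  unfolding _+ℝ_

  seq-^ : ∀ x k n → seq (x ^ k) n ≡ seq x n ℚ^.^ k
  seq-^ x zero    n = refl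
  seq-^ x (suc k) n = cong (seq x n ℚ.*_) (seq-^ x k n)

  seq-+gaps : ∀ x n → seq (x +ℝ gaps) n ≡ seq x n ℚ.+ unit-fraction n
  seq-+gaps x n = cong (seq x n ℚ.+_) (seq-gaps n)

  pointwise-0≼ : ∀ {x} → (∀ n → 0ℚ ℚ.≤ seq x n) → 0ℝ ≼ x
  pointwise-0≼ h = pointwise-≼ h

  pointwise-≼fromℚ : ∀ {x q} → (∀ n → seq x n ℚ.≤ q) → x ≼ fromℚ q
  pointwise-≼fromℚ h = pointwise-≼ h

  pointwise-fromℚ≼ : ∀ {x q} → (∀ n → q ℚ.≤ seq x n) → fromℚ q ≼ x
  pointwise-fromℚ≼ h = pointwise-≼ h

-- Integer parts, suprema of cuts and roots of 2.

module Cuts (em : ExcludedMiddle 0ℓ) where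
  open Classical em

  crossing : (P : ℕ → Set) → P 0 → ∀ K → ¬ P K → ∃[ k ] (P k × ¬ P (suc k))
  crossing P P0 zero    ¬P0 = contradiction P0 ¬P0
  crossing P P0 (suc K) ¬PK with em {P K}
  ... | yes PK = K , PK , ¬PK
  ... | no ¬PK = crossing P P0 K ¬PK

  ⋠⇒≽ : ∀ {x y} → ¬ (y ≼ x) → x ≼ y
  ⋠⇒≽ h = <⇒≼ (⋠⇒< h)

  round : ∀ x → ∃[ z ] (x -ℝ fromℤ z) *ℝ (x -ℝ fromℤ z) ≼ 1ℝ
  round x with archimedean x | archimedean (-ℝ x)
  -- The search runs from -A, which is at most `x`, to B + 1, which exceeds it.
  ... | B , x≼B | A , -x≼A = nearest (crossing (λ k → fromℤ (start k) ≼ x) low (suc (A ℕ.+ B)) high)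
    where
    start : ℕ → ℤ
    start k = ℤ.- (+ A) ℤ.+ (+ k)
    low : fromℤ (start 0) ≼ x
    low = ≼-resp (≃-trans (≃-sym (fromℤ-neg (+ A))) (R.reflexive (cong fromℤ (sym (ℤP.+-identityʳ (ℤ.- + A))))))
      (solve 1 (λ x → :- (:- x) := x) ≃-refl x) (neg-anti -x≼A)
      where
      neg-anti : ∀ {x y} → x ≼ y → -ℝ y ≼ -ℝ x
      neg-anti {x} {y} h = 0≼-⇒≼ (≼-resp ≃-refl
        (solve 2 (λ x y → y :- x := :- x :- :- y) ≃-refl x y) (≼⇒0≼- h))
    end : start (suc (A ℕ.+ B)) ≡ + suc B
    end = trans (cong (λ n → ℤ.- (+ A) ℤ.+ (+ n)) (sym (ℕP.+-suc A B)))
      (trans (sym (ℤP.+-assoc (ℤ.- (+ A)) (+ A) (+ suc B)))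
        (trans (cong (ℤ._+ (+ suc B)) (ℤP.+-inverseˡ (+ A))) (ℤP.+-identityˡ (+ suc B))))
    high : ¬ (fromℤ (start (suc (A ℕ.+ B))) ≼ x)
    high h = beyond (fromℤ-cancel-≼ (≼-trans (subst (λ z → fromℤ z ≼ x) end h) x≼B))
      where
      beyond : ¬ (+ suc B ℤ.≤ + B)
      beyond (ℤ.+≤+ l) = ℕP.1+n≰n l
    nearest : ∃[ k ] (fromℤ (start k) ≼ x × ¬ (fromℤ (start (suc k)) ≼ x)) → _
    nearest (k , z≼x , z+1⋠x) = start k
      , ≼-resp ≃-refl (*-identityˡ 1ℝ) (*-mono-≼ 0≼frac 0≼1 frac≼1 frac≼1)
      where
      z : ℝ
      z = fromℤ (start k)
      0≼frac : 0ℝ ≼ x -ℝ z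
      0≼frac = ≼⇒0≼- z≼x
      next : start (suc k) ≡ start k ℤ.+ + 1
      next = trans (cong (λ n → ℤ.- (+ A) ℤ.+ (+ n)) (ℕP.+-comm 1 k))
        (sym (ℤP.+-assoc (ℤ.- (+ A)) (+ k) (+ 1)))
      frac≼1 : x -ℝ z ≼ 1ℝ
      frac≼1 = ≼-resp ≃-refl (solve 1 (λ z → (z :+ con 1ℚ) :- z := con 1ℚ) ≃-refl z)
        (+-mono-≼ (≼-resp ≃-refl (≃-trans (R.reflexive (cong fromℤ next)) (fromℤ-+ (start k) (+ 1)))
          (⋠⇒≽ z+1⋠x)) (≼-refl { -ℝ z}))

  -- sup is the supremum of the nonnegative part of P.
  record Cut (P : ℚ → Set) : Set where
    field
      sup : ℝ
    approx : ℕ → ℚ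
    approx n = seq sup n
    field
      approx≥0  : ∀ n → 0ℚ ℚ.≤ approx n
      below     : ∀ n → P (approx n)
      above     : ∀ n → ¬ P (approx n ℚ.+ unit-fraction n)
      approx≼   : ∀ n → fromℚ (approx n) ≼ sup
      ≼approx+  : ∀ n → sup ≼ fromℚ (approx n ℚ.+ unit-fraction n)

  -- The n-th term is a multiple of 1/(n+1) where `P` holds while failing at the next multiple. As
  -- `P` is downward closed, any term is below a m < a n + 1/(n+1), which gives both the Cauchy
  -- property and the error bounds.
  cut : (P : ℚ → Set) → (∀ {p q} → 0ℚ ℚ.≤ p → p ℚ.≤ q → P q → P p) → P 0ℚ → ∀ B → ¬ P (natℚ B) →
    Cut P
  cut P down P0 B ¬PB = record
    { sup = x
    ; approx≥0 = a≥0
    ; below = P-below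
    ; above = P-above
    ; approx≼ = λ n → ≼-trans
        (pointwise-fromℚ≼ λ m → subst (a n ℚ.≤_) (sym (seq-+gaps x m)) (ℚP.<⇒≤ (a<a+δ n m)))
        (≃⇒≼ (x+gaps≃x x))
    ; ≼approx+ = λ n → pointwise-≼fromℚ λ m → ℚP.<⇒≤ (a<a+δ m n) }
    where
    step : ∀ n → ∃[ k ] (P (k · unit-fraction n) × ¬ P (suc k · unit-fraction n))
    step n = crossing (λ k → P (k · unit-fraction n)) P0 (suc n ℕ.* B)
      (λ h → ¬PB (subst P (K·δ n B) h))
    a : ℕ → ℚ
    a n = proj₁ (step n) · unit-fraction n
    0≤· : ∀ {δ} → 0ℚ ℚ.≤ δ → ∀ k → 0ℚ ℚ.≤ k · δ
    0≤· h zero = ℚP.≤-refl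
    0≤· {δ} h (suc k) = sum≥0 {δ} {k · δ} h (0≤· h k)
    a≥0 : ∀ n → 0ℚ ℚ.≤ a n
    a≥0 n = 0≤· (ℚP.<⇒≤ (0<δ n)) (proj₁ (step n))
    P-below : ∀ n → P (a n)
    P-below n = proj₁ (proj₂ (step n))
    P-above : ∀ n → ¬ P (a n ℚ.+ unit-fraction n)
    P-above n h = proj₂ (proj₂ (step n)) (subst P (ℚP.+-comm (a n) (unit-fraction n)) h)
    a<a+δ : ∀ m n → a m ℚ.< a n ℚ.+ unit-fraction n
    a<a+δ m n = ℚP.≰⇒> λ l → P-above n (down
      (sum≥0 {a n} {unit-fraction n} (a≥0 n) (ℚP.<⇒≤ (0<δ n))) l (P-below m))
    close : ∀ {ε} m n → 0ℚ ℚ.< ε → ↧ₙ ε ℕ.≤ n → a m ℚ.- a n ℚ.< ε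
    close m n 0<ε l = ℚP.<-≤-trans (minus-< {a m} {a n} (a<a+δ m n)) (δ≤ n 0<ε l)
    x : ℝ
    x = mkℝ a λ ε 0<ε → ↧ₙ ε , λ m n lm ln → ∣∣<-intro (close m n 0<ε ln)
      (subst (ℚ._< ε) (sym (minus-swap (a m) (a n))) (close n m 0<ε lm))

  -- The supremum of the q with qᵏ⁺¹ ≤ 2; adding `gaps` termwise yields the opposite inequality. The
  -- cut is bounded by 3, since 2 itself satisfies `P` when k = 0.
  root : ∀ k → ∃[ t ] t ^ suc k ≃ fromℕ 2
  root k = is-root (cut P down P0 3 (3ᵏ≰2 k))
    where
    P : ℚ → Set
    P q = q ℚ^.^ suc k ℚ.≤ natℚ 2
    down : ∀ {p q} → 0ℚ ℚ.≤ p → p ℚ.≤ q → P q → P p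
    down {p} {q} 0≤p p≤q h = ℚP.≤-trans {p ℚ^.^ suc k} {q ℚ^.^ suc k} {natℚ 2}
      (proj₂ (ℚ^-mono-≤ (suc k) 0≤p p≤q)) h
    P0 : P 0ℚ
    P0 = subst (ℚ._≤ natℚ 2) (sym (ℚP.*-zeroˡ (0ℚ ℚ^.^ k))) (ℚP.nonNegative⁻¹ (natℚ 2))
    is-root : Cut P → ∃[ t ] t ^ suc k ≃ fromℕ 2
    is-root c = t , ≼-antisym lower
        (≼-trans upper (≃⇒≼ (ℝ^.^-congˡ (suc k) (x+gaps≃x t))))
      where
      open Cut c renaming (sup to t)
      lower : t ^ suc k ≼ fromℕ 2
      lower = pointwise-≼fromℚ λ n →
        subst (ℚ._≤ natℚ 2) (sym (seq-^ t (suc k) n)) (below n)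
      upper : fromℕ 2 ≼ (t +ℝ gaps) ^ suc k
      upper = pointwise-fromℚ≼ λ n → subst (natℚ 2 ℚ.≤_)
        (sym (trans (seq-^ (t +ℝ gaps) (suc k) n) (cong (ℚ^._^ suc k) (seq-+gaps t n))))
        (ℚP.<⇒≤ (ℚP.≰⇒> (above n)))

open import Relation.Binary.Reasoning.Setoid R.setoid

-- Finite sums

sum-0 : ∀ {n} {f : Vector ℝ n} → (∀ i → f i ≃ 0ℝ) → sum f ≃ 0ℝ
sum-0 {n} h = ≃-trans (∑.sum-cong-≋ h) (∑.sum-replicate-zero n)

sum-mono : ∀ {n} {f g : Vector ℝ n} → (∀ i → f i ≼ g i) → sum f ≼ sum g
sum-mono {zero}  h = ≼-refl
sum-mono {suc n} h = +-mono-≼ (h zero) (sum-mono λ i → h (suc i))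

sum-nonneg : ∀ {n} {f : Vector ℝ n} → (∀ i → 0ℝ ≼ f i) → 0ℝ ≼ sum f
sum-nonneg {n} h = ≼-resp (∑.sum-replicate-zero n) ≃-refl (sum-mono h)

fromℤ-sum : ∀ {n} (f : Vector ℤ n) → fromℤ (sumℤ f) ≃ sum (λ i → fromℤ (f i))
fromℤ-sum {zero}  f = ≃-refl
fromℤ-sum {suc n} f = ≃-trans (fromℤ-+ (f zero) (sumℤ λ i → f (suc i)))
  (+-cong ≃-refl (fromℤ-sum λ i → f (suc i)))

sum-δ : ∀ {n} (f : Vector ℝ n) j → sum (λ i → f i *ℝ fromℤ (δ i j)) ≃ f j
sum-δ {suc n} f zero = ≃-trans
  (+-cong (R.*-identityʳ (f zero)) (sum-0 λ i → R.zeroʳ (f (suc i)))) (R.+-identityʳ (f zero))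
sum-δ {suc n} f (suc j) = ≃-trans
  (+-cong (R.zeroʳ (f zero)) (sum-δ (λ i → f (suc i)) j)) (+-identityˡ (f (suc j)))

-- Triangular matrices

LowerTriangular : ∀ {n} → Vector (Vector ℝ n) n → Set
LowerTriangular M = ∀ i j → i Fin.< j → M i j ≃ 0ℝ

minor : ∀ {n} → Vector (Vector ℝ (suc n)) (suc n) → Vector (Vector ℝ n) n
minor M i j = M (suc i) (suc j)

minor-lower : ∀ {n} {M : Vector (Vector ℝ (suc n)) (suc n)} →
  LowerTriangular M → LowerTriangular (minor M)
minor-lower h i j i<j = h (suc i) (suc j) (ℕ.s≤s i<j)

alternating-0 : ∀ n {x} → x ≃ 0ℝ → alternating n x ≃ 0ℝ
alternating-0 zero    h = h
alternating-0 (suc n) h = ≃-trans (neg-cong (alternating-0 n h)) (solve 0 (:- con 0ℚ := con 0ℚ) ≃-refl)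

det-lower : ∀ {n} (M : Vector (Vector ℝ n) n) → LowerTriangular M → det M ≃ ∏ (λ i → M i i)
det-lower {zero}  M h = ≃-refl
det-lower {suc n} M h = begin
  det M
    ≈⟨ +-cong ≃-refl (sum-0 λ j → alternating-0 (toℕ (suc j))
         (≃-trans (*-cong (h zero (suc j) (ℕ.s≤s ℕ.z≤n)) ≃-refl) (R.zeroˡ _))) ⟩
  M zero zero *ℝ det (minor M) +ℝ 0ℝ
    ≈⟨ R.+-identityʳ _ ⟩
  M zero zero *ℝ det (minor M)
    ≈⟨ *-cong ≃-refl (det-lower (minor M) (minor-lower {M = M} h)) ⟩
  ∏ (λ i → M i i) ∎

-- Row 0 vanishes beyond its first entry, so the later columns involve only the later coefficients,
-- which vanish by induction. Column 0 then reads c₀M₀₀ = 0, and M₀₀ is invertible.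
lower-independent : ∀ {n} (M : Vector (Vector ℝ n) n) → LowerTriangular M →
  (∀ i → ∃[ u ] M i i *ℝ u ≃ 1ℝ) →
  ∀ (c : Vector ℝ n) → (∀ j → sum (λ i → c i *ℝ M i j) ≃ 0ℝ) → ∀ i → c i ≃ 0ℝ
lower-independent {zero}  M lower unit c h ()
lower-independent {suc n} M lower unit c h i = by-index i
  where
  tail≃0 : ∀ i → c (suc i) ≃ 0ℝ
  tail≃0 = lower-independent (minor M) (minor-lower {M = M} lower) (λ i → unit (suc i))
    (λ i → c (suc i)) λ j → begin
      sum (λ i → c (suc i) *ℝ M (suc i) (suc j))
        ≈⟨ +-identityˡ _ ⟨
      0ℝ +ℝ sum (λ i → c (suc i) *ℝ M (suc i) (suc j))
        ≈⟨ +-cong (≃-trans (*-cong ≃-refl (lower zero (suc j) (ℕ.s≤s ℕ.z≤n))) (R.zeroʳ (c zero))) ≃-refl ⟨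
      sum (λ i → c i *ℝ M i (suc j))
        ≈⟨ h (suc j) ⟩
      0ℝ ∎
  column≃0 : c zero *ℝ M zero zero ≃ 0ℝ
  column≃0 = begin
    c zero *ℝ M zero zero
      ≈⟨ R.+-identityʳ _ ⟨
    c zero *ℝ M zero zero +ℝ 0ℝ
      ≈⟨ +-cong ≃-refl (sum-0 λ i → ≃-trans (*-cong (tail≃0 i) ≃-refl) (R.zeroˡ (M (suc i) zero))) ⟨
    sum (λ i → c i *ℝ M i zero)
      ≈⟨ h zero ⟩
    0ℝ ∎
  head≃0 : ∃[ u ] M zero zero *ℝ u ≃ 1ℝ → c zero ≃ 0ℝ
  head≃0 (u , Mu≃1) = begin
    c zero                           ≈⟨ R.*-identityʳ (c zero) ⟨
    c zero *ℝ 1ℝ                     ≈⟨ *-cong ≃-refl Mu≃1 ⟨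
    c zero *ℝ (M zero zero *ℝ u)     ≈⟨ *-assoc (c zero) (M zero zero) u ⟨
    c zero *ℝ M zero zero *ℝ u       ≈⟨ *-cong column≃0 ≃-refl ⟩
    0ℝ *ℝ u                          ≈⟨ R.zeroˡ u ⟩
    0ℝ ∎
  by-index : ∀ i → c i ≃ 0ℝ
  by-index zero    = head≃0 (unit zero)
  by-index (suc i) = tail≃0 i

-- Spanning families, sums of squares and inverses of factors.

double : ℕ → ℕ
double zero    = zero
double (suc n) = suc (suc (double n))

-- Merges the two lists of minimal vectors into one family. Alternating them lets its sums be
-- handled by the same recursion as sums over the coordinates.
interleave : ∀ {A : Set} {n} → Vector A n → Vector A n → Vector A (double n)
interleave {n = suc n} f g zero          = f zero
interleave {n = suc n} f g (suc zero)    = g zero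
interleave {n = suc n} f g (suc (suc i)) = interleave (λ i → f (suc i)) (λ i → g (suc i)) i

interleave-all : ∀ {A : Set} {P : A → Set} {n} {f g : Vector A n} →
  (∀ i → P (f i)) → (∀ i → P (g i)) → ∀ i → P (interleave f g i)
interleave-all {n = suc n} p q zero          = p zero
interleave-all {n = suc n} p q (suc zero)    = q zero
interleave-all {P = P} {n = suc n} p q (suc (suc i)) =
  interleave-all {P = P} (λ i → p (suc i)) (λ i → q (suc i)) i

sum-interleave : ∀ {A : Set} (F : A → ℝ) {n} (f g : Vector A n) →
  sum (λ i → F (interleave f g i)) ≃ sum (λ i → F (f i) +ℝ F (g i))
sum-interleave F {zero}  f g = ≃-refl
sum-interleave F {suc n} f g = ≃-trans
  (+-cong ≃-refl (+-cong ≃-refl (sum-interleave F (λ i → f (suc i)) (λ i → g (suc i)))))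
  (≃-sym (+-assoc _ _ _))

sumsq : ∀ {n} → Vector ℝ n → ℝ
sumsq v = sum λ j → v j *ℝ v j

0≼sumsq : ∀ {n} (v : Vector ℝ n) → 0ℝ ≼ sumsq v
0≼sumsq v = sum-nonneg λ j → 0≼x² (v j)

sumsq-cong : ∀ {n} {v w : Vector ℝ n} → (∀ j → v j ≃ w j) → sumsq v ≃ sumsq w
sumsq-cong h = ∑.sum-cong-≋ λ j → *-cong (h j) (h j)

-- An inverse of one factor is the inverse of the product times the remaining factors. Thus the
-- volume equation alone provides inverses of all scales and of all diagonal entries.
factor-unit : ∀ {n} (f : Vector ℝ n) {u} → ∏ f *ℝ u ≃ 1ℝ → ∀ i → ∃[ v ] f i *ℝ v ≃ 1ℝ
factor-unit {suc n} f {u} h zero = ∏ (λ i → f (suc i)) *ℝ u , ≃-trans (≃-sym (*-assoc _ _ _)) h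
factor-unit {suc n} f {u} h (suc i) = factor-unit (λ i → f (suc i)) (≃-trans
  (solve 3 (λ x y u → y :* (x :* u) := x :* y :* u) ≃-refl (f zero) (∏ λ i → f (suc i)) u) h) i

-- The block of Λ₁₅ contributes 4 · 2¹⁰ · 1⁴ = 2¹², and the block of ℤᵏ contributes 1.
diagonal : ∀ k → ∏ (λ i → fromℤ (B k i i)) ≃ fromℕ 4096
diagonal zero    = ≃-trans (fromℤ-∏ (λ i → G i i)) ≃-refl
  where
  fromℤ-∏ : ∀ {n} (f : Vector ℤ n) → ∏ (λ i → fromℤ (f i)) ≃ fromℤ (Vector.foldr ℤ._*_ (+ 1) f)
  fromℤ-∏ {zero}  f = ≃-refl
  fromℤ-∏ {suc n} f = ≃-trans (*-cong ≃-refl (fromℤ-∏ λ i → f (suc i)))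
    (≃-sym (fromℤ-* (f zero) (Vector.foldr ℤ._*_ (+ 1) λ i → f (suc i))))
diagonal (suc k) = ≃-trans (*-identityˡ _) (diagonal k)

-- Coordinate i of ℤᵈ is scaled by sᵢ; a is the squared norm per unit of weight.
record Scaling (k : ℕ) : Set where
  field
    s        : Vector ℝ (k ℕ.+ 15)
    a a⁻¹    : ℝ
    a*a⁻¹≃1  : a *ℝ a⁻¹ ≃ 1ℝ
    0≼a      : 0ℝ ≼ a
    0≼a⁻¹    : 0ℝ ≼ a⁻¹
    s²≃aω    : ∀ i → s i *ℝ s i ≃ a *ℝ fromℤ (ω k i)
    volume   : fromℕ 4096 *ℝ ∏ s ≃ 1ℝ

-- Unimodularity and well-roundedness of the scaled lattice.

module Scaled {k : ℕ} (S : Scaling k) where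
  open Scaling S

  ι : Vector ℤ (k ℕ.+ 15) → ℝ^ (k ℕ.+ 15)
  ι y j = fromℤ (y j) *ℝ s j

  rows : Vector (ℝ^ (k ℕ.+ 15)) (k ℕ.+ 15)
  rows i = ι (B k i)

  rows-lower : LowerTriangular rows
  rows-lower i j i<j = ≃-trans
    (*-cong (R.reflexive (cong fromℤ (B-lower k i j i<j))) ≃-refl) (R.zeroˡ (s j))

  det-rows : det rows ≃ 1ℝ
  det-rows = begin
    det rows                                  ≈⟨ det-lower rows rows-lower ⟩
    ∏ (λ i → fromℤ (B k i i) *ℝ s i)          ≈⟨ Π.∑-distrib-+ (λ i → fromℤ (B k i i)) s ⟩
    ∏ (λ i → fromℤ (B k i i)) *ℝ ∏ s          ≈⟨ *-cong (diagonal k) ≃-refl ⟩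
    fromℕ 4096 *ℝ ∏ s                         ≈⟨ volume ⟩
    1ℝ                                        ∎

  Λ : Lattice (k ℕ.+ 15)
  Λ = record { basis = rows ; independent = λ c h i → lower-independent rows rows-lower
        (factor-unit (λ i → rows i i) (≃-trans (R.*-identityʳ _) (≃-trans (≃-sym (det-lower rows rows-lower)) det-rows)))
        c (λ j → ≈⇒≃ (h j)) i .≃⇒≈ }

  unimodular : Unimodular Λ
  unimodular = ≃-trans (∣x∣≃x (≼-trans 0≼1 (≃⇒≼ (≃-sym det-rows)))) det-rows .≃⇒≈

  combination-rows : ∀ z j → combination (λ i → fromℤ (z i)) rows j ≃ ι (image (B k) z) j
  combination-rows z j = begin
    sum (λ i → fromℤ (z i) *ℝ (fromℤ (B k i j) *ℝ s j))
      ≈⟨ ∑.sum-cong-≋ (λ i → ≃-trans (≃-sym (*-assoc _ _ _)) (*-cong (≃-sym (fromℤ-* (z i) (B k i j))) ≃-refl)) ⟩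
    sum (λ i → fromℤ (z i ℤ.* B k i j) *ℝ s j)
      ≈⟨ ∑.*-distribʳ-sum (s j) (λ i → fromℤ (z i ℤ.* B k i j)) ⟨
    sum (λ i → fromℤ (z i ℤ.* B k i j)) *ℝ s j
      ≈⟨ *-cong (≃-sym (fromℤ-sum λ i → z i ℤ.* B k i j)) ≃-refl ⟩
    fromℤ (image (B k) z j) *ℝ s j ∎

  point : Vector ℤ (k ℕ.+ 15) → ℝ^ (k ℕ.+ 15)
  point z = ι (image (B k) z)

  point∈Λ : ∀ z → point z ∈ Λ
  point∈Λ z = z , λ j → ≃-sym (combination-rows z j) .≃⇒≈

  ∈Λ⇒point : ∀ {v} → v ∈ Λ → ∃[ z ] (∀ j → v j ≃ point z j)
  ∈Λ⇒point (z , h) = z , λ j → ≃-trans (≈⇒≃ (h j)) (combination-rows z j)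

  sumsq-ι : ∀ y → sumsq (ι y) ≃ a *ℝ fromℤ (weighted k y)
  sumsq-ι y = begin
    sum (λ j → fromℤ (y j) *ℝ s j *ℝ (fromℤ (y j) *ℝ s j))
      ≈⟨ ∑.sum-cong-≋ term ⟩
    sum (λ j → a *ℝ fromℤ (ω k j ℤ.* (y j ℤ.* y j)))
      ≈⟨ ∑.*-distribˡ-sum a (λ j → fromℤ (ω k j ℤ.* (y j ℤ.* y j))) ⟨
    a *ℝ sum (λ j → fromℤ (ω k j ℤ.* (y j ℤ.* y j)))
      ≈⟨ *-cong ≃-refl (fromℤ-sum λ j → ω k j ℤ.* (y j ℤ.* y j)) ⟨
    a *ℝ fromℤ (weighted k y) ∎
    where
    term : ∀ j → fromℤ (y j) *ℝ s j *ℝ (fromℤ (y j) *ℝ s j) ≃ a *ℝ fromℤ (ω k j ℤ.* (y j ℤ.* y j))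
    term j = begin
      fromℤ (y j) *ℝ s j *ℝ (fromℤ (y j) *ℝ s j)
        ≈⟨ solve 2 (λ y s → y :* s :* (y :* s) := s :* s :* (y :* y)) ≃-refl (fromℤ (y j)) (s j) ⟩
      s j *ℝ s j *ℝ (fromℤ (y j) *ℝ fromℤ (y j))
        ≈⟨ *-cong (s²≃aω j) (≃-sym (fromℤ-* (y j) (y j))) ⟩
      a *ℝ fromℤ (ω k j) *ℝ fromℤ (y j ℤ.* y j)
        ≈⟨ *-assoc _ _ _ ⟩
      a *ℝ (fromℤ (ω k j) *ℝ fromℤ (y j ℤ.* y j))
        ≈⟨ *-cong ≃-refl (fromℤ-* (ω k j) (y j ℤ.* y j)) ⟨
      a *ℝ fromℤ (ω k j ℤ.* (y j ℤ.* y j)) ∎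

  a⁻¹*[a*x]≃x : ∀ x → a⁻¹ *ℝ (a *ℝ x) ≃ x
  a⁻¹*[a*x]≃x x = ≃-trans (solve 3 (λ a b x → b :* (a :* x) := a :* b :* x) ≃-refl a a⁻¹ x)
    (≃-trans (*-cong a*a⁻¹≃1 ≃-refl) (*-identityˡ x))

  weight8-shortest : ∀ z → weighted k (image (B k) z) ≡ + 8 → IsShortest Λ (point z)
  weight8-shortest z w≡8 = point∈Λ z , nonzero , shortest
    where
    sumsq≃8a : sumsq (point z) ≃ a *ℝ fromℕ 8
    sumsq≃8a = ≃-trans (sumsq-ι (image (B k) z)) (*-cong ≃-refl (R.reflexive (cong fromℤ w≡8)))
    nonzero : ¬ (point z ≈ᵥ 0ᵥ)
    nonzero h = contradiction (fromℤ≃0⇒≡0 8≃0) λ ()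
      where
      8≃0 : fromℕ 8 ≃ 0ℝ
      8≃0 = begin
        fromℕ 8                    ≈⟨ a⁻¹*[a*x]≃x (fromℕ 8) ⟨
        a⁻¹ *ℝ (a *ℝ fromℕ 8)      ≈⟨ *-cong ≃-refl sumsq≃8a ⟨
        a⁻¹ *ℝ sumsq (point z)     ≈⟨ *-cong ≃-refl (sum-0 λ j → ≃-trans (*-cong (≈⇒≃ (h j)) ≃-refl) (R.zeroˡ (point z j))) ⟩
        a⁻¹ *ℝ 0ℝ                  ≈⟨ R.zeroʳ a⁻¹ ⟩
        0ℝ                         ∎
    shortest : ∀ w → w ∈ Λ → ¬ (w ≈ᵥ 0ᵥ) → ∥ point z ∥ ≤ ∥ w ∥
    shortest w w∈Λ w≉0 = compare (∈Λ⇒point w∈Λ)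
      where
      compare : ∃[ z′ ] (∀ j → w j ≃ point z′ j) → ∥ point z ∥ ≤ ∥ w ∥
      compare (z′ , e) = by-minimum (minimum k z′)
        where
        by-minimum : (∀ j → image (B k) z′ j ≡ + 0) ⊎ + 8 ℤ.≤ weighted k (image (B k) z′) →
          ∥ point z ∥ ≤ ∥ w ∥
        by-minimum (inj₁ h) = contradiction
          (λ j → ≃-trans (e j) (≃-trans (*-cong (R.reflexive (cong fromℤ (h j))) ≃-refl) (R.zeroˡ (s j))) .≃⇒≈)
          w≉0
        by-minimum (inj₂ h) = √-mono (≼-resp (≃-sym sumsq≃8a)
          (≃-sym (≃-trans (sumsq-cong e) (sumsq-ι (image (B k) z′))))
          (*-monoʳ-≼ 0≼a (fromℤ-≼ h))) .≼⇒≤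

  μ-unit : ∀ k i → ∃[ ν ] fromℤ (μ k i) *ℝ ν ≃ 1ℝ
  μ-unit zero    i       = fromℚ (+ 1 ℚ./ 4) , solve 0 (con (natℚ 4) :* con (+ 1 ℚ./ 4) := con 1ℚ) ≃-refl
  μ-unit (suc k) zero    = ½ℝ , solve 0 (con (natℚ 2) :* con ½ := con 1ℚ) ≃-refl
  μ-unit (suc k) (suc i) = μ-unit k i

  ρ : Vector ℝ (k ℕ.+ 15)
  ρ i = proj₁ (μ-unit k i) *ℝ proj₁ (factor-unit s (≃-trans (*-comm _ _) volume) i)

  μ*s*ρ≃1 : ∀ i → fromℤ (μ k i) *ℝ s i *ℝ ρ i ≃ 1ℝ
  μ*s*ρ≃1 i = ≃-trans
    (solve 4 (λ m s n t → m :* s :* (n :* t) := m :* n :* (s :* t)) ≃-refl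
      (fromℤ (μ k i)) (s i) (proj₁ (μ-unit k i)) (proj₁ (factor-unit s (≃-trans (*-comm _ _) volume) i)))
    (≃-trans (*-cong (proj₂ (μ-unit k i)) (proj₂ (factor-unit s (≃-trans (*-comm _ _) volume) i)))
      (*-identityˡ 1ℝ))

  -- The i-th pair of minimal vectors sums to μᵢsᵢ times the i-th unit vector. As ρᵢ inverts μᵢsᵢ,
  -- giving both vectors of each pair the coefficient xᵢρᵢ reproduces `x`.
  wellRounded : WellRounded Λ
  wellRounded x = double (k ℕ.+ 15) , (λ i → proj₂ (family i)) , (λ i → proj₁ (family i))
    , interleave-all {P = λ t → IsShortest Λ (proj₂ t)}
        {f = λ i → x i *ℝ ρ i , point (plus k i)} {g = λ i → x i *ℝ ρ i , point (minus k i)}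
        (λ i → weight8-shortest (plus k i) (plus-norm k i))
        (λ i → weight8-shortest (minus k i) (minus-norm k i))
    , λ j → ≃-sym (spans j) .≃⇒≈
    where
    family : Vector (ℝ × ℝ^ (k ℕ.+ 15)) (double (k ℕ.+ 15))
    family = interleave (λ i → x i *ℝ ρ i , point (plus k i)) (λ i → x i *ℝ ρ i , point (minus k i))
    spans : ∀ j → combination (λ i → proj₁ (family i)) (λ i → proj₂ (family i)) j ≃ x j
    spans j = begin
      sum (λ i → proj₁ (family i) *ℝ proj₂ (family i) j)
        ≈⟨ sum-interleave (λ t → proj₁ t *ℝ proj₂ t j)
             (λ i → x i *ℝ ρ i , point (plus k i)) (λ i → x i *ℝ ρ i , point (minus k i)) ⟩
      sum (λ i → x i *ℝ ρ i *ℝ point (plus k i) j +ℝ x i *ℝ ρ i *ℝ point (minus k i) j)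
        ≈⟨ ∑.sum-cong-≋ term ⟩
      sum (λ i → x i *ℝ ρ i *ℝ fromℤ (μ k i) *ℝ s j *ℝ fromℤ (δ i j))
        ≈⟨ sum-δ (λ i → x i *ℝ ρ i *ℝ fromℤ (μ k i) *ℝ s j) j ⟩
      x j *ℝ ρ j *ℝ fromℤ (μ k j) *ℝ s j
        ≈⟨ solve 4 (λ x r m s → x :* r :* m :* s := m :* s :* r :* x) ≃-refl (x j) (ρ j) (fromℤ (μ k j)) (s j) ⟩
      fromℤ (μ k j) *ℝ s j *ℝ ρ j *ℝ x j
        ≈⟨ *-cong (μ*s*ρ≃1 j) ≃-refl ⟩
      1ℝ *ℝ x j
        ≈⟨ *-identityˡ (x j) ⟩
      x j ∎
      where
      term : ∀ i → x i *ℝ ρ i *ℝ point (plus k i) j +ℝ x i *ℝ ρ i *ℝ point (minus k i) j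
        ≃ x i *ℝ ρ i *ℝ fromℤ (μ k i) *ℝ s j *ℝ fromℤ (δ i j)
      term i = begin
        x i *ℝ ρ i *ℝ (fromℤ p *ℝ s j) +ℝ x i *ℝ ρ i *ℝ (fromℤ m *ℝ s j)
          ≈⟨ solve 4 (λ c p m s → c :* (p :* s) :+ c :* (m :* s) := c :* s :* (p :+ m)) ≃-refl
               (x i *ℝ ρ i) (fromℤ p) (fromℤ m) (s j) ⟩
        x i *ℝ ρ i *ℝ s j *ℝ (fromℤ p +ℝ fromℤ m)
          ≈⟨ *-cong ≃-refl (≃-trans (≃-sym (fromℤ-+ p m))
               (≃-trans (R.reflexive (cong fromℤ (plus+minus k i j))) (fromℤ-* (μ k i) (δ i j)))) ⟩
        x i *ℝ ρ i *ℝ s j *ℝ (fromℤ (μ k i) *ℝ fromℤ (δ i j))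
          ≈⟨ solve 4 (λ c s m d → c :* s :* (m :* d) := c :* m :* s :* d) ≃-refl
               (x i *ℝ ρ i) (s j) (fromℤ (μ k i)) (fromℤ (δ i j)) ⟩
        x i *ℝ ρ i *ℝ fromℤ (μ k i) *ℝ s j *ℝ fromℤ (δ i j) ∎
        where
        p m : ℤ
        p = image (B k) (plus k i) j
        m = image (B k) (minus k i) j

-- Uniform margins over finite boxes, and bounds on nearby points.

smaller : ∀ {p q} → 0ℚ ℚ.< p → 0ℚ ℚ.< q → ∃[ r ] (0ℚ ℚ.< r × r ℚ.≤ p × r ℚ.≤ q)
smaller {p} {q} 0<p 0<q = pick (ℚP.≤-total p q)
  where
  pick : p ℚ.≤ q ⊎ q ℚ.≤ p → ∃[ r ] (0ℚ ℚ.< r × r ℚ.≤ p × r ℚ.≤ q)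
  pick (inj₁ p≤q) = p , 0<p , ℚP.≤-refl , p≤q
  pick (inj₂ q≤p) = q , 0<q , q≤p , ℚP.≤-refl

opaque
  unfolding _+ℝ_

  -- Only half of the margin in x < y is used as ε; the other half absorbs the error that `_≼_`
  -- allows.
  gap : ∀ {x y} → x < y → ∃[ ε ] (0ℚ ℚ.< ε × ¬ (y ≼ x +ℝ fromℚ ε))
  gap {x} {y} (ε , 0<ε , l) = ½ ℚ.* ε , half>0 0<ε , λ h → Eventually-const (eventually-map₂
    (λ n x+ε<y y<x+ε → ℚP.<-irrefl refl (ℚP.<-trans x+ε<y (subst (seq y n ℚ.<_)
      (trans (ℚP.+-assoc (seq x n) (½ ℚ.* ε) (½ ℚ.* ε)) (cong (seq x n ℚ.+_) (half+half ε))) y<x+ε)))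
    l (h .≼⇒≤ _ (half>0 0<ε)))

Shrinking : {A : Set} → (A → ℚ → Set) → Set
Shrinking R = ∀ y {ε ε′} → ε ℚ.≤ ε′ → R y ε′ → R y ε

uniform-ℤ : (R : ℤ → ℚ → Set) → Shrinking R → (∀ z → ∃[ ε ] (0ℚ ℚ.< ε × R z ε)) →
  ∀ M → ∃[ ε ] (0ℚ ℚ.< ε × (∀ z → ℤ.∣ z ∣ ℕ.≤ M → R z ε))
uniform-ℤ R shrink h zero = h (+ 0) .proj₁ , h (+ 0) .proj₂ .proj₁
  , λ { (+ zero) ℕ.z≤n → h (+ 0) .proj₂ .proj₂ }
uniform-ℤ R shrink h (suc M) =
  combine (uniform-ℤ R shrink h M) (h (+ suc M)) (h -[1+ M ])
  where
  combine : ∃[ ε ] (0ℚ ℚ.< ε × (∀ z → ℤ.∣ z ∣ ℕ.≤ M → R z ε)) →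
    ∃[ ε ] (0ℚ ℚ.< ε × R (+ suc M) ε) → ∃[ ε ] (0ℚ ℚ.< ε × R -[1+ M ] ε) →
    ∃[ ε ] (0ℚ ℚ.< ε × (∀ z → ℤ.∣ z ∣ ℕ.≤ suc M → R z ε))
  combine (ε₁ , 0<ε₁ , r₁) (ε₂ , 0<ε₂ , r₂) (ε₃ , 0<ε₃ , r₃) = merge (smaller 0<ε₁ 0<ε₂)
    where
    merge : ∃[ r ] (0ℚ ℚ.< r × r ℚ.≤ ε₁ × r ℚ.≤ ε₂) → _
    merge (r , 0<r , r≤ε₁ , r≤ε₂) = merge′ (smaller 0<r 0<ε₃)
      where
      merge′ : ∃[ s ] (0ℚ ℚ.< s × s ℚ.≤ r × s ℚ.≤ ε₃) →
        ∃[ ε ] (0ℚ ℚ.< ε × (∀ z → ℤ.∣ z ∣ ℕ.≤ suc M → R z ε))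
      merge′ (s , 0<s , s≤r , s≤ε₃) = s , 0<s , λ z l → by-size z (ℕP.m≤n⇒m<n∨m≡n l)
        where
        by-size : ∀ z → ℤ.∣ z ∣ ℕ.< suc M ⊎ ℤ.∣ z ∣ ≡ suc M → R z s
        by-size z (inj₁ (ℕ.s≤s l)) = shrink z (ℚP.≤-trans s≤r r≤ε₁) (r₁ z l)
        by-size (+ _)    (inj₂ refl) = shrink (+ suc M) (ℚP.≤-trans s≤r r≤ε₂) r₂
        by-size -[1+ _ ] (inj₂ refl) = shrink -[1+ M ] s≤ε₃ r₃

-- The compactness argument: finitely many positive margins have a common positive lower bound. It
-- is taken one coordinate at a time, with `R₀` quantifying over the box in the remaining
-- coordinates; the compatibility of `R` with pointwise equality replaces function extensionality.
uniform-box : ∀ n (R : Vector ℤ n → ℚ → Set) → Shrinking R →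
  (∀ {y w ε} → (∀ j → y j ≡ w j) → R y ε → R w ε) →
  (∀ y → ∃[ ε ] (0ℚ ℚ.< ε × R y ε)) →
  ∀ M → ∃[ ε ] (0ℚ ℚ.< ε × (∀ y → (∀ j → ℤ.∣ y j ∣ ℕ.≤ M) → R y ε))
uniform-box zero R shrink resp h M =
  h Vector.[] .proj₁ , h Vector.[] .proj₂ .proj₁ , λ y _ → resp (λ ()) (h Vector.[] .proj₂ .proj₂)
uniform-box (suc n) R shrink resp h M = conclude (uniform-ℤ R₀ shrink₀ h₀ M)
  where
  R₀ : ℤ → ℚ → Set
  R₀ z ε = ∀ y → (∀ j → ℤ.∣ y j ∣ ℕ.≤ M) → R (z Vector.∷ y) ε
  shrink₀ : Shrinking R₀
  shrink₀ z l r y b = shrink (z Vector.∷ y) l (r y b)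
  h₀ : ∀ z → ∃[ ε ] (0ℚ ℚ.< ε × R₀ z ε)
  h₀ z = uniform-box n (λ y → R (z Vector.∷ y)) (λ y → shrink (z Vector.∷ y))
    (λ e → resp λ { zero → refl ; (suc j) → e j }) (λ y → h (z Vector.∷ y)) M
  conclude : ∃[ ε ] (0ℚ ℚ.< ε × (∀ z → ℤ.∣ z ∣ ℕ.≤ M → R₀ z ε)) →
    ∃[ ε ] (0ℚ ℚ.< ε × (∀ y → (∀ j → ℤ.∣ y j ∣ ℕ.≤ M) → R y ε))
  conclude (ε , 0<ε , r) = ε , 0<ε , λ y b →
    resp (λ { zero → refl ; (suc j) → refl }) (r (y zero) (b zero) (λ j → y (suc j)) (λ j → b (suc j)))

z²≤M⇒∣z∣≤M : ∀ {M} z → z ℤ.* z ℤ.≤ + M → ℤ.∣ z ∣ ℕ.≤ M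
z²≤M⇒∣z∣≤M (+ zero)  h           = ℕ.z≤n
z²≤M⇒∣z∣≤M (+ suc n) (ℤ.+≤+ h) = ℕP.≤-trans (ℕP.m≤m*n (suc n) (suc n)) h
z²≤M⇒∣z∣≤M -[1+ n ]  (ℤ.+≤+ h) = ℕP.≤-trans (ℕP.m≤m*n (suc n) (suc n)) h

-- The difference of the two sides is (2x - y)². Summed over coordinates, this does the work of the
-- triangle inequality without any square root.
y²≼2x²+2[x-y]² : ∀ x y → y *ℝ y ≼ fromℕ 2 *ℝ (x *ℝ x +ℝ (x -ℝ y) *ℝ (x -ℝ y))
y²≼2x²+2[x-y]² x y = 0≼-⇒≼ (≼-resp ≃-refl
  (solve 2 (λ x y → (x :+ x :- y) :* (x :+ x :- y)
    := con (natℚ 2) :* (x :* x :+ (x :- y) :* (x :- y)) :- y :* y) ≃-refl x y)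
  (0≼x² (x +ℝ x -ℝ y)))

sumsq-bound : ∀ {n} (x v : Vector ℝ n) → sumsq v ≼ fromℕ 2 *ℝ (sumsq x +ℝ sumsq (x -ᵥ v))
sumsq-bound x v = ≼-trans (sum-mono λ j → y²≼2x²+2[x-y]² (x j) (v j)) (≃⇒≼ (≃-trans
  (≃-sym (∑.*-distribˡ-sum (fromℕ 2) λ j → x j *ℝ x j +ℝ (x j -ℝ v j) *ℝ (x j -ℝ v j)))
  (*-cong ≃-refl (∑.∑-distrib-+ (λ j → x j *ℝ x j) (λ j → (x j -ℝ v j) *ℝ (x j -ℝ v j))))))

norm-cong : ∀ {n} {v w : Vector ℝ n} → (∀ j → v j ≃ w j) → ∥ v ∥ ≃ ∥ w ∥
norm-cong h = √-cong (sumsq-cong h)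

covers-mono : ∀ {d} {Λ : Lattice d} {r r′} → r ≼ r′ → Covers Λ r → Covers Λ r′
covers-mono {d} {Λ} {r} {r′} r≼r′ c x = widen (c x)
  where
  widen : Σ[ v ∈ ℝ^ d ] (v ∈ Λ × ∥ x -ᵥ v ∥ ≤ r) → Σ[ v ∈ ℝ^ d ] (v ∈ Λ × ∥ x -ᵥ v ∥ ≤ r′)
  widen (v , v∈Λ , h) = v , v∈Λ , ≼-trans {∥ x -ᵥ v ∥} {r} {r′} (≤⇒≼ h) r≼r′ .≼⇒≤

-- Existence of the covering radius, and its lower bound from the hole.

module Covering (em : ExcludedMiddle 0ℓ) {k : ℕ} (S : Scaling k) where
  open Classical em
  open Cuts em
  open Scaling S
  open Scaled S

  p : ℝ^ (k ℕ.+ 15)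
  p j = ½ℝ *ℝ ι (η k) j

  sumsq-hole : ∀ z → sumsq (p -ᵥ point z) ≃
    ½ℝ *ℝ ½ℝ *ℝ (a *ℝ fromℤ (weighted k λ j → η k j ℤ.- + 2 ℤ.* image (B k) z j))
  sumsq-hole z = begin
    sumsq (p -ᵥ point z)
      ≈⟨ ∑.sum-cong-≋ term ⟩
    sum (λ j → ½ℝ *ℝ ½ℝ *ℝ (ι y j *ℝ ι y j))
      ≈⟨ ∑.*-distribˡ-sum (½ℝ *ℝ ½ℝ) (λ j → ι y j *ℝ ι y j) ⟨
    ½ℝ *ℝ ½ℝ *ℝ sumsq (ι y)
      ≈⟨ *-cong ≃-refl (sumsq-ι y) ⟩
    ½ℝ *ℝ ½ℝ *ℝ (a *ℝ fromℤ (weighted k y)) ∎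
    where
    y : Vector ℤ (k ℕ.+ 15)
    y j = η k j ℤ.- + 2 ℤ.* image (B k) z j
    expand : ∀ j → fromℤ (y j) ≃ fromℤ (η k j) -ℝ fromℕ 2 *ℝ fromℤ (image (B k) z j)
    expand j = ≃-trans (fromℤ-+ (η k j) (ℤ.- (+ 2 ℤ.* image (B k) z j))) (+-cong ≃-refl
      (≃-trans (fromℤ-neg (+ 2 ℤ.* image (B k) z j)) (neg-cong (fromℤ-* (+ 2) (image (B k) z j)))))
    term : ∀ j → (p j -ℝ point z j) *ℝ (p j -ℝ point z j) ≃ ½ℝ *ℝ ½ℝ *ℝ (ι y j *ℝ ι y j)
    term j = ≃-trans
      (solve 3 (λ h m s → (con ½ :* (h :* s) :- m :* s) :* (con ½ :* (h :* s) :- m :* s)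
        := con ½ :* con ½ :* (((h :- con (natℚ 2) :* m) :* s) :* ((h :- con (natℚ 2) :* m) :* s)))
        ≃-refl (fromℤ (η k j)) (fromℤ (image (B k) z j)) (s j))
      (*-cong ≃-refl (*-cong (*-cong (≃-sym (expand j)) ≃-refl) (*-cong (≃-sym (expand j)) ≃-refl)))

  -- Applied to the hole `p`, covering yields a lattice point within r, while `hole` keeps all of
  -- them at squared distance at least a (8k + 28)/4; the 4 undoes the doubling.
  covers⇒hole≼ : ∀ {r} → Covers Λ r → 0ℝ ≼ r × a *ℝ fromℕ (8 ℕ.* k ℕ.+ 28) ≼ fromℕ 4 *ℝ (r *ℝ r)
  covers⇒hole≼ {r} c = from-nearest (c p)
    where
    from-nearest : Σ[ v ∈ ℝ^ (k ℕ.+ 15) ] (v ∈ Λ × ∥ p -ᵥ v ∥ ≤ r) →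
      0ℝ ≼ r × a *ℝ fromℕ (8 ℕ.* k ℕ.+ 28) ≼ fromℕ 4 *ℝ (r *ℝ r)
    from-nearest (v , v∈Λ , h) = 0≼r , from-point (∈Λ⇒point v∈Λ)
      where
      0≼r : 0ℝ ≼ r
      0≼r = ≼-trans (0≼√ _) (≤⇒≼ h)
      from-point : ∃[ z ] (∀ j → v j ≃ point z j) →
        a *ℝ fromℕ (8 ℕ.* k ℕ.+ 28) ≼ fromℕ 4 *ℝ (r *ℝ r)
      from-point (z , e) = ≼-trans (*-monoʳ-≼ 0≼a (fromℤ-≼ (hole k z)))
        (≼-resp
          (≃-trans (*-cong ≃-refl (≃-trans (sumsq-cong λ j → +-cong ≃-refl (neg-cong (e j))) (sumsq-hole z)))
            (solve 1 (λ w → con (natℚ 4) :* (con ½ :* con ½ :* w) := w) ≃-refl _))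
          ≃-refl
          (*-monoʳ-≼ (0≼fromℕ 4)
            (√x≼r⇒x≼r² (0≼sumsq (p -ᵥ v)) 0≼r (≤⇒≼ h))))

  ¬covers-0 : ¬ Covers Λ 0ℝ
  ¬covers-0 c = positive (fromℤ-cancel-≼ scaled)
    where
    scaled : fromℕ (8 ℕ.* k ℕ.+ 28) ≼ fromℕ 0
    scaled = ≼-resp (a⁻¹*[a*x]≃x (fromℕ (8 ℕ.* k ℕ.+ 28)))
      (solve 1 (λ b → b :* (con (natℚ 4) :* (con 0ℚ :* con 0ℚ)) := con 0ℚ) ≃-refl a⁻¹)
      (*-monoʳ-≼ 0≼a⁻¹ (proj₂ (covers⇒hole≼ c)))
    positive : ¬ (+ (8 ℕ.* k ℕ.+ 28) ℤ.≤ + 0)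
    positive (ℤ.+≤+ l) = ℕP.<⇒≱ (ℕP.<-≤-trans (ℕ.s≤s ℕ.z≤n) (ℕP.m≤n+m 28 (8 ℕ.* k))) l

  -- Rounding each xⱼρⱼ to an integer selects a point of the orthogonal sublattice from `multiples`.
  -- Each coordinate is then off by at most one period, so the norm of the vector of periods bounds
  -- the distance.
  bounded : ∃[ N ] Covers Λ (fromℕ N)
  bounded = enlarge (archimedean ∥ period ∥)
    where
    period : ℝ^ (k ℕ.+ 15)
    period j = fromℤ (μ k j) *ℝ s j
    Nearest : ℝ^ (k ℕ.+ 15) → Vector ℤ (k ℕ.+ 15) → Set
    Nearest x n = ∀ j → (x j *ℝ ρ j -ℝ fromℤ (n j)) *ℝ (x j *ℝ ρ j -ℝ fromℤ (n j)) ≼ 1ℝ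
    nearest : ∀ x → ∃[ n ] Nearest x n
    nearest x = (λ j → proj₁ (round (x j *ℝ ρ j))) , λ j → proj₂ (round (x j *ℝ ρ j))
    enlarge : ∃[ N ] ∥ period ∥ ≼ fromℕ N → ∃[ N ] Covers Λ (fromℕ N)
    enlarge (N , h) = N , λ x → near x (nearest x)
      where
      near : ∀ x → ∃[ n ] Nearest x n → Σ[ v ∈ ℝ^ (k ℕ.+ 15) ] (v ∈ Λ × ∥ x -ᵥ v ∥ ≤ fromℕ N)
      near x (n , close) = point z , point∈Λ z ,
        ≼-trans {∥ x -ᵥ point z ∥} {∥ period ∥} {fromℕ N} (√-mono (sum-mono term)) h .≼⇒≤
        where
        z : Vector ℤ (k ℕ.+ 15)
        z = proj₁ (multiples k n)
        e : ∀ j → image (B k) z j ≡ n j ℤ.* μ k j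
        e = proj₂ (multiples k n)
        same : ∀ j → period j *ℝ (x j *ℝ ρ j) -ℝ fromℤ (n j) *ℝ period j ≃ x j -ℝ point z j
        same j = +-cong
          (≃-trans (solve 3 (λ q x t → q :* (x :* t) := q :* t :* x) ≃-refl (period j) (x j) (ρ j))
            (≃-trans (*-cong (μ*s*ρ≃1 j) ≃-refl) (*-identityˡ (x j))))
          (neg-cong (≃-trans (≃-sym (*-assoc (fromℤ (n j)) (fromℤ (μ k j)) (s j)))
            (*-cong (≃-trans (≃-sym (fromℤ-* (n j) (μ k j))) (R.reflexive (cong fromℤ (sym (e j))))) ≃-refl)))
        term : ∀ j → (x j -ℝ point z j) *ℝ (x j -ℝ point z j) ≼ period j *ℝ period j
        term j = ≼-resp
          (≃-trans (solve 3 (λ x q n → q :* q :* ((x :- n) :* (x :- n)) := (q :* x :- n :* q) :* (q :* x :- n :* q))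
             ≃-refl (x j *ℝ ρ j) (period j) (fromℤ (n j)))
           (*-cong (same j) (same j)))
          (R.*-identityʳ (period j *ℝ period j))
          (*-monoʳ-≼ (0≼x² (period j)) (close j))

  -- Only finitely many lattice points are close to x, so their distances to x
  -- cannot accumulate at r from above.
  closed : ∀ {r} → 0ℝ ≼ r → (∀ ε → 0ℚ ℚ.< ε → Covers Λ (r +ℝ fromℚ ε)) → Covers Λ r
  closed {r} 0≼r c x = by-cases em
    where
    dist : Vector ℤ (k ℕ.+ 15) → ℝ
    dist z = ∥ x -ᵥ point z ∥
    by-cases : Dec (∃[ z ] dist z ≼ r) → Σ[ v ∈ ℝ^ (k ℕ.+ 15) ] (v ∈ Λ × ∥ x -ᵥ v ∥ ≤ r)
    by-cases (yes (z , h)) = point z , point∈Λ z , h .≼⇒≤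
    by-cases (no far) = contradiction (uniform-box (k ℕ.+ 15) Far shrink resp exists (proj₁ box)) refute
      where
      -- Indexed by the integer vector `y` rather than by basis coordinates `z`, because closeness
      -- to `x` bounds the entries of `y`.
      Far : Vector ℤ (k ℕ.+ 15) → ℚ → Set
      Far y ε = ∀ z → (∀ j → image (B k) z j ≡ y j) → ¬ (dist z ≼ r +ℝ fromℚ ε)
      shrink : Shrinking Far
      shrink y l f z e h = f z e (≼-trans h (+-mono-≼ ≼-refl (fromℚ-≼ l)))
      resp : ∀ {y w ε} → (∀ j → y j ≡ w j) → Far y ε → Far w ε
      resp e f z e′ = f z λ j → trans (e′ j) (sym (e j))
      exists : ∀ y → ∃[ ε ] (0ℚ ℚ.< ε × Far y ε)
      exists y = by-membership em
        where
        by-membership : Dec (∃[ z ] (∀ j → image (B k) z j ≡ y j)) → ∃[ ε ] (0ℚ ℚ.< ε × Far y ε)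
        by-membership (no ∉) = 1ℚ , ℚP.positive⁻¹ 1ℚ , λ z e _ → ∉ (z , e)
        by-membership (yes (z , e)) = from-gap (gap (⋠⇒< λ h → far (z , h)))
          where
          from-gap : ∃[ ε ] (0ℚ ℚ.< ε × ¬ (dist z ≼ r +ℝ fromℚ ε)) → ∃[ ε ] (0ℚ ℚ.< ε × Far y ε)
          from-gap (ε , 0<ε , h) = ε , 0<ε , λ z′ e′ l → h (≼-trans (≃⇒≼ (norm-cong λ j →
            +-cong ≃-refl (neg-cong (*-cong
              (R.reflexive (cong fromℤ (trans (e j) (sym (e′ j))))) ≃-refl)))) l)
      -- Every ε used below is at most 1, so only points within r + 1 of `x` matter. There the
      -- weighted norm of the integer vector is at most 2a⁻¹(∥x∥² + (r + 1)²), which bounds each of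
      -- its entries.
      r+1 : ℝ
      r+1 = r +ℝ 1ℝ
      box : ∃[ M ] a⁻¹ *ℝ (fromℕ 2 *ℝ (sumsq x +ℝ r+1 *ℝ r+1)) ≼ fromℕ M
      box = archimedean _
      0≼r+1 : 0ℝ ≼ r+1
      0≼r+1 = ≼-resp (+-identityˡ 0ℝ) ≃-refl (+-mono-≼ 0≼r 0≼1)
      in-box : ∀ z → dist z ≼ r+1 → ∀ j → ℤ.∣ image (B k) z j ∣ ℕ.≤ proj₁ box
      in-box z h j = z²≤M⇒∣z∣≤M (image (B k) z j) (ℤP.≤-trans (y²≤weighted k (image (B k) z) j)
        (fromℤ-cancel-≼ (≼-trans (≼-resp
            (≃-trans (*-cong ≃-refl (sumsq-ι (image (B k) z))) (a⁻¹*[a*x]≃x _)) ≃-refl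
            (*-monoʳ-≼ 0≼a⁻¹ (≼-trans (sumsq-bound x (point z))
              (*-monoʳ-≼ (0≼fromℕ 2) (+-mono-≼ ≼-refl
                (√x≼r⇒x≼r² (0≼sumsq (x -ᵥ point z)) 0≼r+1 h))))))
          (proj₂ box))))
      refute : ¬ (∃[ ε ] (0ℚ ℚ.< ε × (∀ y → (∀ j → ℤ.∣ y j ∣ ℕ.≤ proj₁ box) → Far y ε)))
      refute (ε , 0<ε , f) = at (smaller 0<ε (ℚP.positive⁻¹ 1ℚ))
        where
        at : ¬ (∃[ ε′ ] (0ℚ ℚ.< ε′ × ε′ ℚ.≤ ε × ε′ ℚ.≤ 1ℚ))
        at (ε′ , 0<ε′ , ε′≤ε , ε′≤1) = no-point (c ε′ 0<ε′ x)
          where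
          no-point : ¬ (Σ[ v ∈ ℝ^ (k ℕ.+ 15) ] (v ∈ Λ × ∥ x -ᵥ v ∥ ≤ r +ℝ fromℚ ε′))
          no-point (v , v∈Λ , h) = no-integer-point (∈Λ⇒point v∈Λ)
            where
            no-integer-point : ¬ (∃[ z ] (∀ j → v j ≃ point z j))
            no-integer-point (z , e) = f (image (B k) z)
              (in-box z (≼-trans near (+-mono-≼ ≼-refl (fromℚ-≼ ε′≤1)))) z (λ j → refl)
              (≼-trans near (+-mono-≼ ≼-refl (fromℚ-≼ ε′≤ε)))
              where
              near : dist z ≼ r +ℝ fromℚ ε′
              near = ≼-trans (≃⇒≼ (norm-cong λ j → +-cong ≃-refl (neg-cong (≃-sym (e j))))) (≤⇒≼ h)

  -- The supremum of the uncovered rationals, a cut that contains 0 by `¬covers-0` and is bounded by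
  -- `bounded`. Every r + ε covers, so r covers by `closed`; a covering s < r would lie at or below
  -- some uncovered rational.
  coveringRadius : ∃[ r ] IsCoveringRadius Λ r
  coveringRadius = is-radius (cut Uncovered
      (λ _ p≤q ¬c c → ¬c (covers-mono {Λ = Λ} (fromℚ-≼ p≤q) c)) ¬covers-0
      (proj₁ bounded) (λ ¬c → ¬c (proj₂ bounded)))
    where
    Uncovered : ℚ → Set
    Uncovered q = ¬ Covers Λ (fromℚ q)
    is-radius : Cut Uncovered → ∃[ r ] IsCoveringRadius Λ r
    is-radius c₀ = r , 0≼r .≼⇒≤ , closed 0≼r covers-above
        , λ s 0≤s c → minimal {s} (≤⇒≼ {0ℝ} {s} 0≤s) c .≼⇒≤
      where
      open Cut c₀ renaming (sup to r)
      0≼r : 0ℝ ≼ r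
      0≼r = pointwise-0≼ approx≥0
      covers-above : ∀ ε → 0ℚ ℚ.< ε → Covers Λ (r +ℝ fromℚ ε)
      covers-above ε 0<ε = covers-mono {Λ = Λ}
        (≼-trans (≃⇒≼ (fromℚ-+ (approx n) (unit-fraction n)))
          (+-mono-≼ (approx≼ n) (fromℚ-≼ (δ≤ n 0<ε ℕP.≤-refl))))
        (decidable-stable em (above n))
        where
        n : ℕ
        n = ↧ₙ ε
      minimal : ∀ {s} → 0ℝ ≼ s → Covers Λ s → r ≼ s
      minimal {s} 0≼s c = decidable-stable em λ r⋠s → below-s (gap (⋠⇒< r⋠s))
        where
        below-s : ¬ (∃[ ε ] (0ℚ ℚ.< ε × ¬ (r ≼ s +ℝ fromℚ ε)))
        below-s (ε , 0<ε , h) = below n (covers-mono {Λ = Λ} (⋠⇒≽ λ aₙ≼s → h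
            (≼-trans (≼approx+ n) (≼-trans (≃⇒≼ (fromℚ-+ (approx n) (unit-fraction n)))
              (+-mono-≼ aₙ≼s (fromℚ-≼ (δ≤ n 0<ε ℕP.≤-refl)))))) c)
          where
          n : ℕ
          n = ↧ₙ ε

-- The scale factors for volume one.

1^≃1 : ∀ n → 1ℝ ^ n ≃ 1ℝ
1^≃1 zero    = ≃-refl
1^≃1 (suc n) = ≃-trans (*-identityˡ (1ℝ ^ n)) (1^≃1 n)

^-inverse : ∀ {x y} n → x *ℝ y ≃ 1ℝ → x ^ n *ℝ y ^ n ≃ 1ℝ
^-inverse {x} {y} n h = ≃-trans (≃-sym (ℝᶜ^.^-distrib-* x y n)) (≃-trans (ℝ^.^-congˡ n h) (1^≃1 n))

¼ℝ : ℝ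
¼ℝ = fromℚ (+ 1 ℚ./ 4)

-- With τ = t²¹, T = tᵈ and T² = 2 for d = k + 15, the first k coordinates are
-- scaled by τ and the last 15 by τT/4, so that τ² = 8(τT/4)²; the volume is
-- 2¹² τᵏ (τT/4)¹⁵ = 2⁻¹⁸ τᵈ T¹⁵ = 2⁻¹⁸ T³⁶ = 1.
module Scales (k : ℕ) (t t⁻¹ : ℝ) (t*t⁻¹≃1 : t *ℝ t⁻¹ ≃ 1ℝ)
    (T²≃2 : t ^ (k ℕ.+ 15) *ℝ t ^ (k ℕ.+ 15) ≃ fromℕ 2) where

  T τ σ σ⁻¹ : ℝ
  T   = t ^ (k ℕ.+ 15)
  -- In minimal norm 8 the volume is 2^((3d-21)/2); dividing √8 by its d-th root gives 2^(21/2d) =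
  -- t²¹.
  τ   = t ^ 21
  σ   = ¼ℝ *ℝ (τ *ℝ T)
  σ⁻¹ = fromℕ 4 *ℝ (t⁻¹ ^ 21 *ℝ t⁻¹ ^ (k ℕ.+ 15))

  σ*σ⁻¹≃1 : σ *ℝ σ⁻¹ ≃ 1ℝ
  σ*σ⁻¹≃1 = begin
    ¼ℝ *ℝ (τ *ℝ T) *ℝ (fromℕ 4 *ℝ (t⁻¹ ^ 21 *ℝ t⁻¹ ^ (k ℕ.+ 15)))
      ≈⟨ solve 4 (λ x y z w → con (+ 1 ℚ./ 4) :* (x :* y) :* (con (natℚ 4) :* (z :* w)) := x :* z :* (y :* w))
           ≃-refl τ T (t⁻¹ ^ 21) (t⁻¹ ^ (k ℕ.+ 15)) ⟩
    τ *ℝ t⁻¹ ^ 21 *ℝ (T *ℝ t⁻¹ ^ (k ℕ.+ 15))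
      ≈⟨ *-cong (^-inverse 21 t*t⁻¹≃1) (^-inverse (k ℕ.+ 15) t*t⁻¹≃1) ⟩
    1ℝ *ℝ 1ℝ
      ≈⟨ *-identityˡ 1ℝ ⟩
    1ℝ ∎

  scale : ∀ l → Vector ℝ (l ℕ.+ 15)
  scale zero    i       = σ
  scale (suc l) zero    = τ
  scale (suc l) (suc i) = scale l i

  8σ²≃τ² : σ *ℝ σ *ℝ fromℕ 8 ≃ τ *ℝ τ
  8σ²≃τ² = begin
    ¼ℝ *ℝ (τ *ℝ T) *ℝ (¼ℝ *ℝ (τ *ℝ T)) *ℝ fromℕ 8
      ≈⟨ solve 2 (λ x y → con (+ 1 ℚ./ 4) :* (x :* y) :* (con (+ 1 ℚ./ 4) :* (x :* y)) :* con (natℚ 8)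
           := con ½ :* (y :* y) :* (x :* x)) ≃-refl τ T ⟩
    ½ℝ *ℝ (T *ℝ T) *ℝ (τ *ℝ τ)
      ≈⟨ *-cong (*-cong ≃-refl T²≃2) ≃-refl ⟩
    ½ℝ *ℝ fromℕ 2 *ℝ (τ *ℝ τ)
      ≈⟨ solve 1 (λ x → con ½ :* con (natℚ 2) :* x := x) ≃-refl (τ *ℝ τ) ⟩
    τ *ℝ τ ∎

  scale²≃σ²ω : ∀ l i → scale l i *ℝ scale l i ≃ σ *ℝ σ *ℝ fromℤ (ω l i)
  scale²≃σ²ω zero    i       = ≃-sym (R.*-identityʳ (σ *ℝ σ))
  scale²≃σ²ω (suc l) zero    = ≃-sym 8σ²≃τ²
  scale²≃σ²ω (suc l) (suc i) = scale²≃σ²ω l i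

  ∏scale : ∀ l → ∏ (scale l) ≃ τ ^ l *ℝ σ ^ 15
  ∏scale zero    = ≃-sym (*-identityˡ (σ ^ 15))
  ∏scale (suc l) = ≃-trans (*-cong ≃-refl (∏scale l)) (≃-sym (*-assoc τ (τ ^ l) (σ ^ 15)))

  τᵈ≃T²¹ : τ ^ (k ℕ.+ 15) ≃ T ^ 21
  τᵈ≃T²¹ = begin
    (t ^ 21) ^ (k ℕ.+ 15)     ≈⟨ ℝ^.^-assocʳ t 21 (k ℕ.+ 15) ⟩
    t ^ (21 ℕ.* (k ℕ.+ 15))   ≡⟨ cong (t ^_) (ℕP.*-comm 21 (k ℕ.+ 15)) ⟩
    t ^ ((k ℕ.+ 15) ℕ.* 21)   ≈⟨ ℝ^.^-assocʳ t (k ℕ.+ 15) 21 ⟨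
    (t ^ (k ℕ.+ 15)) ^ 21     ∎

  T³⁶≃2¹⁸ : T ^ 36 ≃ fromℕ 2 ^ 18
  T³⁶≃2¹⁸ = ≃-trans (≃-sym (ℝ^.^-assocʳ T 2 18))
    (ℝ^.^-congˡ 18 (≃-trans (*-cong ≃-refl (R.*-identityʳ T)) T²≃2))

  2¹²4⁻¹⁵2¹⁸≃1 : fromℕ 4096 *ℝ ¼ℝ ^ 15 *ℝ fromℕ 2 ^ 18 ≃ 1ℝ
  2¹²4⁻¹⁵2¹⁸≃1 = begin
    fromℕ 4096 *ℝ ¼ℝ ^ 15 *ℝ fromℕ 2 ^ 18
      ≈⟨ *-cong (*-cong (fromℕ-^ 4 6) ≃-refl) (≃-sym (ℝ^.^-assocʳ (fromℕ 2) 2 9)) ⟩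
    fromℕ 4 ^ 6 *ℝ ¼ℝ ^ 15 *ℝ (fromℕ 2 ^ 2) ^ 9
      ≈⟨ *-cong ≃-refl (ℝ^.^-congˡ 9 (≃-sym (fromℕ-^ 2 2))) ⟩
    fromℕ 4 ^ 6 *ℝ ¼ℝ ^ 15 *ℝ fromℕ 4 ^ 9
      ≈⟨ solve 3 (λ x y z → x :* y :* z := x :* z :* y) ≃-refl (fromℕ 4 ^ 6) (¼ℝ ^ 15) (fromℕ 4 ^ 9) ⟩
    fromℕ 4 ^ 6 *ℝ fromℕ 4 ^ 9 *ℝ ¼ℝ ^ 15
      ≈⟨ *-cong (≃-sym (ℝ^.^-homo-* (fromℕ 4) 6 9)) ≃-refl ⟩
    fromℕ 4 ^ 15 *ℝ ¼ℝ ^ 15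
      ≈⟨ ^-inverse 15 (solve 0 (con (natℚ 4) :* con (+ 1 ℚ./ 4) := con 1ℚ) ≃-refl) ⟩
    1ℝ ∎

  volume≃1 : fromℕ 4096 *ℝ ∏ (scale k) ≃ 1ℝ
  volume≃1 = begin
    fromℕ 4096 *ℝ ∏ (scale k)
      ≈⟨ *-cong ≃-refl (∏scale k) ⟩
    fromℕ 4096 *ℝ (τ ^ k *ℝ σ ^ 15)
      ≈⟨ *-cong ≃-refl (*-cong ≃-refl (≃-trans (ℝᶜ^.^-distrib-* ¼ℝ (τ *ℝ T) 15)
           (*-cong ≃-refl (ℝᶜ^.^-distrib-* τ T 15)))) ⟩
    fromℕ 4096 *ℝ (τ ^ k *ℝ (¼ℝ ^ 15 *ℝ (τ ^ 15 *ℝ T ^ 15)))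
      ≈⟨ solve 5 (λ v x q y z → v :* (x :* (q :* (y :* z))) := v :* q :* (x :* y :* z)) ≃-refl
           (fromℕ 4096) (τ ^ k) (¼ℝ ^ 15) (τ ^ 15) (T ^ 15) ⟩
    fromℕ 4096 *ℝ ¼ℝ ^ 15 *ℝ (τ ^ k *ℝ τ ^ 15 *ℝ T ^ 15)
      ≈⟨ *-cong ≃-refl (*-cong (≃-trans (≃-sym (ℝ^.^-homo-* τ k 15)) τᵈ≃T²¹) ≃-refl) ⟩
    fromℕ 4096 *ℝ ¼ℝ ^ 15 *ℝ (T ^ 21 *ℝ T ^ 15)
      ≈⟨ *-cong ≃-refl (≃-trans (≃-sym (ℝ^.^-homo-* T 21 15)) T³⁶≃2¹⁸) ⟩
    fromℕ 4096 *ℝ ¼ℝ ^ 15 *ℝ fromℕ 2 ^ 18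
      ≈⟨ 2¹²4⁻¹⁵2¹⁸≃1 ⟩
    1ℝ ∎

  scaling : Scaling k
  scaling = record
    { s = scale k ; a = σ *ℝ σ ; a⁻¹ = σ⁻¹ *ℝ σ⁻¹
    ; a*a⁻¹≃1 = ≃-trans (solve 2 (λ x y → x :* x :* (y :* y) := x :* y :* (x :* y)) ≃-refl σ σ⁻¹)
        (≃-trans (*-cong σ*σ⁻¹≃1 σ*σ⁻¹≃1) (*-identityˡ 1ℝ))
    ; 0≼a = 0≼x² σ ; 0≼a⁻¹ = 0≼x² σ⁻¹
    ; s²≃aω = scale²≃σ²ω k ; volume = volume≃1 }

  -- 8a = τ² is the squared minimum after rescaling. Its d-th power is an integer, so the comparison
  -- with d/4 can be made between natural numbers.
  [8a]ᵈ≃2²¹ : (σ *ℝ σ *ℝ fromℕ 8) ^ (k ℕ.+ 15) ≃ fromℕ (2 ℕ.^ 21)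
  [8a]ᵈ≃2²¹ = begin
    (σ *ℝ σ *ℝ fromℕ 8) ^ (k ℕ.+ 15)   ≈⟨ ℝ^.^-congˡ (k ℕ.+ 15) 8σ²≃τ² ⟩
    (τ *ℝ τ) ^ (k ℕ.+ 15)              ≈⟨ ℝᶜ^.^-distrib-* τ τ (k ℕ.+ 15) ⟩
    τ ^ (k ℕ.+ 15) *ℝ τ ^ (k ℕ.+ 15)   ≈⟨ *-cong τᵈ≃T²¹ τᵈ≃T²¹ ⟩
    T ^ 21 *ℝ T ^ 21                   ≈⟨ ℝᶜ^.^-distrib-* T T 21 ⟨
    (T *ℝ T) ^ 21                      ≈⟨ ℝ^.^-congˡ 21 T²≃2 ⟩
    fromℕ 2 ^ 21                       ≈⟨ fromℕ-^ 2 21 ⟨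
    fromℕ (2 ℕ.^ 21)                   ∎

fromℕ-* : ∀ m n → fromℕ (m ℕ.* n) ≃ fromℕ m *ℝ fromℕ n
fromℕ-* m n = ≃-trans (R.reflexive (cong fromℤ (ℤP.pos-* m n))) (fromℤ-* (+ m) (+ n))

-- Comparison of the hole with √d/2, and the theorem.

module Deep (em : ExcludedMiddle 0ℓ) {k : ℕ} (S : Scaling k) (V : ℕ)
    ([8a]ᵈ≃V : (Scaling.a S *ℝ fromℕ 8) ^ (k ℕ.+ 15) ≃ fromℕ V)
    (V-large : (2 ℕ.* (k ℕ.+ 15)) ℕ.^ (k ℕ.+ 15) ℕ.< V ℕ.* (2 ℕ.* k ℕ.+ 7) ℕ.^ (k ℕ.+ 15)) where
  open Classical em
  open Scaling S
  open Scaled S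
  open Covering em S

  d A : ℕ
  d = k ℕ.+ 15
  A = 2 ℕ.* k ℕ.+ 7

  ½√d : ℝ
  ½√d = ½ℝ *ℝ √ fromℕ d

  -- Here 8k + 28 = 4A with A = 2k + 7 = 2d - 23. Doubling turns the inequality into 8a · A ≤ 2d,
  -- and its d-th power into V Aᵈ ≤ (2d)ᵈ, against `V-large`.
  hole⋠d : ¬ (a *ℝ fromℕ (8 ℕ.* k ℕ.+ 28) ≼ fromℕ d)
  hole⋠d h = ℕP.<⇒≱ V-large (drop (fromℤ-cancel-≼ powers))
    where
    drop : ∀ {m n} → + m ℤ.≤ + n → m ℕ.≤ n
    drop (ℤ.+≤+ l) = l
    8k+28≡4A : 8 ℕ.* k ℕ.+ 28 ≡ 4 ℕ.* A
    8k+28≡4A = sym (trans (ℕP.*-distribˡ-+ 4 (2 ℕ.* k) 7) (cong (ℕ._+ 28) (sym (ℕP.*-assoc 4 2 k))))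
    scaled : a *ℝ fromℕ 8 *ℝ fromℕ A ≼ fromℕ (2 ℕ.* d)
    scaled = ≼-resp
      (≃-trans (*-cong ≃-refl (*-cong ≃-refl (≃-trans (R.reflexive (cong fromℕ 8k+28≡4A)) (fromℕ-* 4 A))))
        (solve 2 (λ a x → con (natℚ 2) :* (a :* (con (natℚ 4) :* x)) := a :* con (natℚ 8) :* x)
          ≃-refl a (fromℕ A)))
      (≃-sym (fromℕ-* 2 d))
      (*-monoʳ-≼ (0≼fromℕ 2) h)
    powers : fromℕ (V ℕ.* A ℕ.^ d) ≼ fromℕ ((2 ℕ.* d) ℕ.^ d)
    powers = ≼-resp
      (begin
        (a *ℝ fromℕ 8 *ℝ fromℕ A) ^ d         ≈⟨ ℝᶜ^.^-distrib-* (a *ℝ fromℕ 8) (fromℕ A) d ⟩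
        (a *ℝ fromℕ 8) ^ d *ℝ fromℕ A ^ d     ≈⟨ *-cong [8a]ᵈ≃V (≃-sym (fromℕ-^ A d)) ⟩
        fromℕ V *ℝ fromℕ (A ℕ.^ d)            ≈⟨ fromℕ-* V (A ℕ.^ d) ⟨
        fromℕ (V ℕ.* A ℕ.^ d)                 ∎)
      (≃-sym (fromℕ-^ (2 ℕ.* d) d))
      (proj₂ (^-mono-≼ d (*-nonneg (*-nonneg 0≼a (0≼fromℕ 8)) (0≼fromℕ A)) scaled))

  -- By contraposition: r ≤ √d/2 would give a (8k + 28) ≤ 4r² ≤ d, which `hole⋠d` excludes.
  covers⇒½√d< : ∀ {r} → Covers Λ r → ½√d < r
  covers⇒½√d< {r} c = ⋠⇒< λ r≼½√d → hole⋠d (≼-trans hole≼4r² (≼-resp ≃-refl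
      (≃-trans (solve 1 (λ q → con (natℚ 4) :* (con ½ :* q :* (con ½ :* q)) := q :* q) ≃-refl (√ fromℕ d))
        (√x*√x≃x (0≼fromℕ d)))
      (*-monoʳ-≼ (0≼fromℕ 4)
        (*-mono-≼ 0≼r (≼-trans 0≼r r≼½√d) r≼½√d r≼½√d))))
    where
    0≼r : 0ℝ ≼ r
    0≼r = proj₁ (covers⇒hole≼ {r} c)
    hole≼4r² : a *ℝ fromℕ (8 ℕ.* k ℕ.+ 28) ≼ fromℕ 4 *ℝ (r *ℝ r)
    hole≼4r² = proj₂ (covers⇒hole≼ {r} c)

  deep : Σ[ Λ ∈ Lattice d ] Σ[ r ∈ ℝ ] (WellRounded Λ × Unimodular Λ × IsCoveringRadius Λ r × ½√d < r)
  deep = Λ , proj₁ coveringRadius , wellRounded , unimodular , proj₂ coveringRadius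
    , covers⇒½√d< {proj₁ coveringRadius} (proj₁ (proj₂ (proj₂ coveringRadius)))

Example : ℕ → Set
Example d = Σ[ Λ ∈ Lattice d ] Σ[ r ∈ ℝ ]
  (WellRounded Λ × Unimodular Λ × IsCoveringRadius Λ r × ½ℝ *ℝ √ (fromℕ d) < r)

example : ExcludedMiddle 0ℓ → ∀ j → Example (j ℕ.+ 15 ℕ.+ 15)
example em j = from-root (Cuts.root em m)
  where
  k d m : ℕ
  k = j ℕ.+ 15
  d = k ℕ.+ 15
  -- `root` takes the predecessor of its exponent, so this choice gives t²ᵈ = 2.
  m = ℕ.pred (2 ℕ.* d)
  V-large : ∀ V → (2 ℕ.* 30) ℕ.^ 30 ℕ.< V ℕ.* 37 ℕ.^ 30 →
    (2 ℕ.* d) ℕ.^ d ℕ.< V ℕ.* (2 ℕ.* k ℕ.+ 7) ℕ.^ d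
  V-large V h = subst₂ (λ n A → (2 ℕ.* n) ℕ.^ n ℕ.< V ℕ.* A ℕ.^ n)
    (sym (ℕP.+-assoc j 15 15))
    (trans (sym (ℕP.+-assoc (2 ℕ.* j) 30 7)) (cong (ℕ._+ 7) (sym (ℕP.*-distribˡ-+ 2 j 15))))
    (ratio-bound V 37 30 refl h j)
  from-root : ∃[ t ] t ^ suc m ≃ fromℕ 2 → Example d
  from-root (t , t^[1+m]≃2) = Deep.deep em (Scales.scaling k t t⁻¹ t*t⁻¹≃1 T²≃2) (2 ℕ.^ 21)
      (Scales.[8a]ᵈ≃2²¹ k t t⁻¹ t*t⁻¹≃1 T²≃2) (V-large (2 ℕ.^ 21) dimension-30)
    where
    t⁻¹ : ℝ
    -- Since t · tᵐ = 2, halving tᵐ inverts t without a division of reals.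
    t⁻¹ = ½ℝ *ℝ t ^ m
    t*t⁻¹≃1 : t *ℝ t⁻¹ ≃ 1ℝ
    t*t⁻¹≃1 = begin
      t *ℝ (½ℝ *ℝ t ^ m)   ≈⟨ solve 2 (λ t u → t :* (con ½ :* u) := con ½ :* (t :* u)) ≃-refl t (t ^ m) ⟩
      ½ℝ *ℝ t ^ suc m      ≈⟨ *-cong ≃-refl t^[1+m]≃2 ⟩
      ½ℝ *ℝ fromℕ 2        ≈⟨ solve 0 (con ½ :* con (natℚ 2) := con 1ℚ) ≃-refl ⟩
      1ℝ                   ∎
    1+m≡d+d : suc m ≡ d ℕ.+ d
    1+m≡d+d = trans (ℕP.suc-pred (2 ℕ.* d) {{ℕ.>-nonZero 0<2d}}) (cong (d ℕ.+_) (ℕP.+-identityʳ d))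
      where
      0<2d : 0 ℕ.< 2 ℕ.* d
      0<2d = ℕP.<-≤-trans (ℕP.<-≤-trans (ℕ.s≤s ℕ.z≤n) (ℕP.m≤n+m 15 k)) (ℕP.m≤m+n d (d ℕ.+ 0))
    T²≃2 : t ^ d *ℝ t ^ d ≃ fromℕ 2
    T²≃2 = ≃-trans (≃-sym (ℝ^.^-homo-* t d d))
      (≃-trans (R.reflexive (cong (t ^_) (sym 1+m≡d+d))) t^[1+m]≃2)

mainTheorem2 : ExcludedMiddle 0ℓ → ∀ (d : ℕ) → 30 ≤ℕ d →
    (∀ N → IsN d N → ½ℝ *ℝ √ (fromℕ d) < N) ×
    (Σ[ Λ ∈ Lattice d ] Σ[ r ∈ ℝ ]
    (WellRounded Λ × Unimodular Λ × IsCoveringRadius Λ r × ½ℝ *ℝ √ (fromℕ d) < r))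
mainTheorem2 em d 30≤d = exceeds witness , witness
  where
  open Classical em
  witness : Example d
  witness = subst Example (trans (ℕP.+-assoc (d ℕ.∸ 30) 15 15) (ℕP.m∸n+n≡m 30≤d)) (example em (d ℕ.∸ 30))
  exceeds : Example d → ∀ N → IsN d N → ½ℝ *ℝ √ (fromℕ d) < N
  -- The covering radius r of the example is at most N, so N ≤ √d/2 would contradict √d/2 < r.
  exceeds (Λ , r , wr , um , cr , ½√d<r) N (upper , _) = ⋠⇒< λ N≼½√d →
    <⇒⋠ {½ℝ *ℝ √ (fromℕ d)} {r} ½√d<r (≼-trans (≤⇒≼ {r} {N} (upper r (Λ , wr , um , cr))) N≼½√d)
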